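{- Let $\lambda=(\lambda_1\ge\dots\ge\lambda_n)$ be a partition. Then $$G_\lambda^{(\beta)}=\mathscr{L}_{w_0,\lambda}=\sum_{P\in\mathscr{P}^+(\lambda)} x^P,$$ where $w_0\in S_n$ is the longest permutation.
   Context: Operators on $\mathbb{Z}[\beta][x_1,\dots,x_n]$: $\partial_i f=(f-s_if)/(x_i-x_{i+1})$ where $s_i$ swaps $x_i,x_{i+1}$, and $\pi_i^{(\beta)}f=\partial_i(x_if+\beta x_ix_{i+1}f)$. For $w\in S_n$, $\mathscr{L}_{w,\lambda}=\pi^{(\beta)}_{i_k}\cdots\pi^{(\beta)}_{i_1}(x^\lambda)$ where $w=s_{i_1}\cdots s_{i_k}$ is reduced and $x^\lambda=x_1^{\lambda_1}\cdots x_n^{\lambda_n}$ (well defined by braid relations); the Grassmannian Grothendieck polynomial $G^{(\beta)}_\lambda$ is $\mathscr{L}_{w_0,\lambda}$. A Gelfand--Zetlin pattern is an integer array $(a_{ij})_{0\le i\le n-1,\,1\le j\le n-i}$ with $a_{0j}=\lambda_{n+1-j}$ and $a_{i-1,j}\le a_{ij}\le a_{i-1,j+1}$; row $i$ is $a_{i1},\dots,a_{i,n-i}$. Entries $a_{ij}$ and $a_{i-1,j}$, resp. $a_{ij}$ and $a_{i-1,j+1}$, are neighbors; a triangle consists of top-left $a_{i-1,j}$, top-right $a_{i-1,j+1}$, bottom $a_{ij}$. An enhanced pattern is a GZ pattern with some entries encircled and some pairs of neighbors joined by edges, such that: (1) all entries of row $0$ are encircled; (2) entries joined by an edge are equal and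 the lower one is encircled; (3) for $1\le i\le n-2$, $a_{ij},a_{i,j+1}$ are both joined to $a_{i-1,j+1}$ iff both are joined to $a_{i+1,j}$; (4) if $a_{0j}=a_{0,j+1}$ then $a_{1j}$ is encircled and joined to both; (5) if a triangle has top-left $a$, top-right $b>a$, bottom $a$, then the bottom is encircled and joined to the top-left; (6) if a triangle has top-left $a$, top-right $b>a$, bottom $b$ encircled, then the bottom is joined to the top-right; (7) if all three entries of a triangle are equal and the two top entries are connected by a path of edges, the bottom is encircled and joined to both; (8) if all three entries of a triangle are equal and the bottom is encircled, it is joined to at least one top entry. The rank $\operatorname{rk}P$ is the number of non-encircled entries. $P$ is inefficient if it has a triangle with all three entries equal whose bottom is not joined by an edge to the top-right entry, and efficient otherwise; $\mathscr{P}^+(\lambda)$ is the set of efficient enhanced patterns with top row $\lambda$. For efficient $P$: let $S_i$ be the sum of row $i$ ($S_0=\sum\lambda_k$), $D_i$ the number of non-encircled entries in row $i$, with $S_n=D_n=0$; set $d_{n+1-i}=S_{i-1}-S_i+D_i$ for $1\le i\le n$ and $x^P=\beta^{\operatorname{rk}P}x_1^{d_1}\cdots x_n^{d_n}$. -}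

module Defs where

open import Data.Nat as ℕ using (ℕ; zero; suc; _+_; _∸_; _≤_; _<_; _≥_; _≤ᵇ_; _≡ᵇ_)
open import Data.Integer as ℤ using (ℤ; +_)
open import Data.Bool using (Bool; true; false; if_then_else_; not; T; _∧_)
open import Data.Fin using (Fin; toℕ)
open import Data.Maybe using (Maybe; just; nothing; maybe; fromMaybe)
open import Data.Product using (_×_; _,_)
open import Data.Sum using (_⊎_)
open import Data.List as List using (List; []; _∷_; _++_; upTo; applyUpTo; concatMap; length)
open import Data.Vec as Vec using (Vec; []; _∷_; zipWith; replicate; tabulate; toList)
import Data.Vec.Properties as VecP
import Data.Nat.Properties as ℕP
open import Data.List.Relation.Unary.Linked using (Linked)
open import Relation.Nullary using (does)
open import Relation.Binary.PropositionalEquality using (_≡_)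
open import Relation.Binary.Construct.Closure.ReflexiveTransitive using (Star)

-- Polynomials in Z[β][x_1,…,x_n]
-- A term (c , k , a) stands for c · β^k · x_1^{a_1} ⋯ x_n^{a_n}.
-- A polynomial is a finite list of terms (formal sum); equality of
-- polynomials is equality of all coefficients (see _≈ₚ_).

Term : ℕ → Set
Term n = ℤ × ℕ × Vec ℕ n

Poly : ℕ → Set
Poly n = List (Term n)

vget : ∀ {n} → Vec ℕ n → ℕ → ℕ
vget []       _       = 0
vget (x ∷ xs) zero    = x
vget (x ∷ xs) (suc p) = vget xs p

vset : ∀ {n} → Vec ℕ n → ℕ → ℕ → Vec ℕ n
vset []       _       _ = []
vset (x ∷ xs) zero    v = v ∷ xs
vset (x ∷ xs) (suc p) v = x ∷ vset xs p v

coeff : ∀ {n} → Poly n → ℕ → Vec ℕ n → ℤ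
coeff []                  k d = + 0
coeff ((c , k' , a) ∷ p)  k d =
  if (k ≡ᵇ k') ∧ does (VecP.≡-dec ℕP._≟_ d a)
  then c ℤ.+ coeff p k d else coeff p k d

infix 4 _≈ₚ_
_≈ₚ_ : ∀ {n} → Poly n → Poly n → Set
p ≈ₚ q = ∀ k d → coeff p k d ≡ coeff q k d

mulMono : ∀ {n} → ℕ → Vec ℕ n → Poly n → Poly n
mulMono b e = List.map (λ { (c , k , a) → c , k + b , zipWith _+_ a e })

-- exponent vector of the variable x_i (1-based i)
xVar : (n : ℕ) → ℕ → Vec ℕ n
xVar n i = vset (replicate n 0) (i ∸ 1) 1

-- Divided difference ∂_i (1-based i) applied to a single term
-- c β^k x^a, where u = a_i, v = a_{i+1}:
--   (x_i^u x_{i+1}^v − x_i^v x_{i+1}^u)/(x_i − x_{i+1})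
--   = Σ_{t < u−v} x_i^{v+t} x_{i+1}^{u−1−t}          if u ≥ v,
--   = − Σ_{t < v−u} x_i^{u+t} x_{i+1}^{v−1−t}        if u < v,
-- times the other variables (exact polynomial division).
ddTerm : ∀ {n} → ℕ → Term n → Poly n
ddTerm i (c , k , a) =
  let p = i ∸ 1 ; u = vget a p ; v = vget a (suc p) in
  if v ≤ᵇ u
  then List.map (λ t → c , k , vset (vset a p (v + t)) (suc p) (u ∸ 1 ∸ t)) (upTo (u ∸ v))
  else List.map (λ t → ℤ.- c , k , vset (vset a p (u + t)) (suc p) (v ∸ 1 ∸ t)) (upTo (v ∸ u))

-- ∂_i f = (f − s_i f)/(x_i − x_{i+1})   (extended linearly)
∂ : ∀ {n} → ℕ → Poly n → Poly n
∂ i = concatMap (ddTerm i)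

πβ : ∀ {n} → ℕ → Poly n → Poly n
πβ {n} i f = ∂ i (mulMono 0 (xVar n i) f ++ mulMono 1 (zipWith _+_ (xVar n i) (xVar n (suc i))) f)

xPow : ∀ {n} → Vec ℕ n → Poly n
xPow la = (+ 1 , 0 , la) ∷ []

-- For a word [i₁, …, i_k] (w = s_{i₁} ⋯ s_{i_k}) compute
-- π_{i_k} ⋯ π_{i₁} f  (π_{i₁} applied first).
applyWord : ∀ {n} → List ℕ → Poly n → Poly n
applyWord []      f = f
applyWord (i ∷ w) f = applyWord w (πβ i f)

desc : ℕ → List ℕ
desc zero    = []
desc (suc k) = suc k ∷ desc k

-- reduced word of the longest element w₀ ∈ S_n:
-- w₀ = s₁ (s₂ s₁) (s₃ s₂ s₁) ⋯ (s_{n-1} ⋯ s₁)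
w0word : ℕ → List ℕ
w0word n = concatMap desc (applyUpTo suc (n ∸ 1))

-- 𝓛_{w,λ} for w given by a reduced word
𝓛 : ∀ {n} → List ℕ → Vec ℕ n → Poly n
𝓛 w la = applyWord w (xPow la)

Gβ : ∀ {n} → Vec ℕ n → Poly n
Gβ {n} la = 𝓛 (w0word n) la

Partition : ∀ {n} → Vec ℕ n → Set
Partition la = Linked _≥_ (toList la)

-- Enhanced Gelfand–Zetlin patterns
-- A pattern is a list of rows 0 … n-1; row i is the list of cells
-- a_{i1}, …, a_{i,n-i}.  Each cell records the value a_{ij}, whether it
-- is encircled, whether it is joined by an edge to its top-left
-- neighbour a_{i-1,j} (eL) and to its top-right neighbour a_{i-1,j+1}
-- (eR).  Row 0 cells carry no edge flags (they have no upper neighbours).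

record Cell : Set where
  constructor cell
  field
    val  : ℕ
    circ : Bool
    eL   : Bool
    eR   : Bool

Pattern : Set
Pattern = List (List Cell)

nth : ∀ {A : Set} → List A → ℕ → Maybe A
nth []       _       = nothing
nth (x ∷ xs) zero    = just x
nth (x ∷ xs) (suc k) = nth xs k

row : Pattern → ℕ → List Cell
row P i = fromMaybe [] (nth P i)

-- entry (i , j): row i (0-based), column j (1-based, as in the paper)
entry : Pattern → ℕ → ℕ → Maybe Cell
entry P i j = nth (row P i) (j ∸ 1)

val : Pattern → ℕ → ℕ → ℕ
val P i j = maybe Cell.val 0 (entry P i j)

circ eL eR : Pattern → ℕ → ℕ → Bool
circ P i j = maybe Cell.circ false (entry P i j)
eL   P i j = maybe Cell.eL   false (entry P i j)
eR   P i j = maybe Cell.eR   false (entry P i j)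

Valid : ℕ → ℕ → ℕ → Set
Valid n i j = i < n × 1 ≤ j × j ≤ n ∸ i

Shape : ℕ → Pattern → Set
Shape n P = length P ≡ n × (∀ i → i < n → length (row P i) ≡ n ∸ i)

Pos : Set
Pos = ℕ × ℕ

data Edge (n : ℕ) (P : Pattern) : Pos → Pos → Set where
  edgeL : ∀ {i j} → Valid n (suc i) j → T (eL P (suc i) j) → Edge n P (suc i , j) (i , j)
  edgeR : ∀ {i j} → Valid n (suc i) j → T (eR P (suc i) j) → Edge n P (suc i , j) (i , suc j)

Joined : ℕ → Pattern → Pos → Pos → Set
Joined n P x y = Edge n P x y ⊎ Edge n P y x

Connected : ℕ → Pattern → Pos → Pos → Set
Connected n P = Star (Joined n P)

-- Enhanced pattern with top row λ.  Triangles are indexed by the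
-- position (suc i , j) of their bottom entry; top-left is (i , j),
-- top-right is (i , suc j).
record Enhanced (n : ℕ) (la : Vec ℕ n) (P : Pattern) : Set where
  field
    shape   : Shape n P
    -- top row: a_{0j} = λ_{n+1-j}; condition (1); no edge flags in row 0
    top-val  : ∀ j → 1 ≤ j → j ≤ n → val P 0 j ≡ vget la (n ∸ j)
    top-circ : ∀ j → 1 ≤ j → j ≤ n → T (circ P 0 j)
    top-noL  : ∀ j → 1 ≤ j → j ≤ n → eL P 0 j ≡ false
    top-noR  : ∀ j → 1 ≤ j → j ≤ n → eR P 0 j ≡ false
    gz      : ∀ i j → Valid n (suc i) j →
              val P i j ≤ val P (suc i) j × val P (suc i) j ≤ val P i (suc j)
    c2L     : ∀ i j → Valid n (suc i) j → T (eL P (suc i) j) →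
              val P (suc i) j ≡ val P i j × T (circ P (suc i) j)
    c2R     : ∀ i j → Valid n (suc i) j → T (eR P (suc i) j) →
              val P (suc i) j ≡ val P i (suc j) × T (circ P (suc i) j)
    c3      : ∀ i j → 1 ≤ i → i + 2 ≤ n → 1 ≤ j → suc j ≤ n ∸ i →
              ((T (eR P i j) × T (eL P i (suc j))) → (T (eL P (suc i) j) × T (eR P (suc i) j)))
            × ((T (eL P (suc i) j) × T (eR P (suc i) j)) → (T (eR P i j) × T (eL P i (suc j))))
    c4      : ∀ j → 1 ≤ j → suc j ≤ n → val P 0 j ≡ val P 0 (suc j) →
              T (circ P 1 j) × T (eL P 1 j) × T (eR P 1 j)
    c5      : ∀ i j → Valid n (suc i) j → val P i j < val P i (suc j) →
              val P (suc i) j ≡ val P i j →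
              T (circ P (suc i) j) × T (eL P (suc i) j)
    c6      : ∀ i j → Valid n (suc i) j → val P i j < val P i (suc j) →
              val P (suc i) j ≡ val P i (suc j) → T (circ P (suc i) j) →
              T (eR P (suc i) j)
    c7      : ∀ i j → Valid n (suc i) j → val P i j ≡ val P i (suc j) →
              val P (suc i) j ≡ val P i j →
              Connected n P (i , j) (i , suc j) →
              T (circ P (suc i) j) × T (eL P (suc i) j) × T (eR P (suc i) j)
    c8      : ∀ i j → Valid n (suc i) j → val P i j ≡ val P i (suc j) →
              val P (suc i) j ≡ val P i j → T (circ P (suc i) j) →
              T (eL P (suc i) j) ⊎ T (eR P (suc i) j)

Efficient : ℕ → Pattern → Set
Efficient n P = ∀ i j → Valid n (suc i) j → val P i j ≡ val P i (suc j) →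
                val P (suc i) j ≡ val P i j → T (eR P (suc i) j)

InP⁺ : (n : ℕ) → Vec ℕ n → Pattern → Set
InP⁺ n la P = Enhanced n la P × Efficient n P

rowSum : List Cell → ℕ
rowSum = List.foldr (λ c s → Cell.val c + s) 0

rowNonCirc : List Cell → ℕ
rowNonCirc = List.foldr (λ c s → if Cell.circ c then s else suc s) 0

S D : Pattern → ℕ → ℕ
S P i = rowSum (row P i)      -- S_n = 0 automatically (no row n)
D P i = rowNonCirc (row P i)  -- D_n = 0 automatically

rk : Pattern → ℕ
rk P = List.foldr (λ r s → rowNonCirc r + s) 0 P

-- d_{n+1-i} = S_{i-1} − S_i + D_i   (1 ≤ i ≤ n); for index k (0-based,
-- i.e. d_{k+1}) we have i = n − k.  The subtraction is exact for GZ
-- patterns since S_i ≤ S_{i-1}.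
dexp : (n : ℕ) → Pattern → Vec ℕ n
dexp n P = tabulate (λ k → let i = n ∸ toℕ k in (S P (i ∸ 1) + D P i) ∸ S P i)

xP : (n : ℕ) → Pattern → Term n
xP n P = + 1 , rk P , dexp n P

{-# OPTIONS --safe #-}

-- In an efficient pattern the values and circles determine the edges, condition (7) holds automatically, and the
-- circle is forced on an entry equal to its top-left neighbour and free on all others.  The sum over patterns
-- therefore unfolds row by row, and it remains to prove the branching rule (with variables x_0 , … , x_k)
--   W_{k+1} (x^λ) = W_k (x_k^{λ_k} ∏_{j<k} q_j),   (x_j − x_k) q_j = u_j − v_j,
--   u_j = x_j^{λ_j + 1} (1 + β x_k),   v_j = x_j^{λ_{j+1}} x_k^{λ_j − λ_{j+1} + 1} (1 + β x_j),
-- where W_k is the operator of the longest element of S_k.  Both sides are multiplied by the W_k-scalar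
-- ∏_{j<k} (x_j − x_k).  On the left W_{k+1} = W_k π_{k-1} ⋯ π_0, and the two terms of (x_{k-1} − x_k) π_{k-1} f are
-- computed from the symmetry of W_k (x^λ) and from the branching rule for k − 1.  On the right the braid relations
-- give W_k π_j = W_k, and π_j (v_j u_{j+1}) = 0 removes all mixed terms in the product of the u_j − v_j.
module Submission where

open import Defs
open import Level using (0ℓ)
open import Algebra.Bundles using (CommutativeRing)
open import Algebra.Solver.Ring.AlmostCommutativeRing
  using (_-Raw-AlmostCommutative⟶_; fromCommutativeRing)
import Algebra.Solver.Ring
import Algebra.Properties.CommutativeSemigroup
import Algebra.Properties.Group
import Algebra.Properties.Semiring.Exp
open import Data.Bool.Base using (Bool; true; false; _∨_; _∧_; T; if_then_else_)
open import Data.Empty using (⊥-elim)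
open import Data.Fin.Base using (toℕ)
open import Data.Integer.Base as ℤ using (ℤ; +_; -[1+_]; +-*-rawRing)
import Data.Integer.Properties as ℤ
open import Data.Integer.Solver using (module +-*-Solver)
open import Data.List using (List; []; _∷_; _++_; map; concatMap; length; upTo; applyUpTo; cartesianProductWith)
import Data.List.Properties as List
open import Data.List.Membership.Propositional using (_∈_; find; lose)
open import Data.List.Membership.Propositional.Properties
  using (∈-map⁺; ∈-map⁻; ∈-concatMap⁺; ∈-concatMap⁻; ∈-cartesianProductWith⁺; ∈-cartesianProductWith⁻)
open import Data.List.Relation.Unary.All as All using (All; []; _∷_)
open import Data.List.Relation.Unary.AllPairs using ([]; _∷_)
open import Data.List.Relation.Unary.Any using (here; there)
open import Data.List.Relation.Unary.Linked using (Linked; []; [-]; _∷_)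
import Data.List.Relation.Unary.Linked.Properties as Linked
open import Data.List.Relation.Unary.Unique.Propositional using (Unique)
import Data.List.Relation.Unary.Unique.Propositional.Properties as Unique
open import Data.Maybe.Base using (Maybe; just; nothing; maybe)
open import Data.Nat.Base as ℕ using (ℕ; zero; suc; _∸_; _≤_; _<_; _≡ᵇ_; z≤n; s≤s)
import Data.Nat.Properties as ℕ
import Data.Nat.Solver
open import Data.Product using (Σ; _×_; _,_; proj₁; proj₂)
open import Data.Sum.Base as Sum using (_⊎_; inj₁; inj₂)
open import Data.Unit.Base using (tt)
open import Data.Vec using (Vec; []; _∷_; zipWith; replicate; tabulate)
import Data.Vec.Properties as Vec
open import Function.Base using (_∘_; id)
open import Relation.Binary.Construct.Closure.ReflexiveTransitive using (fold)
open import Relation.Binary.PropositionalEquality as ≡ using (_≡_; _≢_)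
import Relation.Binary.Reasoning.Setoid
open import Relation.Nullary using (yes; no; does; ¬_)

open _-Raw-AlmostCommutative⟶_ using (0-homo; 1-homo)

-- The single factors q_j are not symmetric in x_0, ..., x_{k-1}, so none of them can be taken out
-- of W_k. The product of all x_j - x_k is symmetric, passes through W_k, and turns every q_j into a
-- difference of two terms; it can be cancelled at the end because no x_i - x_j is a zero divisor.
-- For the same reason the divided difference is axiomatised only through its product with x_i -
-- x_{i+1}: an identity for π_i then becomes an identity between permuted images of f. The two terms
-- of (x_{k-1} - x_k) π_{k-1} f behave differently. The first leaves f in place, and a symmetric
-- factor can be split off from it. The second contains s_{k-1}, which commutes with W_{k-1} but not
-- with W_k. Hence W_k is written as C_{k-1} W_{k-1}, and the induction hypothesis, stated for the
-- last variable x_{k-1}, is carried over to x_k by s_{k-1}. The polynomial q_j is the sum over one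
-- entry of the next row: every value above the lower bound occurs circled and uncircled, with
-- weights in the ratio 1 : β x_k, and the lower bound itself occurs only circled.

-- Axioms for a ring with variable swaps and divided differences

record SwapRing (N : ℕ) : Set₁ where
  field
    commutativeRing : CommutativeRing 0ℓ 0ℓ
    constants       : +-*-rawRing -Raw-AlmostCommutative⟶ fromCommutativeRing commutativeRing
  open CommutativeRing commutativeRing public
  open _-Raw-AlmostCommutative⟶_ constants public using () renaming (⟦_⟧ to const)
  field
    β        : Carrier
    x        : ℕ → Carrier
    swap     : ℕ → Carrier → Carrier
    ∂ᵣ       : ℕ → Carrier → Carrier
    swap-cong       : ∀ i {f g} → f ≈ g → swap i f ≈ swap i g
    swap-+          : ∀ i f g → swap i (f + g) ≈ swap i f + swap i g
    swap-*          : ∀ i f g → swap i (f * g) ≈ swap i f * swap i g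
    swap-const      : ∀ i c → swap i (const c) ≈ const c
    swap-β          : ∀ i → swap i β ≈ β
    swap-involutive : ∀ i f → swap i (swap i f) ≈ f
    swap-xˡ         : ∀ i → suc i < N → swap i (x i) ≈ x (suc i)
    swap-x-other    : ∀ i j → suc i < N → j ≢ i → j ≢ suc i → swap i (x j) ≈ x j
    swap-comm       : ∀ i j → suc i < j → suc j < N → ∀ f → swap i (swap j f) ≈ swap j (swap i f)
    swap-braid      : ∀ i → suc (suc i) < N → ∀ f →
                      swap i (swap (suc i) (swap i f)) ≈ swap (suc i) (swap i (swap (suc i) f))
    ∂ᵣ-divides      : ∀ i → suc i < N → ∀ f → (x i - x (suc i)) * ∂ᵣ i f ≈ f - swap i f
    x-x-cancel      : ∀ i j → i < j → j < N → ∀ f → (x i - x j) * f ≈ 0# → f ≈ 0#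

-- The operators π and their elementary identities

module Operators {N : ℕ} (R : SwapRing N) where
  open SwapRing R
  open Algebra.Properties.Group +-group using (x≈y⇒x∙y⁻¹≈ε; x∙y⁻¹≈ε⇒x≈y)
  open Algebra.Properties.Semiring.Exp semiring public using (_^_; ^-homo-*; ^-congˡ)
  module ≈R = Relation.Binary.Reasoning.Setoid setoid
  open Algebra.Properties.CommutativeSemigroup *-commutativeSemigroup using (x∙yz≈y∙xz)

  private
    const≟ : ∀ a b → Maybe (const a ≈ const b)
    const≟ a b with a ℤ.≟ b
    ... | yes p = just (reflexive (≡.cong const p))
    ... | no  _ = nothing

  open Algebra.Solver.Ring +-*-rawRing (fromCommutativeRing commutativeRing) constants const≟
    public using (solve; _:=_; _:+_; _:*_; _:-_; :-_; con)

  𝟙 : Carrier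
  𝟙 = const (+ 1)

  𝟙*_ : ∀ f → 𝟙 * f ≈ f
  𝟙*_ = solve 1 (λ f → con (+ 1) :* f := f) refl

  swap-neg : ∀ i f → swap i (- f) ≈ - swap i f
  swap-neg i f = begin
    swap i (- f)                ≈⟨ swap-cong i (solve 1 (λ f → :- f := con (-[1+ 0 ]) :* f) refl f) ⟩
    swap i (const -[1+ 0 ] * f) ≈⟨ swap-* i _ _ ⟩
    swap i (const -[1+ 0 ]) * swap i f ≈⟨ *-congʳ (swap-const i _) ⟩
    const -[1+ 0 ] * swap i f ≈⟨ solve 1 (λ f → con (-[1+ 0 ]) :* f := :- f) refl _ ⟩
    - swap i f ∎
    where open ≈R

  swap-xʳ : ∀ i → suc i < N → swap i (x (suc i)) ≈ x i
  swap-xʳ i i< = trans (swap-cong i (sym (swap-xˡ i i<))) (swap-involutive i (x i))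

  Inv : ℕ → Carrier → Set
  Inv i f = swap i f ≈ f

  Inv-+ : ∀ {i f g} → Inv i f → Inv i g → Inv i (f + g)
  Inv-+ {i} p q = trans (swap-+ i _ _) (+-cong p q)

  Inv-neg : ∀ {i f} → Inv i f → Inv i (- f)
  Inv-neg {i} p = trans (swap-neg i _) (-‿cong p)

  Inv-* : ∀ {i f g} → Inv i f → Inv i g → Inv i (f * g)
  Inv-* {i} p q = trans (swap-* i _ _) (*-cong p q)

  Inv-resp : ∀ {i f g} → f ≈ g → Inv i f → Inv i g
  Inv-resp {i} e p = trans (swap-cong i (sym e)) (trans p e)

  swap-x-lower : ∀ {i j} → j < i → suc i < N → swap i (x j) ≈ x j
  swap-x-lower {i} {j} j<i i< = swap-x-other i j i< (ℕ.<⇒≢ j<i) (ℕ.<⇒≢ (ℕ.m<n⇒m<1+n j<i))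

  swap-x-upper : ∀ {i j} → suc i < j → suc i < N → swap i (x j) ≈ x j
  swap-x-upper {i} {j} i<j i< =
    swap-x-other i j i< (ℕ.>⇒≢ (ℕ.<-trans (ℕ.n<1+n i) i<j)) (ℕ.>⇒≢ i<j)

  x-x-cancelˡ : ∀ {i j f g} → i < j → j < N → (x i - x j) * f ≈ (x i - x j) * g → f ≈ g
  x-x-cancelˡ {i} {j} {f} {g} i<j j< e = x∙y⁻¹≈ε⇒x≈y f g (x-x-cancel i j i<j j< (f - g) (begin
    (x i - x j) * (f - g)                 ≈⟨ solve 3 (λ d f g → d :* (f :- g) := d :* f :- d :* g) refl _ f g ⟩
    (x i - x j) * f - (x i - x j) * g     ≈⟨ x≈y⇒x∙y⁻¹≈ε e ⟩
    0#                                    ∎))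
    where open ≈R

  -- π_i is ∂_i after multiplication by `A i` = x_i (1 + β x_{i+1}); `A′ i` is the image of `A i`
  -- under s_i.
  A A′ δ : ℕ → Carrier
  A  i = x i + β * (x i * x (suc i))
  A′ i = x (suc i) + β * (x i * x (suc i))
  δ  i = x i - x (suc i)

  π : ℕ → Carrier → Carrier
  π i f = ∂ᵣ i (x i * f + β * (x i * x (suc i)) * f)

  swap-A : ∀ i → suc i < N → swap i (A i) ≈ A′ i
  swap-A i i< = begin
    swap i (A i)                                          ≈⟨ swap-+ i _ _ ⟩
    swap i (x i) + swap i (β * (x i * x (suc i)))         ≈⟨ +-cong (swap-xˡ i i<) (trans (swap-* i _ _) (*-cong (swap-β i) (swap-* i _ _))) ⟩
    x (suc i) + β * (swap i (x i) * swap i (x (suc i)))   ≈⟨ +-congˡ (*-congˡ (*-cong (swap-xˡ i i<) (swap-xʳ i i<))) ⟩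
    x (suc i) + β * (x (suc i) * x i)                     ≈⟨ +-congˡ (*-congˡ (*-comm _ _)) ⟩
    A′ i ∎
    where open ≈R

  swap-δ : ∀ i → suc i < N → swap i (δ i) ≈ - δ i
  swap-δ i i< = begin
    swap i (δ i)                      ≈⟨ trans (swap-+ i _ _) (+-congˡ (swap-neg i _)) ⟩
    swap i (x i) - swap i (x (suc i)) ≈⟨ +-cong (swap-xˡ i i<) (-‿cong (swap-xʳ i i<)) ⟩
    x (suc i) - x i                   ≈⟨ solve 2 (λ a b → b :- a := :- (a :- b)) refl _ _ ⟩
    - δ i ∎
    where open ≈R

  π-eq : ∀ i → suc i < N → ∀ f → δ i * π i f ≈ A i * f - A′ i * swap i f
  π-eq i i< f = begin
    δ i * π i f                                      ≈⟨ ∂ᵣ-divides i i< _ ⟩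
    g - swap i g                                     ≈⟨ +-cong eq (-‿cong (trans (swap-cong i eq) (trans (swap-* i _ _) (*-congʳ (swap-A i i<))))) ⟩
    A i * f - A′ i * swap i f                        ∎
    where
    open ≈R
    g = x i * f + β * (x i * x (suc i)) * f
    eq : g ≈ A i * f
    eq = sym (distribʳ f _ _)

  δ-cancel : ∀ i → suc i < N → ∀ {f g} → δ i * f ≈ δ i * g → f ≈ g
  δ-cancel i i< = x-x-cancelˡ (ℕ.n<1+n i) i<

  -- Since `δ i` can be cancelled, the equation of `π-eq` characterises π_i f. Additivity, linearity
  -- over s_i-invariants and commutation are all verified on this equation.
  π-unique : ∀ i → suc i < N → ∀ {f h} → δ i * h ≈ A i * f - A′ i * swap i f → h ≈ π i f
  π-unique i i< e = δ-cancel i i< (trans e (sym (π-eq i i< _)))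

  π-cong : ∀ i → suc i < N → ∀ {f g} → f ≈ g → π i f ≈ π i g
  π-cong i i< e = π-unique i i< (trans (π-eq i i< _) (+-cong (*-congˡ e) (-‿cong (*-congˡ (swap-cong i e)))))

  π-+ : ∀ i → suc i < N → ∀ f g → π i (f + g) ≈ π i f + π i g
  π-+ i i< f g = sym (π-unique i i< (begin
    δ i * (π i f + π i g)                                       ≈⟨ distribˡ _ _ _ ⟩
    δ i * π i f + δ i * π i g                                   ≈⟨ +-cong (π-eq i i< f) (π-eq i i< g) ⟩
    (A i * f - A′ i * swap i f) + (A i * g - A′ i * swap i g)   ≈⟨ solve 6 (λ a b f f′ g g′ → (a :* f :- b :* f′) :+ (a :* g :- b :* g′) := a :* (f :+ g) :- b :* (f′ :+ g′)) refl _ _ _ _ _ _ ⟩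
    A i * (f + g) - A′ i * (swap i f + swap i g)                ≈⟨ +-congˡ (-‿cong (*-congˡ (sym (swap-+ i f g)))) ⟩
    A i * (f + g) - A′ i * swap i (f + g)                       ∎))
    where open ≈R

  π-scale : ∀ i → suc i < N → ∀ {g} → Inv i g → ∀ f → π i (g * f) ≈ g * π i f
  π-scale i i< {g} inv f = sym (π-unique i i< (begin
    δ i * (g * π i f)                          ≈⟨ x∙yz≈y∙xz _ _ _ ⟩
    g * (δ i * π i f)                          ≈⟨ *-congˡ (π-eq i i< f) ⟩
    g * (A i * f - A′ i * swap i f)            ≈⟨ solve 5 (λ g a b f f′ → g :* (a :* f :- b :* f′) := a :* (g :* f) :- b :* (g :* f′)) refl _ _ _ _ _ ⟩
    A i * (g * f) - A′ i * (g * swap i f)      ≈⟨ +-congˡ (-‿cong (*-congˡ (trans (*-congʳ (sym inv)) (sym (swap-* i g f))))) ⟩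
    A i * (g * f) - A′ i * swap i (g * f)      ∎))
    where open ≈R

  π-Inv : ∀ i → suc i < N → ∀ f → Inv i (π i f)
  π-Inv i i< f = δ-cancel i i< (begin
    δ i * swap i (π i f)                             ≈⟨ solve 2 (λ d g → d :* g := :- (:- d :* g)) refl _ _ ⟩
    - (- δ i * swap i (π i f))                       ≈⟨ -‿cong (*-congʳ (sym (swap-δ i i<))) ⟩
    - (swap i (δ i) * swap i (π i f))                ≈⟨ -‿cong (sym (swap-* i _ _)) ⟩
    - swap i (δ i * π i f)                           ≈⟨ -‿cong (swap-cong i (π-eq i i< f)) ⟩
    - swap i (A i * f - A′ i * swap i f)             ≈⟨ -‿cong (trans (swap-+ i _ _) (+-cong (swap-* i _ _) (trans (swap-neg i _) (-‿cong (swap-* i _ _))))) ⟩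
    - (swap i (A i) * swap i f - swap i (A′ i) * swap i (swap i f))
      ≈⟨ -‿cong (+-cong (*-congʳ (swap-A i i<)) (-‿cong (*-cong swap-A′ (swap-involutive i f)))) ⟩
    - (A′ i * swap i f - A i * f)                    ≈⟨ solve 4 (λ a b f f′ → :- (b :* f′ :- a :* f) := a :* f :- b :* f′) refl _ _ _ _ ⟩
    A i * f - A′ i * swap i f                        ≈⟨ sym (π-eq i i< f) ⟩
    δ i * π i f                                      ∎)
    where
    open ≈R
    swap-A′ : swap i (A′ i) ≈ A i
    swap-A′ = trans (swap-cong i (sym (swap-A i i<))) (swap-involutive i _)

  π-fix : ∀ i → suc i < N → ∀ {f} → Inv i f → π i f ≈ f
  π-fix i i< {f} inv = sym (π-unique i i< (begin
    δ i * f                       ≈⟨ solve 4 (λ a b c f → (a :- b) :* f := (a :+ c) :* f :- (b :+ c) :* f) refl _ _ _ _ ⟩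
    A i * f - A′ i * f            ≈⟨ +-congˡ (-‿cong (*-congˡ (sym inv))) ⟩
    A i * f - A′ i * swap i f     ∎))
    where open ≈R

  π-kill : ∀ i → suc i < N → ∀ {f} → Inv i (A i * f) → π i f ≈ 0#
  π-kill i i< {f} inv = sym (π-unique i i< (begin
    δ i * 0#                            ≈⟨ zeroʳ _ ⟩
    0#                                  ≈⟨ sym (-‿inverseʳ _) ⟩
    A i * f - A i * f                   ≈⟨ +-congˡ (-‿cong (trans (sym inv) (trans (swap-* i _ _) (*-congʳ (swap-A i i<))))) ⟩
    A i * f - A′ i * swap i f           ∎))
    where open ≈R

  module _ (T : Carrier → Carrier) (T-cong : ∀ {f g} → f ≈ g → T f ≈ T g)
           (T-- : ∀ f g → T (f - g) ≈ T f - T g) (j : ℕ) (j< : suc j < N)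
           (T-A : ∀ f → T (A j * f) ≈ A j * T f) (T-A′ : ∀ f → T (A′ j * f) ≈ A′ j * T f)
           (T-δ : ∀ f → T (δ j * f) ≈ δ j * T f)
           (T-swap : ∀ f → T (swap j f) ≈ swap j (T f)) where
    -- `T (π j f)` satisfies the equation that characterises `π j (T f)`. The argument is used for T
    -- = s_i and then for T = π_i at distant indices.
    commutes-with-π : ∀ f → T (π j f) ≈ π j (T f)
    commutes-with-π f = π-unique j j< (begin
      δ j * T (π j f)                              ≈⟨ sym (T-δ _) ⟩
      T (δ j * π j f)                              ≈⟨ T-cong (π-eq j j< f) ⟩
      T (A j * f - A′ j * swap j f)                ≈⟨ T-- _ _ ⟩
      T (A j * f) - T (A′ j * swap j f)            ≈⟨ +-cong (T-A f) (-‿cong (trans (T-A′ _) (*-congˡ (T-swap f)))) ⟩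
      A j * T f - A′ j * swap j (T f)              ∎)
      where open ≈R

  Far : ℕ → ℕ → Set
  Far i j = (suc i < j) ⊎ (suc j < i)

  Inv-x-far : ∀ {i j} → suc i < N → (j < i) ⊎ (suc i < j) → Inv i (x j)
  Inv-x-far i< (inj₁ p) = swap-x-lower p i<
  Inv-x-far i< (inj₂ p) = swap-x-upper p i<

  module _ {i j : ℕ} (i< : suc i < N) (j< : suc j < N) (far : Far i j) where
    private
      far₀ : (j < i) ⊎ (suc i < j)
      far₀ = Sum.[ inj₂ , (λ p → inj₁ (ℕ.<-trans (ℕ.n<1+n j) p)) ] far
      far₁ : (suc j < i) ⊎ (suc i < suc j)
      far₁ = Sum.[ (λ p → inj₂ (ℕ.m<n⇒m<1+n p)) , inj₁ ] far
      inv₀ : Inv i (x j)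
      inv₀ = Inv-x-far i< far₀
      inv₁ : Inv i (x (suc j))
      inv₁ = Inv-x-far i< far₁
      inv₂ : Inv i (β * (x j * x (suc j)))
      inv₂ = Inv-* (swap-β i) (Inv-* inv₀ inv₁)

    Inv-A-far : Inv i (A j)
    Inv-A-far = Inv-+ inv₀ inv₂
    Inv-A′-far : Inv i (A′ j)
    Inv-A′-far = Inv-+ inv₁ inv₂
    Inv-δ-far : Inv i (δ j)
    Inv-δ-far = Inv-+ inv₀ (Inv-neg inv₁)

  swap-far : ∀ {i j} → suc i < N → suc j < N → Far i j → ∀ f → swap i (swap j f) ≈ swap j (swap i f)
  swap-far i< j< (inj₁ p) f = swap-comm _ _ p j< f
  swap-far i< j< (inj₂ p) f = sym (swap-comm _ _ p i< f)

  swap-- : ∀ i f g → swap i (f - g) ≈ swap i f - swap i g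
  swap-- i f g = trans (swap-+ i _ _) (+-congˡ (swap-neg i g))

  π-neg : ∀ i → suc i < N → ∀ f → π i (- f) ≈ - π i f
  π-neg i i< f = begin
    π i (- f)                ≈⟨ π-cong i i< (solve 1 (λ f → :- f := con -[1+ 0 ] :* f) refl f) ⟩
    π i (const -[1+ 0 ] * f) ≈⟨ π-scale i i< (swap-const i _) f ⟩
    const -[1+ 0 ] * π i f   ≈⟨ solve 1 (λ f → con -[1+ 0 ] :* f := :- f) refl _ ⟩
    - π i f                  ∎
    where open ≈R

  π-- : ∀ i → suc i < N → ∀ f g → π i (f - g) ≈ π i f - π i g
  π-- i i< f g = trans (π-+ i i< _ _) (+-congˡ (π-neg i i< g))

  swap-π-far : ∀ {i j} → suc i < N → suc j < N → Far i j → ∀ f → swap i (π j f) ≈ π j (swap i f)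
  swap-π-far {i} {j} i< j< far = commutes-with-π (swap i) (swap-cong i) (swap-- i) j j<
    (scale (Inv-A-far i< j< far)) (scale (Inv-A′-far i< j< far)) (scale (Inv-δ-far i< j< far)) (swap-far i< j< far)
    where
    scale : ∀ {g} → Inv i g → ∀ f → swap i (g * f) ≈ g * swap i f
    scale inv f = trans (swap-* i _ f) (*-congʳ inv)

  π-π-far : ∀ {i j} → suc i < N → suc j < N → Far i j → ∀ f → π i (π j f) ≈ π j (π i f)
  π-π-far {i} {j} i< j< far = commutes-with-π (π i) (π-cong i i<) (π-- i i<) j j<
    (π-scale i i< (Inv-A-far i< j< far)) (π-scale i i< (Inv-A′-far i< j< far)) (π-scale i i< (Inv-δ-far i< j< far))
    (λ f → sym (swap-π-far j< i< (Sum.swap far) f))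

  -- The braid relation

  module _ (i : ℕ) (i< : suc (suc i) < N) where
    private
      j : ℕ
      j = suc i
      i<′ : suc i < N
      i<′ = ℕ.<-trans (ℕ.n<1+n _) i<
      a b c : Carrier
      a = x i
      b = x j
      c = x (suc j)
      Aₓ : Carrier → Carrier → Carrier
      Aₓ u v = u + β * (u * v)

      swapᵢ : ∀ {u v u′ v′ f} → swap i u ≈ u′ → swap i v ≈ v′ → swap i (Aₓ u v * f) ≈ Aₓ u′ v′ * swap i f
      swapᵢ p q = trans (swap-* i _ _) (*-congʳ (trans (swap-+ i _ _)
        (+-cong p (trans (swap-* i _ _) (*-cong (swap-β i) (trans (swap-* i _ _) (*-cong p q)))))))
      swapⱼ : ∀ {u v u′ v′ f} → swap j u ≈ u′ → swap j v ≈ v′ → swap j (Aₓ u v * f) ≈ Aₓ u′ v′ * swap j f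
      swapⱼ p q = trans (swap-* j _ _) (*-congʳ (trans (swap-+ j _ _)
        (+-cong p (trans (swap-* j _ _) (*-cong (swap-β j) (trans (swap-* j _ _) (*-cong p q)))))))

      swap-rel : ∀ k {u e u′ v′ f g f′ g′} → u * e ≈ f - g →
                 swap k u ≈ u′ → swap k e ≈ v′ → swap k f ≈ f′ → swap k g ≈ g′ → u′ * v′ ≈ f′ - g′
      swap-rel k r p q s t = trans (*-cong (sym p) (sym q)) (trans (sym (swap-* k _ _))
        (trans (swap-cong k r) (trans (swap-- k _ _) (+-cong s (-‿cong t)))))

      sub : ∀ k {u v u′ v′} → swap k u ≈ u′ → swap k v ≈ v′ → swap k (u - v) ≈ u′ - v′
      sub k p q = trans (swap-- k _ _) (+-cong p (-‿cong q))

      i-a : swap i a ≈ b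
      i-a = swap-xˡ i i<′
      i-b : swap i b ≈ a
      i-b = swap-xʳ i i<′
      i-c : swap i c ≈ c
      i-c = swap-x-upper (ℕ.n<1+n _) i<′
      j-a : swap j a ≈ a
      j-a = swap-x-lower (ℕ.n<1+n _) i<
      j-b : swap j b ≈ c
      j-b = swap-xˡ j i<
      j-c : swap j c ≈ b
      j-c = swap-xʳ j i<

      Δ : Carrier
      Δ = ((b - c) * (a - c)) * (a - b)

      -- Common normal form of the two triple products after multiplication by the Vandermonde
      -- product `Δ`: a combination of the six permuted images of f. It is arranged as it comes out
      -- of π_i π_j π_i.
      Φ : Carrier → Carrier → Carrier → Carrier → Carrier → Carrier → Carrier
      Φ f₀ f₁ f₂ f₂₁ f₁₂ f₁₂₁ =
          (a * b) * ((𝟙 + β * c) * (𝟙 + β * c)) * (Aₓ a b * f₀ - Aₓ b a * f₁)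
        - Aₓ a b * Aₓ c b * (Aₓ a c * f₂ - Aₓ c a * f₂₁)
        + Aₓ b a * Aₓ c a * (Aₓ b c * f₁₂ - Aₓ c b * f₁₂₁)

      Δ-π-π-π : ∀ f → Δ * π i (π j (π i f)) ≈
        Φ f (swap i f) (swap j f) (swap j (swap i f)) (swap i (swap j f)) (swap i (swap j (swap i f)))
      Δ-π-π-π f = begin
        Δ * π i G
          ≈⟨ *-assoc _ _ _ ⟩
        ((b - c) * (a - c)) * ((a - b) * π i G)
          ≈⟨ *-congˡ (π-eq i i<′ G) ⟩
        ((b - c) * (a - c)) * (Aₓ a b * G - A′ i * G₁)
          ≈⟨ solve 6 (λ p q u v g h → (p :* q) :* (u :* g :- v :* h) := u :* (q :* (p :* g)) :- v :* (p :* (q :* h))) refl _ _ _ _ _ _ ⟩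
        Aₓ a b * ((a - c) * ((b - c) * G)) - A′ i * ((b - c) * ((a - c) * G₁))
          ≈⟨ +-cong (*-congˡ (*-congˡ (π-eq j i< E))) (-‿cong (*-congˡ (*-congˡ rel-G₁))) ⟩
        Aₓ a b * ((a - c) * (Aₓ b c * E - A′ j * E₂)) - A′ i * ((b - c) * (Aₓ a c * E - Aₓ c a * E₁₂))
          -- The two contributions to e combine by (1 + βb)(a - c) - (1 + βa)(b - c) = (1 + βc)(a -
          -- b). This restores the factor a - b needed for `rel-E` and produces the square of 1 +
          -- βc.
          ≈⟨ solve 7 (λ β a b c e e₂ e₁₂ →
               let A = λ u v → u :+ β :* (u :* v); A′ = λ v u → u :+ β :* (v :* u) in
               A a b :* ((a :- c) :* (A b c :* e :- A′ b c :* e₂)) :- A′ a b :* ((b :- c) :* (A a c :* e :- A c a :* e₁₂))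
               := (a :* b) :* ((con (+ 1) :+ β :* c) :* (con (+ 1) :+ β :* c)) :* ((a :- b) :* e)
                  :- A a b :* A c b :* ((a :- c) :* e₂) :+ A b a :* A c a :* ((b :- c) :* e₁₂)) refl β a b c E E₂ E₁₂ ⟩
        (a * b) * ((𝟙 + β * c) * (𝟙 + β * c)) * ((a - b) * E)
          - Aₓ a b * Aₓ c b * ((a - c) * E₂) + Aₓ b a * Aₓ c a * ((b - c) * E₁₂)
          ≈⟨ +-cong (+-cong (*-congˡ rel-E) (-‿cong (*-congˡ rel-E₂))) (*-congˡ rel-E₁₂) ⟩
        Φ f (swap i f) (swap j f) (swap j (swap i f)) (swap i (swap j f)) (swap i (swap j (swap i f))) ∎
        where
        open ≈R
        E  = π i f
        E₂ = swap j E
        E₁₂ = swap i E₂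
        G  = π j E
        G₁ = swap i G
        rel-E : (a - b) * E ≈ Aₓ a b * f - Aₓ b a * swap i f
        rel-E = trans (π-eq i i<′ f) (+-congˡ (-‿cong (*-congʳ (+-congˡ (*-congˡ (*-comm a b))))))
        rel-E₂ : (a - c) * E₂ ≈ Aₓ a c * swap j f - Aₓ c a * swap j (swap i f)
        rel-E₂ = swap-rel j rel-E (sub j j-a j-b) refl (swapⱼ j-a j-b) (swapⱼ j-b j-a)
        rel-E₁₂ : (b - c) * E₁₂ ≈ Aₓ b c * swap i (swap j f) - Aₓ c b * swap i (swap j (swap i f))
        rel-E₁₂ = swap-rel i rel-E₂ (sub i i-a i-c) refl (swapᵢ i-a i-c) (swapᵢ i-c i-a)
        rel-G : (b - c) * G ≈ Aₓ b c * E - Aₓ c b * E₂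
        rel-G = trans (π-eq j i< E) (+-congˡ (-‿cong (*-congʳ (+-congˡ (*-congˡ (*-comm b c))))))
        rel-G₁ : (a - c) * G₁ ≈ Aₓ a c * E - Aₓ c a * E₁₂
        rel-G₁ = swap-rel i rel-G (sub i i-b i-c) refl
          (trans (swapᵢ i-b i-c) (*-congˡ (π-Inv i i<′ f))) (swapᵢ i-c i-b)

      Δ-π-π-π′ : ∀ f → Δ * π j (π i (π j f)) ≈
        Φ f (swap i f) (swap j f) (swap j (swap i f)) (swap i (swap j f)) (swap i (swap j (swap i f)))
      Δ-π-π-π′ f = begin
        Δ * π j G
          ≈⟨ solve 4 (λ u v w g → ((u :* v) :* w) :* g := (v :* w) :* (u :* g)) refl _ _ _ _ ⟩
        ((a - c) * (a - b)) * ((b - c) * π j G)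
          ≈⟨ *-congˡ (π-eq j i< G) ⟩
        ((a - c) * (a - b)) * (Aₓ b c * G - A′ j * G₂)
          ≈⟨ solve 6 (λ p q u v g h → (p :* q) :* (u :* g :- v :* h) := u :* (p :* (q :* g)) :- v :* (q :* (p :* h))) refl _ _ _ _ _ _ ⟩
        Aₓ b c * ((a - c) * ((a - b) * G)) - A′ j * ((a - b) * ((a - c) * G₂))
          ≈⟨ +-cong (*-congˡ (*-congˡ (π-eq i i<′ E))) (-‿cong (*-congˡ (*-congˡ rel-G₂))) ⟩
        Aₓ b c * ((a - c) * (Aₓ a b * E - A′ i * E₁)) - A′ j * ((a - b) * (Aₓ a c * E - Aₓ c a * E₂₁))
          ≈⟨ solve 7 (λ β a b c e e₁ e₂₁ →
               let A = λ u v → u :+ β :* (u :* v); A′ = λ v u → u :+ β :* (v :* u) in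
               A b c :* ((a :- c) :* (A a b :* e :- A′ a b :* e₁)) :- A′ b c :* ((a :- b) :* (A a c :* e :- A c a :* e₂₁))
               := (a :* a) :* ((con (+ 1) :+ β :* b) :* (con (+ 1) :+ β :* c)) :* ((b :- c) :* e)
                  :- A b c :* A b a :* ((a :- c) :* e₁) :+ A c b :* A c a :* ((a :- b) :* e₂₁)) refl β a b c E E₁ E₂₁ ⟩
        (a * a) * ((𝟙 + β * b) * (𝟙 + β * c)) * ((b - c) * E)
          - Aₓ b c * Aₓ b a * ((a - c) * E₁) + Aₓ c b * Aₓ c a * ((a - b) * E₂₁)
          ≈⟨ +-cong (+-cong (*-congˡ rel-E) (-‿cong (*-congˡ rel-E₁))) (*-congˡ rel-E₂₁) ⟩
        (a * a) * ((𝟙 + β * b) * (𝟙 + β * c)) * (Aₓ b c * f - Aₓ c b * swap j f)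
          - Aₓ b c * Aₓ b a * (Aₓ a c * swap i f - Aₓ c a * swap i (swap j f))
          + Aₓ c b * Aₓ c a * (Aₓ a b * swap j (swap i f) - Aₓ b a * swap i (swap j (swap i f)))
          -- The two products group the six images in different pairs; the coefficients of each
          -- image agree as polynomials.
          ≈⟨ solve 10 (λ β a b c f₀ f₁ f₂ f₂₁ f₁₂ f₁₂₁ →
               let A = λ u v → u :+ β :* (u :* v); o = λ u → con (+ 1) :+ β :* u in
               (a :* a) :* (o b :* o c) :* (A b c :* f₀ :- A c b :* f₂) :- A b c :* A b a :* (A a c :* f₁ :- A c a :* f₁₂)
                 :+ A c b :* A c a :* (A a b :* f₂₁ :- A b a :* f₁₂₁)
               := (a :* b) :* (o c :* o c) :* (A a b :* f₀ :- A b a :* f₁) :- A a b :* A c b :* (A a c :* f₂ :- A c a :* f₂₁)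
                 :+ A b a :* A c a :* (A b c :* f₁₂ :- A c b :* f₁₂₁)) refl β a b c _ _ _ _ _ _ ⟩
        Φ f (swap i f) (swap j f) (swap j (swap i f)) (swap i (swap j f)) (swap i (swap j (swap i f))) ∎
        where
        open ≈R
        E  = π j f
        E₁ = swap i E
        E₂₁ = swap j E₁
        G  = π i E
        G₂ = swap j G
        rel-E : (b - c) * E ≈ Aₓ b c * f - Aₓ c b * swap j f
        rel-E = trans (π-eq j i< f) (+-congˡ (-‿cong (*-congʳ (+-congˡ (*-congˡ (*-comm b c))))))
        rel-E₁ : (a - c) * E₁ ≈ Aₓ a c * swap i f - Aₓ c a * swap i (swap j f)
        rel-E₁ = swap-rel i rel-E (sub i i-b i-c) refl (swapᵢ i-b i-c) (swapᵢ i-c i-b)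
        rel-E₂₁ : (a - b) * E₂₁ ≈ Aₓ a b * swap j (swap i f) - Aₓ b a * swap i (swap j (swap i f))
        rel-E₂₁ = swap-rel j rel-E₁ (sub j j-a j-c) refl (swapⱼ j-a j-c)
          (trans (swapⱼ j-c j-a) (*-congˡ (sym (swap-braid i i< f))))
        rel-G : (a - b) * G ≈ Aₓ a b * E - Aₓ b a * E₁
        rel-G = trans (π-eq i i<′ E) (+-congˡ (-‿cong (*-congʳ (+-congˡ (*-congˡ (*-comm a b))))))
        rel-G₂ : (a - c) * G₂ ≈ Aₓ a c * E - Aₓ c a * E₂₁
        rel-G₂ = swap-rel j rel-G (sub j j-a j-b) refl
          (trans (swapⱼ j-a j-b) (*-congˡ (π-Inv j i< f))) (swapⱼ j-b j-a)

    π-braid : ∀ f → π i (π j (π i f)) ≈ π j (π i (π j f))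
    π-braid f =
      x-x-cancelˡ {i} {j} (ℕ.n<1+n i) i<′
        (x-x-cancelˡ {i} {suc j} (ℕ.<-trans (ℕ.n<1+n i) (ℕ.n<1+n j)) i<
          (x-x-cancelˡ {j} {suc j} (ℕ.n<1+n j) i<
            (trans (assoc _) (trans (trans (Δ-π-π-π f) (sym (Δ-π-π-π′ f))) (sym (assoc _))))))
      where
      assoc : ∀ g → (b - c) * ((a - c) * ((a - b) * g)) ≈ Δ * g
      assoc = solve 4 (λ u v w g → u :* (v :* (w :* g)) := ((u :* v) :* w) :* g) refl (b - c) (a - c) (a - b)

  -- Words in the operators π

  -- Variables are numbered from 0, so W k is the operator of the longest element of S_k, acting on x 0 , … , x (k ∸ 1).
  C C′ W : ℕ → Carrier → Carrier
  C zero    f = f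
  C (suc k) f = C k (π k f)
  C′ zero    f = f
  C′ (suc k) f = π k (C′ k f)
  W zero    f = f
  W (suc k) f = C k (W k f)

  C-cong : ∀ k → k < N → ∀ {f g} → f ≈ g → C k f ≈ C k g
  C-cong zero    k< e = e
  C-cong (suc k) k< e = C-cong k (ℕ.<⇒≤ k<) (π-cong k k< e)

  C′-cong : ∀ k → k < N → ∀ {f g} → f ≈ g → C′ k f ≈ C′ k g
  C′-cong zero    k< e = e
  C′-cong (suc k) k< e = π-cong k k< (C′-cong k (ℕ.<⇒≤ k<) e)

  W-cong : ∀ k → k ≤ N → ∀ {f g} → f ≈ g → W k f ≈ W k g
  W-cong zero    k≤ e = e
  W-cong (suc k) k≤ e = C-cong k k≤ (W-cong k (ℕ.<⇒≤ k≤) e)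

  module _ (T : Carrier → Carrier) (T-cong : ∀ {f g} → f ≈ g → T f ≈ T g) where
    C-natural : ∀ k → k < N → (∀ j → j < k → ∀ f → T (π j f) ≈ π j (T f)) → ∀ f → T (C k f) ≈ C k (T f)
    C-natural zero    k< h f = refl
    C-natural (suc k) k< h f =
      trans (C-natural k (ℕ.<⇒≤ k<) (λ j j<k → h j (ℕ.m<n⇒m<1+n j<k)) (π k f)) (C-cong k (ℕ.<⇒≤ k<) (h k (ℕ.n<1+n k) f))

    C′-natural : ∀ k → k < N → (∀ j → j < k → ∀ f → T (π j f) ≈ π j (T f)) → ∀ f → T (C′ k f) ≈ C′ k (T f)
    C′-natural zero    k< h f = refl
    C′-natural (suc k) k< h f =
      trans (h k (ℕ.n<1+n k) _) (π-cong k k< (C′-natural k (ℕ.<⇒≤ k<) (λ j j<k → h j (ℕ.m<n⇒m<1+n j<k)) f))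

    W-natural : ∀ k → k ≤ N → (∀ j → suc j < k → ∀ f → T (π j f) ≈ π j (T f)) → ∀ f → T (W k f) ≈ W k (T f)
    W-natural zero    k≤ h f = refl
    W-natural (suc k) k≤ h f =
      trans (C-natural k k≤ (λ j j<k → h j (s≤s j<k)) _)
            (C-cong k k≤ (W-natural k (ℕ.<⇒≤ k≤) (λ j j<k → h j (ℕ.m<n⇒m<1+n j<k)) f))

  C-scale : ∀ k → k < N → ∀ {g} → (∀ j → j < k → Inv j g) → ∀ f → C k (g * f) ≈ g * C k f
  C-scale k k< {g} inv f =
    sym (C-natural (g *_) *-congˡ k k< (λ j j<k f → sym (π-scale j (ℕ.≤-<-trans j<k k<) (inv j j<k) f)) f)

  C′-scale : ∀ k → k < N → ∀ {g} → (∀ j → j < k → Inv j g) → ∀ f → C′ k (g * f) ≈ g * C′ k f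
  C′-scale k k< {g} inv f =
    sym (C′-natural (g *_) *-congˡ k k< (λ j j<k f → sym (π-scale j (ℕ.≤-<-trans j<k k<) (inv j j<k) f)) f)

  W-scale : ∀ k → k ≤ N → ∀ {g} → (∀ j → suc j < k → Inv j g) → ∀ f → W k (g * f) ≈ g * W k f
  W-scale k k≤ {g} inv f =
    sym (W-natural (g *_) *-congˡ k k≤ (λ j j<k f → sym (π-scale j (ℕ.<-≤-trans j<k k≤) (inv j j<k) f)) f)

  C-+ : ∀ k → k < N → ∀ f g → C k (f + g) ≈ C k f + C k g
  C-+ zero    k< f g = refl
  C-+ (suc k) k< f g = trans (C-cong k (ℕ.<⇒≤ k<) (π-+ k k< f g)) (C-+ k (ℕ.<⇒≤ k<) _ _)

  W-+ : ∀ k → k ≤ N → ∀ f g → W k (f + g) ≈ W k f + W k g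
  W-+ zero    k≤ f g = refl
  W-+ (suc k) k≤ f g = trans (C-cong k k≤ (W-+ k (ℕ.<⇒≤ k≤) f g)) (C-+ k k≤ _ _)

  W-neg : ∀ k → k ≤ N → ∀ f → W k (- f) ≈ - W k f
  W-neg k k≤ f = begin
    W k (- f)                ≈⟨ W-cong k k≤ (solve 1 (λ f → :- f := con -[1+ 0 ] :* f) refl f) ⟩
    W k (const -[1+ 0 ] * f) ≈⟨ W-scale k k≤ (λ j _ → swap-const j _) f ⟩
    const -[1+ 0 ] * W k f   ≈⟨ solve 1 (λ f → con -[1+ 0 ] :* f := :- f) refl _ ⟩
    - W k f                  ∎
    where open ≈R

  W-- : ∀ k → k ≤ N → ∀ f g → W k (f - g) ≈ W k f - W k g
  W-- k k≤ f g = trans (W-+ k k≤ _ _) (+-congˡ (W-neg k k≤ g))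

  π-W-far : ∀ i k → k ≤ i → suc i < N → ∀ f → π i (W k f) ≈ W k (π i f)
  π-W-far i k k≤i i< = W-natural (π i) (π-cong i i<) k (ℕ.≤-trans k≤i (ℕ.<⇒≤ (ℕ.<-trans (ℕ.n<1+n i) i<)))
    λ j j<k f → π-π-far i< (ℕ.<-trans (ℕ.<-≤-trans j<k k≤i) (ℕ.<-trans (ℕ.n<1+n i) i<)) (inj₂ (ℕ.<-≤-trans j<k k≤i)) f

  swap-W-far : ∀ i k → k ≤ i → suc i < N → ∀ f → swap i (W k f) ≈ W k (swap i f)
  swap-W-far i k k≤i i< = W-natural (swap i) (swap-cong i) k (ℕ.≤-trans k≤i (ℕ.<⇒≤ (ℕ.<-trans (ℕ.n<1+n i) i<)))
    λ j j<k f → swap-π-far i< (ℕ.<-trans (ℕ.<-≤-trans j<k k≤i) (ℕ.<-trans (ℕ.n<1+n i) i<)) (inj₂ (ℕ.<-≤-trans j<k k≤i)) f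

  -- A reduced word of the longest element can end or begin with a cycle: `C k` and `C′ k` run
  -- through the same operators in opposite orders. In the induction π_k passes `W k`, whose indices
  -- are at most k - 2.
  W-C′ : ∀ k → k < N → ∀ f → W (suc k) f ≈ W k (C′ k f)
  W-C′ zero    k< f = refl
  W-C′ (suc k) k< f = begin
    C k (π k (W (suc k) f))     ≈⟨ C-cong k k<′ (π-cong k k< (W-C′ k k<′ f)) ⟩
    C k (π k (W k (C′ k f)))    ≈⟨ C-cong k k<′ (π-W-far k k ℕ.≤-refl k< _) ⟩
    C k (W k (π k (C′ k f)))    ∎
    where
    open ≈R
    k<′ = ℕ.<⇒≤ k<

  -- Passing through the cycle lowers the index by one: π_{i+1} commutes with the outer factors
  -- until it meets π_i π_{i+1}, and the braid relation sends it out on the other side as π_i.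
  C-π : ∀ k i → suc i < k → k < N → ∀ f → π (suc i) (C k f) ≈ C k (π i f)
  C-π (suc k) i (s≤s i<k) k< f with ℕ.m≤n⇒m<n∨m≡n i<k
  ... | inj₁ i<k′ = trans (C-π k i i<k′ k<′ (π k f))
                         (C-cong k k<′ (π-π-far (ℕ.≤-<-trans i<k k<′) k< (inj₁ i<k′) f))
    where k<′ = ℕ.<⇒≤ k<
  ... | inj₂ ≡.refl = begin
    π (suc i) (C i (π i (π (suc i) f)))   ≈⟨ C-natural (π (suc i)) (π-cong (suc i) k<) i (ℕ.<⇒≤ k<′) far _ ⟩
    C i (π (suc i) (π i (π (suc i) f)))   ≈⟨ C-cong i (ℕ.<⇒≤ k<′) (sym (π-braid i k< f)) ⟩
    C i (π i (π (suc i) (π i f)))         ∎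
    where
    open ≈R
    k<′ = ℕ.<⇒≤ k<
    far : ∀ j → j < i → ∀ f → π (suc i) (π j f) ≈ π j (π (suc i) f)
    far j j<i f = π-π-far k< (ℕ.<-trans (s≤s j<i) k<′) (inj₂ (s≤s j<i)) f

  C′-π : ∀ k i → suc i < k → k < N → ∀ f → C′ k (π (suc i) f) ≈ π i (C′ k f)
  C′-π (suc k) i (s≤s i<k) k< f with ℕ.m≤n⇒m<n∨m≡n i<k
  ... | inj₁ i<k′ = trans (π-cong k k< (C′-π k i i<k′ k<′ f)) (π-π-far k< (ℕ.≤-<-trans i<k k<′) (inj₂ i<k′) _)
    where k<′ = ℕ.<⇒≤ k<
  ... | inj₂ ≡.refl = begin
    π (suc i) (π i (C′ i (π (suc i) f)))  ≈⟨ π-cong (suc i) k< (π-cong i k<′ (sym (C′-natural (π (suc i)) (π-cong (suc i) k<) i (ℕ.<⇒≤ k<′) far _))) ⟩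
    π (suc i) (π i (π (suc i) (C′ i f)))  ≈⟨ sym (π-braid i k< _) ⟩
    π i (π (suc i) (π i (C′ i f)))        ∎
    where
    open ≈R
    k<′ = ℕ.<⇒≤ k<
    far : ∀ j → j < i → ∀ f → π (suc i) (π j f) ≈ π j (π (suc i) f)
    far j j<i f = π-π-far k< (ℕ.<-trans (s≤s j<i) k<′) (inj₂ (s≤s j<i)) f

  π-idem : ∀ i → suc i < N → ∀ f → π i (π i f) ≈ π i f
  π-idem i i< f = π-fix i i< (π-Inv i i< f)

  C′-π₀ : ∀ k → suc k < N → ∀ f → C′ (suc k) (π 0 f) ≈ C′ (suc k) f
  C′-π₀ zero    k< f = π-idem 0 k< f
  C′-π₀ (suc k) k< f = π-cong (suc k) k< (C′-π₀ k (ℕ.<⇒≤ k<) f)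

  C-π₀ : ∀ k → suc k < N → ∀ f → π 0 (C (suc k) f) ≈ C (suc k) f
  C-π₀ zero    k< f = π-idem 0 k< f
  C-π₀ (suc k) k< f = C-π₀ k (ℕ.<⇒≤ k<) (π (suc k) f)

  -- For j = 0 the operator is absorbed by the idempotent π_0 that `C′` applies first. For larger j,
  -- `C′-π` lowers j and k together.
  W-π : ∀ k j → suc j < k → k ≤ N → ∀ f → W k (π j f) ≈ W k f
  W-π (suc (suc k)) zero    j<k k≤ f = begin
    W (2 ℕ.+ k) (π 0 f)             ≈⟨ W-C′ (suc k) k≤ _ ⟩
    W (suc k) (C′ (suc k) (π 0 f))  ≈⟨ W-cong (suc k) (ℕ.<⇒≤ k≤) (C′-π₀ k k≤ f) ⟩
    W (suc k) (C′ (suc k) f)        ≈⟨ sym (W-C′ (suc k) k≤ f) ⟩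
    W (2 ℕ.+ k) f                   ∎
    where open ≈R
  W-π (suc zero)    zero    (s≤s ()) k≤ f
  W-π (suc k)       (suc j) (s≤s j<k) k≤ f = begin
    W (suc k) (π (suc j) f)       ≈⟨ W-C′ k k≤ _ ⟩
    W k (C′ k (π (suc j) f))      ≈⟨ W-cong k (ℕ.<⇒≤ k≤) (C′-π k j j<k k≤ f) ⟩
    W k (π j (C′ k f))            ≈⟨ W-π k j j<k (ℕ.<⇒≤ k≤) _ ⟩
    W k (C′ k f)                  ≈⟨ sym (W-C′ k k≤ f) ⟩
    W (suc k) f                   ∎
    where open ≈R

  π-W : ∀ k j → suc j < k → k ≤ N → ∀ f → π j (W k f) ≈ W k f
  π-W (suc (suc k)) zero    j<k k≤ f = C-π₀ k k≤ _
  π-W (suc zero)    zero    (s≤s ()) k≤ f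
  π-W (suc k)       (suc j) (s≤s j<k) k≤ f =
    trans (C-π k j j<k k≤ _) (C-cong k k≤ (π-W k j j<k (ℕ.<⇒≤ k≤) f))

  Inv-W : ∀ k j → suc j < k → k ≤ N → ∀ f → Inv j (W k f)
  Inv-W k j j<k k≤ f = Inv-resp (π-W k j j<k k≤ f) (π-Inv j (ℕ.<-≤-trans j<k k≤) _)

  W-0 : ∀ k → k ≤ N → W k 0# ≈ 0#
  W-0 k k≤ = begin
    W k 0#        ≈⟨ W-cong k k≤ (sym (zeroˡ 0#)) ⟩
    W k (0# * 0#) ≈⟨ W-scale k k≤ (λ j _ → Inv-resp (0-homo constants) (swap-const j (+ 0))) 0# ⟩
    0# * W k 0#   ≈⟨ zeroˡ _ ⟩
    0#            ∎
    where open ≈R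

  W-kill : ∀ k j → suc j < k → k ≤ N → ∀ {f} → Inv j (A j * f) → W k f ≈ 0#
  W-kill k j j<k k≤ {f} inv = begin
    W k f         ≈⟨ sym (W-π k j j<k k≤ f) ⟩
    W k (π j f)   ≈⟨ W-cong k k≤ (π-kill j (ℕ.<-≤-trans j<k k≤) inv) ⟩
    W k 0#        ≈⟨ W-0 k k≤ ⟩
    0#            ∎
    where open ≈R

  -- The branching rule

  o : Carrier → Carrier
  o y = 𝟙 + β * y

  swap-^ : ∀ i f n → swap i (f ^ n) ≈ swap i f ^ n
  swap-^ i f zero    = Inv-resp (1-homo constants) (swap-const i (+ 1))
  swap-^ i f (suc n) = trans (swap-* i _ _) (*-congˡ (swap-^ i f n))

  swap-o : ∀ i y → swap i (o y) ≈ o (swap i y)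
  swap-o i y = trans (swap-+ i _ _) (+-cong (swap-const i _) (trans (swap-* i _ _) (*-congʳ (swap-β i))))

  o-cong : ∀ {y z} → y ≈ z → o y ≈ o z
  o-cong e = +-congˡ (*-congˡ e)

  Inv-^ : ∀ {i f} n → Inv i f → Inv i (f ^ n)
  Inv-^ n p = trans (swap-^ _ _ n) (^-congˡ n p)

  Inv-o : ∀ {i y} → Inv i y → Inv i (o y)
  Inv-o p = trans (swap-o _ _) (o-cong p)

  prod : ℕ → (ℕ → Carrier) → Carrier
  prod zero    g = 𝟙
  prod (suc k) g = g k * prod k g

  swap-prod : ∀ j k {g h} → (∀ i → i < k → swap j (g i) ≈ h i) → swap j (prod k g) ≈ prod k h
  swap-prod j zero    e = swap-const j _
  swap-prod j (suc k) e = trans (swap-* j _ _) (*-cong (e k (ℕ.n<1+n k)) (swap-prod j k (λ i i<k → e i (ℕ.m<n⇒m<1+n i<k))))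

  Inv-prod : ∀ j k {g} → suc j < k → swap j (g j) ≈ g (suc j) → swap j (g (suc j)) ≈ g j →
             (∀ i → i < k → i ≢ j → i ≢ suc j → Inv j (g i)) → Inv j (prod k g)
  Inv-prod j (suc k) {g} (s≤s j<k) p q r with ℕ.m≤n⇒m<n∨m≡n j<k
  ... | inj₁ j<k′ = Inv-* (r k (ℕ.n<1+n k) (ℕ.>⇒≢ j<k) (ℕ.>⇒≢ j<k′)) (Inv-prod j k j<k′ p q (λ i i<k → r i (ℕ.m<n⇒m<1+n i<k)))
  ... | inj₂ ≡.refl = begin
    swap j (g (suc j) * (g j * prod j g))                 ≈⟨ trans (swap-* j _ _) (*-congˡ (swap-* j _ _)) ⟩
    swap j (g (suc j)) * (swap j (g j) * swap j (prod j g)) ≈⟨ *-cong q (*-cong p (swap-prod j j low)) ⟩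
    g j * (g (suc j) * prod j g)                          ≈⟨ x∙yz≈y∙xz _ _ _ ⟩
    g (suc j) * (g j * prod j g)                          ∎
    where
    open ≈R
    low : ∀ i → i < j → Inv j (g i)
    low i i<j = r i (ℕ.<-trans i<j (ℕ.<-trans (ℕ.n<1+n j) (ℕ.n<1+n _))) (ℕ.<⇒≢ i<j) (ℕ.<⇒≢ (ℕ.m<n⇒m<1+n i<j))

  P : ℕ → Carrier
  P k = prod k x

  E : ℕ → Carrier → Carrier
  E k y = prod k (λ j → x j - y)

  Inv-P : ∀ j k → suc j < k → k ≤ N → Inv j (P k)
  Inv-P j k j<k k≤ = Inv-prod j k j<k (swap-xˡ j j<) (swap-xʳ j j<) (λ i _ → swap-x-other j i j<)
    where j< = ℕ.<-≤-trans j<k k≤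

  Inv-E : ∀ j k {y} → suc j < k → k ≤ N → Inv j y → Inv j (E k y)
  Inv-E j k {y} j<k k≤ inv = Inv-prod j k j<k (sub (swap-xˡ j j<)) (sub (swap-xʳ j j<)) (λ i _ p q → sub (swap-x-other j i j< p q))
    where
    j< = ℕ.<-≤-trans j<k k≤
    sub : ∀ {u v} → swap j u ≈ v → swap j (u - y) ≈ v - y
    sub e = trans (swap-- j _ _) (+-cong e (-‿cong inv))

  swap-E : ∀ j k {y z} → k ≤ j → suc j < N → swap j y ≈ z → swap j (E k y) ≈ E k z
  swap-E j k k≤j j< e = swap-prod j k λ i i<k →
    trans (swap-- j _ _) (+-cong (swap-x-lower (ℕ.<-≤-trans i<k k≤j) j<) (-‿cong e))

  E-cancel : ∀ k l → k ≤ l → l < N → ∀ {f g} → E k (x l) * f ≈ E k (x l) * g → f ≈ g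
  E-cancel zero    l k≤l l< e = trans (sym (𝟙*_ _)) (trans e (𝟙*_ _))
  E-cancel (suc k) l k<l l< e = E-cancel k l (ℕ.<⇒≤ k<l) l<
    (x-x-cancelˡ k<l l< (trans (sym (*-assoc _ _ _)) (trans e (*-assoc _ _ _))))

  -- By π_k (x_{k+1} (x_k - y)) = x_k x_{k+1} (1 + βy), each operator trades one linear factor for 1
  -- + βy and hands a fresh x_k to the next operator.
  C-E : ∀ k → k < N → ∀ y → (∀ j → j < k → Inv j y) → C k (x k * E k y) ≈ P (suc k) * o y ^ k
  C-E zero    k< y inv = sym (*-identityʳ _)
  C-E (suc k) k< y inv = begin
    C k (π k (x (suc k) * ((x k - y) * E k y)))
      ≈⟨ C-cong k k<′ (π-cong k k< (solve 4 (λ a b y e → b :* ((a :- y) :* e) := e :* (b :* (a :- y))) refl _ _ _ _)) ⟩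
    C k (π k (E k y * (x (suc k) * (x k - y))))
      ≈⟨ C-cong k k<′ (π-scale k k< (swap-E k k ℕ.≤-refl k< inv-y) _) ⟩
    C k (E k y * π k (x (suc k) * (x k - y)))
      ≈⟨ C-cong k k<′ (*-congˡ (sym (π-unique k k< π-xx))) ⟩
    C k (E k y * (x k * x (suc k) * o y))
      ≈⟨ C-cong k k<′ (solve 4 (λ a b o e → e :* (a :* b :* o) := (b :* o) :* (a :* e)) refl _ _ _ _) ⟩
    C k ((x (suc k) * o y) * (x k * E k y))
      ≈⟨ C-scale k k<′ (λ j j<k → Inv-* (swap-x-upper (s≤s j<k) (ℕ.<-trans (s≤s j<k) k<)) (Inv-o (inv j (ℕ.m<n⇒m<1+n j<k)))) _ ⟩
    (x (suc k) * o y) * C k (x k * E k y)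
      ≈⟨ *-congˡ (C-E k k<′ y (λ j j<k → inv j (ℕ.m<n⇒m<1+n j<k))) ⟩
    (x (suc k) * o y) * (P (suc k) * o y ^ k)
      ≈⟨ solve 4 (λ b o p q → (b :* o) :* (p :* q) := b :* p :* (o :* q)) refl _ _ _ _ ⟩
    P (suc (suc k)) * o y ^ suc k ∎
    where
    open ≈R
    k<′ = ℕ.<⇒≤ k<
    inv-y : Inv k y
    inv-y = inv k (ℕ.n<1+n k)
    π-xx : δ k * (x k * x (suc k) * o y) ≈ A k * (x (suc k) * (x k - y)) - A′ k * swap k (x (suc k) * (x k - y))
    π-xx = begin
      δ k * (x k * x (suc k) * o y)
        ≈⟨ solve 4 (λ β a b y → (a :- b) :* (a :* b :* (con (+ 1) :+ β :* y)) :=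
             (a :+ β :* (a :* b)) :* (b :* (a :- y)) :- (b :+ β :* (a :* b)) :* (a :* (b :- y))) refl β _ _ _ ⟩
      A k * (x (suc k) * (x k - y)) - A′ k * (x k * (x (suc k) - y))
        ≈⟨ +-congˡ (-‿cong (*-congˡ (sym (trans (swap-* k _ _) (*-cong (swap-xʳ k k<)
             (trans (swap-- k _ _) (+-cong (swap-xˡ k k<) (-‿cong inv-y)))))))) ⟩
      A k * (x (suc k) * (x k - y)) - A′ k * swap k (x (suc k) * (x k - y)) ∎

  -- In closed form u^b y^d + (1 + βy) Σ_{t=1}^{d} u^{b+t} y^{d-t}. This is the q_j of the overview,
  -- with b and b + d the bounds of an entry.
  ladder : ℕ → ℕ → Carrier → Carrier → Carrier
  ladder b zero    u y = u ^ b
  ladder b (suc d) u y = y * ladder b d u y + o y * u ^ suc (b ℕ.+ d)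

  ladder-eq : ∀ b d u y → (u - y) * ladder b d u y ≈ u ^ suc (b ℕ.+ d) * o y - u ^ b * (y ^ suc d * o u)
  ladder-eq b zero u y = begin
    (u - y) * u ^ b
      ≈⟨ solve 4 (λ β u y p → (u :- y) :* p :=
           (u :* p) :* (con (+ 1) :+ β :* y) :- p :* (y :* con (+ 1) :* (con (+ 1) :+ β :* u))) refl β u y _ ⟩
    (u * u ^ b) * o y - u ^ b * (y * 𝟙 * o u)
      ≈⟨ +-cong (*-congʳ (*-congˡ (reflexive (≡.cong (u ^_) (≡.sym (ℕ.+-identityʳ b))))))
           (-‿cong (*-congˡ (*-congʳ (*-congˡ (1-homo constants))))) ⟩
    u ^ suc (b ℕ.+ 0) * o y - u ^ b * (y ^ 1 * o u) ∎
    where open ≈R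
  ladder-eq b (suc d) u y = begin
    (u - y) * (y * ladder b d u y + o y * u ^ suc (b ℕ.+ d))
      ≈⟨ solve 5 (λ u y l o p → (u :- y) :* (y :* l :+ o :* p) := y :* ((u :- y) :* l) :+ (u :- y) :* (o :* p)) refl _ _ _ _ _ ⟩
    y * ((u - y) * ladder b d u y) + (u - y) * (o y * u ^ suc (b ℕ.+ d))
      ≈⟨ +-congʳ (*-congˡ (ladder-eq b d u y)) ⟩
    y * (u ^ suc (b ℕ.+ d) * o y - u ^ b * (y ^ suc d * o u)) + (u - y) * (o y * u ^ suc (b ℕ.+ d))
      -- The two terms y u^{b+d+1} (1 + βy), one from the induction hypothesis and one from the new
      -- summand, cancel.
      ≈⟨ solve 7 (λ u y ou oy p q r → y :* (p :* oy :- q :* (r :* ou)) :+ (u :- y) :* (oy :* p) := u :* p :* oy :- q :* (y :* r :* ou)) refl u y _ _ _ _ _ ⟩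
    u * u ^ suc (b ℕ.+ d) * o y - u ^ b * (y ^ suc (suc d) * o u)
      ≈⟨ +-congʳ (*-congʳ (*-congˡ (reflexive (≡.cong (u ^_) (≡.sym (ℕ.+-suc b d)))))) ⟩
    u ^ suc (b ℕ.+ suc d) * o y - u ^ b * (y ^ suc (suc d) * o u) ∎
    where open ≈R

  -- Rows are increasing lists: the head of a list of length k + 1 is the exponent of x k.
  mono : List ℕ → Carrier
  mono []      = 𝟙
  mono (c ∷ r) = x (length r) ^ c * mono r

  Q : List ℕ → Carrier → Carrier
  Q []          y = 𝟙
  Q (c ∷ [])    y = 𝟙
  Q (c ∷ d ∷ r) y = ladder c (d ∸ c) (x (length r)) y * Q (d ∷ r) y

  -- `U` and `V` are the u_j and v_j of the overview, with u = x_j, y = x_k, d = λ_j and c =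
  -- λ_{j+1}. `G` is the product of the differences; `Us` keeps only the u_j.
  U : ℕ → Carrier → Carrier → Carrier
  V : ℕ → ℕ → Carrier → Carrier → Carrier
  U d u y = u ^ suc d * o y
  V c d u y = u ^ c * (y ^ suc (d ∸ c) * o u)

  G : List ℕ → Carrier → Carrier
  G []          y = 𝟙
  G (c ∷ [])    y = 𝟙
  G (c ∷ d ∷ r) y = (U d (x (length r)) y - V c d (x (length r)) y) * G (d ∷ r) y

  Us : List ℕ → Carrier → Carrier
  Us []      y = 𝟙
  Us (d ∷ r) y = U d (x (length r)) y * Us r y

  E-Q : ∀ c r y → Linked _≤_ (c ∷ r) → E (length r) y * Q (c ∷ r) y ≈ G (c ∷ r) y
  E-Q c []      y l         = 𝟙*_ _
  E-Q c (d ∷ r) y (c≤d ∷ l) = begin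
    ((u - y) * E (length r) y) * (ladder c (d ∸ c) u y * Q (d ∷ r) y)
      ≈⟨ solve 4 (λ a e l q → (a :* e) :* (l :* q) := (a :* l) :* (e :* q)) refl _ _ _ _ ⟩
    ((u - y) * ladder c (d ∸ c) u y) * (E (length r) y * Q (d ∷ r) y)
      ≈⟨ *-cong (ladder-eq c (d ∸ c) u y) (E-Q d r y l) ⟩
    (u ^ suc (c ℕ.+ (d ∸ c)) * o y - V c d u y) * G (d ∷ r) y
      ≈⟨ *-congʳ (+-congʳ (*-congʳ (reflexive (≡.cong (λ n → u ^ suc n) (ℕ.m+[n∸m]≡n c≤d))))) ⟩
    (U d u y - V c d u y) * G (d ∷ r) y ∎
    where
    open ≈R
    u = x (length r)

  U-swap : ∀ j d {u v y z} → swap j u ≈ v → swap j y ≈ z → swap j (U d u y) ≈ U d v z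
  U-swap j d p q = trans (swap-* j _ _) (*-cong (trans (swap-^ j _ (suc d)) (^-congˡ (suc d) p)) (trans (swap-o j _) (o-cong q)))

  V-swap : ∀ j c d {u v y z} → swap j u ≈ v → swap j y ≈ z → swap j (V c d u y) ≈ V c d v z
  V-swap j c d p q = trans (swap-* j _ _) (*-cong (trans (swap-^ j _ c) (^-congˡ c p))
    (trans (swap-* j _ _) (*-cong (trans (swap-^ j _ (suc (d ∸ c))) (^-congˡ (suc (d ∸ c)) q)) (trans (swap-o j _) (o-cong p)))))

  G-swap : ∀ j c r {y z} → length r ≤ j → suc j < N → swap j y ≈ z → swap j (G (c ∷ r) y) ≈ G (c ∷ r) z
  G-swap j c []      l≤ j< q = swap-const j _
  G-swap j c (d ∷ r) l≤ j< q = trans (swap-* j _ _) (*-cong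
    (trans (swap-- j _ _) (+-cong (U-swap j d p q) (-‿cong (V-swap j c d p q))))
    (G-swap j d r (ℕ.<⇒≤ l≤) j< q))
    where p = swap-x-lower l≤ j<

  -- The product of the u_j is the monomial of the row times a factor symmetric in x_0, x_1, ...;
  -- the same factor arises in `W-branch` from `C-E` and the 1 + βy of `A m`, so the two sides can
  -- be matched.
  Us-eq : ∀ v y → Us v y ≈ o y ^ length v * (P (length v) * mono v)
  Us-eq []      y = trans (sym (𝟙*_ _)) (trans (*-congʳ (1-homo constants)) (*-congˡ (sym (𝟙*_ _))))
  Us-eq (d ∷ r) y = trans (*-congˡ (Us-eq r y))
    (solve 6 (λ u p o q e m → (u :* p) :* o :* (q :* (e :* m)) := (o :* q) :* ((u :* e) :* (p :* m))) refl _ _ _ _ _ _)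

  -- In the expanded product every term with a factor V at x j next to a factor U at x (suc j) is killed by π j.
  W-G : ∀ k → k ≤ N → ∀ y → (∀ j → suc j < k → Inv j y) → ∀ d r T → length r < k → (∀ j → j < length r → Inv j T) →
        W k (T * (U d (x (length r)) y * G (d ∷ r) y)) ≈ W k (T * Us (d ∷ r) y)
  W-G k k≤ y inv-y d []      T l<k inv-T = refl
  W-G k k≤ y inv-y d (e ∷ r) T l<k inv-T = begin
    W k (T * (Ud * ((Ue - Vde) * Gr)))
      ≈⟨ W-cong k k≤ (solve 5 (λ t u v w g → t :* (u :* ((v :- w) :* g)) := (t :* u) :* (v :* g) :- t :* (u :* (w :* g))) refl _ _ _ _ _) ⟩
    W k ((T * Ud) * (Ue * Gr) - T * (Ud * (Vde * Gr)))
      ≈⟨ W-- k k≤ _ _ ⟩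
    W k ((T * Ud) * (Ue * Gr)) - W k (T * (Ud * (Vde * Gr)))
      ≈⟨ +-congˡ (-‿cong (W-kill k l l<k k≤ inv)) ⟩
    W k ((T * Ud) * (Ue * Gr)) - 0#
      ≈⟨ trans (+-congˡ (-‿cong (sym (0-homo constants)))) (solve 1 (λ w → w :- con (+ 0) := w) refl _) ⟩
    W k ((T * Ud) * (Ue * Gr))
      -- The selected `Ud` joins the prefix T; it involves only x_{l+1} and y, which the swaps with
      -- index below l fix.
      ≈⟨ W-G k k≤ y inv-y e r (T * Ud) (ℕ.<⇒≤ l<k) inv-T′ ⟩
    W k ((T * Ud) * Us (e ∷ r) y)
      ≈⟨ W-cong k k≤ (*-assoc _ _ _) ⟩
    W k (T * (Ud * Us (e ∷ r) y)) ∎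
    where
    open ≈R
    l = length r
    u = x (suc l)
    v = x l
    Ud = U d u y
    Ue = U e v y
    Vde = V d e v y
    Gr = G (e ∷ r) y
    l< : suc l < N
    l< = ℕ.<-≤-trans l<k k≤
    inv-T′ : ∀ j → j < l → Inv j (T * Ud)
    inv-T′ j j<l = Inv-* (inv-T j (ℕ.m<n⇒m<1+n j<l))
      (U-swap j d (swap-x-upper (s≤s j<l) (ℕ.<-trans (s≤s j<l) l<)) (inv-y j (ℕ.<-trans (s≤s j<l) l<k)))
    y-part : Carrier
    y-part = o y * y ^ suc (e ∸ d)
    -- Here v = x_l and u = x_{l+1}. The factor `A l` = v (1 + βu) supplies what is missing from v^d
    -- (1 + βv) and u^{d+1}, so `A l * (Ud * Vde)` contains H(u) H(v), which s_l fixes.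
    H : Carrier → Carrier
    H w = w ^ suc d * o w
    swap-H : ∀ {w w′} → swap l w ≈ w′ → swap l (H w) ≈ H w′
    swap-H p = trans (swap-* l _ _) (*-cong (trans (swap-^ l _ (suc d)) (^-congˡ (suc d) p)) (trans (swap-o l _) (o-cong p)))
    inv-yl : Inv l y
    inv-yl = inv-y l l<k
    inv : Inv l (A l * (T * (Ud * (Vde * Gr))))
    inv = Inv-resp
      (solve 9 (λ β u v p q y oy t g → (t :* g) :* (oy :* y) :* ((u :* p) :* (con (+ 1) :+ β :* u) :* ((v :* q) :* (con (+ 1) :+ β :* v))) :=
         (v :+ β :* (v :* u)) :* (t :* (((u :* p) :* oy) :* ((q :* (y :* (con (+ 1) :+ β :* v))) :* g)))) refl β u v (u ^ d) (v ^ d) _ _ _ _)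
      (Inv-* (Inv-* (Inv-* (inv-T l (ℕ.n<1+n l)) (G-swap l e r ℕ.≤-refl l< inv-yl)) (Inv-* (Inv-o inv-yl) (Inv-^ (suc (e ∸ d)) inv-yl)))
             (trans (swap-* l _ _) (trans (*-cong (swap-H (swap-xʳ l l<)) (swap-H (swap-xˡ l l<))) (*-comm _ _))))

  -- After multiplication by E k (x k), the two terms of (x m − x k) π m become the two terms U and V of the first factor of G.
  W-branch : ∀ c r → Linked _≤_ (c ∷ r) → length r < N →
             W (suc (length r)) (mono (c ∷ r)) ≈ W (length r) (x (length r) ^ c * Q (c ∷ r) (x (length r)))
  W-branch c []       l         k< = refl
  W-branch c (d ∷ r′) (c≤d ∷ l) k< = E-cancel k k ℕ.≤-refl k< (begin
    E k y * W (suc k) (mono (c ∷ d ∷ r′))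
      ≈⟨ *-congˡ (W-C′ k k< _) ⟩
    E k y * W k (C′ k (y ^ c * M))
      -- The operators in `C′ m` do not involve x_k, so y^c passes them and only π_m acts on it.
      ≈⟨ *-congˡ (W-cong k k≤ (π-cong m k< (C′-scale m m< (λ j j<m → Inv-^ c (inv-y j j<m)) M))) ⟩
    E k y * W k (π m (y ^ c * h))
      ≈⟨ sym (W-scale k k≤ (λ j j<k → Inv-E j k j<k k≤ (inv-y j (ℕ.≤-pred j<k))) _) ⟩
    W k (((z - y) * E m y) * π m (y ^ c * h))
      ≈⟨ W-cong k k≤ (trans (solve 3 (λ d e p → (d :* e) :* p := e :* (d :* p)) refl _ _ _) (*-congˡ (π-eq m k< _))) ⟩
    W k (E m y * (A m * (y ^ c * h) - A′ m * swap m (y ^ c * h)))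
      ≈⟨ W-cong k k≤ (solve 3 (λ e a b → e :* (a :- b) := e :* a :- e :* b) refl _ _ _) ⟩
    W k (E m y * (A m * (y ^ c * h)) - E m y * (A′ m * swap m (y ^ c * h)))
      ≈⟨ W-- k k≤ _ _ ⟩
    W k (E m y * (A m * (y ^ c * h))) - W k (E m y * (A′ m * swap m (y ^ c * h)))
      ≈⟨ +-cong first (-‿cong second) ⟩
    W k (y ^ c * (U d z y * Gy)) - W k (y ^ c * (V c d z y * Gy))
      ≈⟨ sym (W-- k k≤ _ _) ⟩
    W k (y ^ c * (U d z y * Gy) - y ^ c * (V c d z y * Gy))
      ≈⟨ W-cong k k≤ (solve 4 (λ p u v g → p :* (u :* g) :- p :* (v :* g) := p :* ((u :- v) :* g)) refl _ _ _ _) ⟩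
    W k (y ^ c * G (c ∷ d ∷ r′) y)
      ≈⟨ W-cong k k≤ (trans (*-congˡ (sym (E-Q c (d ∷ r′) y (c≤d ∷ l)))) (x∙yz≈y∙xz _ _ _)) ⟩
    W k (E k y * (y ^ c * Q (c ∷ d ∷ r′) y))
      ≈⟨ W-scale k k≤ (λ j j<k → Inv-E j k j<k k≤ (inv-y j (ℕ.≤-pred j<k))) _ ⟩
    E k y * W k (y ^ c * Q (c ∷ d ∷ r′) y) ∎)
    where
    open ≈R
    m = length r′
    k = suc m
    k≤ : k ≤ N
    k≤ = ℕ.<⇒≤ k<
    m< : m < N
    m< = k≤
    m≤ : m ≤ N
    m≤ = ℕ.<⇒≤ m<
    y = x k
    z = x m
    M = mono (d ∷ r′)
    h = C′ m M
    Gy = G (d ∷ r′) y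
    inv-y : ∀ j → j < m → Inv j y
    inv-y j j<m = swap-x-upper (s≤s j<m) (ℕ.<-trans (s≤s j<m) k<)
    inv-z : ∀ j → suc j < m → Inv j z
    inv-z j j<m = swap-x-upper j<m (ℕ.<-trans j<m m<)
    first : W k (E m y * (A m * (y ^ c * h))) ≈ W k (y ^ c * (U d z y * Gy))
    first = begin
      W k (E m y * (A m * (y ^ c * h)))
        ≈⟨ W-cong k k≤ (solve 6 (λ β y z e p h → e :* ((z :+ β :* (z :* y)) :* (p :* h)) := (p :* (con (+ 1) :+ β :* y)) :* ((z :* e) :* h)) refl β y z _ _ _) ⟩
      W k ((y ^ c * o y) * ((z * E m y) * h))
        ≈⟨ W-scale k k≤ (λ j j<k → Inv-* (Inv-^ c (inv-y j (ℕ.≤-pred j<k))) (Inv-o (inv-y j (ℕ.≤-pred j<k)))) _ ⟩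
      (y ^ c * o y) * C m (W m ((z * E m y) * h))
        -- Here W_k = C_m W_m. The scalar z E_m(y) leaves W_m; what remains is W_m h = W_k M, and
        -- its symmetry lets it leave C_m in turn.
        ≈⟨ *-congˡ (C-cong m m< (trans
             (W-scale m m≤ (λ j j<m → Inv-* (inv-z j j<m) (Inv-E j m j<m m≤ (inv-y j (ℕ.<⇒≤ j<m)))) h)
             (trans (*-congˡ (sym (W-C′ m m< M))) (*-comm _ _)))) ⟩
      (y ^ c * o y) * C m (W k M * (z * E m y))
        ≈⟨ *-congˡ (C-scale m m< (λ j j<m → Inv-W k j (s≤s j<m) k≤ M) _) ⟩
      (y ^ c * o y) * (W k M * C m (z * E m y))
        ≈⟨ *-congˡ (*-congˡ (C-E m m< y inv-y)) ⟩
      (y ^ c * o y) * (W k M * (P k * o y ^ m))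
        ≈⟨ solve 5 (λ a o w p q → (a :* o) :* (w :* (p :* q)) := (a :* ((o :* q) :* p)) :* w) refl _ _ _ _ _ ⟩
      (y ^ c * (o y ^ k * P k)) * W k M
        ≈⟨ sym (W-scale k k≤ (λ j j<k → let inv = inv-y j (ℕ.≤-pred j<k) in
             Inv-* (Inv-^ c inv) (Inv-* (Inv-^ k (Inv-o inv)) (Inv-P j k j<k k≤))) M) ⟩
      W k ((y ^ c * (o y ^ k * P k)) * M)
        ≈⟨ W-cong k k≤ (trans (solve 4 (λ a b c d → (a :* (b :* c)) :* d := a :* (b :* (c :* d))) refl _ _ _ _)
             (*-congˡ (sym (Us-eq (d ∷ r′) y)))) ⟩
      W k (y ^ c * Us (d ∷ r′) y)
        ≈⟨ sym (W-G k k≤ y (λ j j<k → inv-y j (ℕ.≤-pred j<k)) d r′ (y ^ c) (ℕ.n<1+n m) (λ j j<m → Inv-^ c (inv-y j j<m))) ⟩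
      W k (y ^ c * (U d z y * Gy)) ∎
    Gz = G (d ∷ r′) z
    second : W k (E m y * (A′ m * swap m (y ^ c * h))) ≈ W k (y ^ c * (V c d z y * Gy))
    -- The outer C_m stays untouched, since s_m commutes with W_m but not with C_m.
    second = C-cong m m< (begin
      W m (E m y * (A′ m * swap m (y ^ c * h)))
        ≈⟨ W-cong m m≤ (*-congˡ (*-congˡ (trans (swap-* m _ _) (*-congʳ (trans (swap-^ m y c) (^-congˡ c (swap-xʳ m k<))))))) ⟩
      W m (E m y * (A′ m * (z ^ c * swap m h)))
        ≈⟨ W-cong m m≤ (solve 4 (λ e a b s → e :* (a :* (b :* s)) := (a :* b) :* (e :* s)) refl _ _ _ _) ⟩
      W m ((A′ m * z ^ c) * (E m y * swap m h))
        ≈⟨ W-scale m m≤ scalar _ ⟩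
      (A′ m * z ^ c) * W m (E m y * swap m h)
        ≈⟨ *-congˡ inner ⟩
      (A′ m * z ^ c) * W m (y ^ d * Gy)
        ≈⟨ sym (W-scale m m≤ scalar _) ⟩
      W m ((A′ m * z ^ c) * (y ^ d * Gy))
        -- Since c ≤ d, y^d splits: y^{d-c} joins the y of `A′ m` to form the power y^{d-c+1} in
        -- `V`, and y^c becomes the prefactor shared with the first term.
        ≈⟨ W-cong m m≤ (*-congˡ (*-congʳ (trans (reflexive (≡.cong (y ^_) (≡.sym (ℕ.m+[n∸m]≡n c≤d)))) (^-homo-* y c (d ∸ c))))) ⟩
      W m ((A′ m * z ^ c) * ((y ^ c * y ^ (d ∸ c)) * Gy))
        ≈⟨ W-cong m m≤ (solve 7 (λ β y z p q r g → ((y :+ β :* (z :* y)) :* p) :* ((q :* r) :* g) :=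
             q :* ((p :* ((y :* r) :* (con (+ 1) :+ β :* z))) :* g)) refl β y z _ _ _ _) ⟩
      W m (y ^ c * (V c d z y * Gy)) ∎)
      where
      scalar : ∀ j → suc j < m → Inv j (A′ m * z ^ c)
      scalar j j<m = Inv-* (Inv-A′-far (ℕ.<-trans j<m m<) k< (inj₁ j<m)) (Inv-^ c (inv-z j j<m))
      inner : W m (E m y * swap m h) ≈ W m (y ^ d * Gy)
      inner = begin
        W m (E m y * swap m h)
          ≈⟨ W-cong m m≤ (sym (trans (swap-* m _ _) (*-congʳ (swap-E m m ℕ.≤-refl k< (swap-xˡ m k<))))) ⟩
        W m (swap m (E m z * h))
          ≈⟨ sym (swap-W-far m m ℕ.≤-refl k< _) ⟩
        swap m (W m (E m z * h))
          ≈⟨ swap-cong m (begin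
               W m (E m z * h)                    ≈⟨ W-scale m m≤ inv-E h ⟩
               -- The induction hypothesis, for the row without its head c; its last variable is z,
               -- and the surrounding s_m turns z into y.
               E m z * W m h                      ≈⟨ *-congˡ (trans (sym (W-C′ m m< M)) (W-branch d r′ l m<)) ⟩
               E m z * W m (z ^ d * Q (d ∷ r′) z) ≈⟨ sym (W-scale m m≤ inv-E _) ⟩
               W m (E m z * (z ^ d * Q (d ∷ r′) z)) ≈⟨ W-cong m m≤ (trans (x∙yz≈y∙xz _ _ _) (*-congˡ (E-Q d r′ z l))) ⟩
               W m (z ^ d * Gz)                   ∎) ⟩
        swap m (W m (z ^ d * Gz))
          ≈⟨ swap-W-far m m ℕ.≤-refl k< _ ⟩
        W m (swap m (z ^ d * Gz))
          ≈⟨ W-cong m m≤ (trans (swap-* m _ _) (*-cong (trans (swap-^ m z d) (^-congˡ d (swap-xˡ m k<))) (G-swap m d r′ ℕ.≤-refl k< (swap-xˡ m k<)))) ⟩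
        W m (y ^ d * Gy) ∎
        where
        inv-E : ∀ j → suc j < m → Inv j (E m z)
        inv-E j j<m = Inv-E j m j<m m≤ (inv-z j j<m)

-- The polynomial ring of formal sums

module PolynomialRing where
  open ≡

  Exponents : ℕ → Set
  Exponents n = ℕ × Vec ℕ n

  module FormalSums (n : ℕ) where

    private
      M = Exponents n

    infixl 7 _∙_
    _∙_ : M → M → M
    (k , a) ∙ (l , b) = k ℕ.+ l , zipWith ℕ._+_ a b

    ε : M
    ε = 0 , replicate n 0

    ∙-assoc : ∀ m m′ m″ → (m ∙ m′) ∙ m″ ≡ m ∙ (m′ ∙ m″)
    ∙-assoc (k , a) (l , b) (j , c) = cong₂ _,_ (ℕ.+-assoc k l j) (Vec.zipWith-assoc ℕ.+-assoc a b c)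

    ∙-comm : ∀ m m′ → m ∙ m′ ≡ m′ ∙ m
    ∙-comm (k , a) (l , b) = cong₂ _,_ (ℕ.+-comm k l) (Vec.zipWith-comm ℕ.+-comm a b)

    ∙-identityˡ : ∀ m → ε ∙ m ≡ m
    ∙-identityˡ (k , a) = cong (k ,_) (Vec.zipWith-identityˡ ℕ.+-identityˡ a)

    -- Equality of polynomials is tested against all functions on monomials, coefficients being a special case:
    -- linear operators then respect it for free.
    ⟨_∣_⟩ : Poly n → (M → ℤ) → ℤ
    ⟨ []          ∣ φ ⟩ = + 0
    ⟨ (c , m) ∷ p ∣ φ ⟩ = c ℤ.* φ m ℤ.+ ⟨ p ∣ φ ⟩

    infix 4 _≋_
    record _≋_ (p q : Poly n) : Set where
      constructor mk
      field at : ∀ φ → ⟨ p ∣ φ ⟩ ≡ ⟨ q ∣ φ ⟩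
    open _≋_ public

    open +-*-Solver using (solve; _:=_; _:+_; _:*_; _:-_; :-_; con)

    pair-++ : ∀ p q φ → ⟨ p ++ q ∣ φ ⟩ ≡ ⟨ p ∣ φ ⟩ ℤ.+ ⟨ q ∣ φ ⟩
    pair-++ []            q φ = sym (ℤ.+-identityˡ _)
    pair-++ ((c , m) ∷ p) q φ = trans (cong (λ s → c ℤ.* φ m ℤ.+ s) (pair-++ p q φ)) (sym (ℤ.+-assoc (c ℤ.* φ m) _ _))

    pair-cong : ∀ p {φ ψ} → (∀ m → φ m ≡ ψ m) → ⟨ p ∣ φ ⟩ ≡ ⟨ p ∣ ψ ⟩
    pair-cong []            e = refl
    pair-cong ((c , m) ∷ p) e = cong₂ (λ u v → c ℤ.* u ℤ.+ v) (e m) (pair-cong p e)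

    pair-+ : ∀ p φ ψ → ⟨ p ∣ (λ m → φ m ℤ.+ ψ m) ⟩ ≡ ⟨ p ∣ φ ⟩ ℤ.+ ⟨ p ∣ ψ ⟩
    pair-+ []            φ ψ = refl
    pair-+ ((c , m) ∷ p) φ ψ rewrite pair-+ p φ ψ =
      solve 5 (λ c a b s t → c :* (a :+ b) :+ (s :+ t) := (c :* a :+ s) :+ (c :* b :+ t)) refl c (φ m) (ψ m) _ _

    pair-scale : ∀ p a φ → ⟨ p ∣ (λ m → a ℤ.* φ m) ⟩ ≡ a ℤ.* ⟨ p ∣ φ ⟩
    pair-scale []            a φ = sym (ℤ.*-zeroʳ a)
    pair-scale ((c , m) ∷ p) a φ rewrite pair-scale p a φ =
      solve 4 (λ c a f s → c :* (a :* f) :+ a :* s := a :* (c :* f :+ s)) refl c a (φ m) _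

    pair-0 : ∀ p → ⟨ p ∣ (λ _ → + 0) ⟩ ≡ + 0
    pair-0 []            = refl
    pair-0 ((c , m) ∷ p) = trans (cong₂ ℤ._+_ (ℤ.*-zeroʳ c) (pair-0 p)) refl

    -- Exchange of two finite sums; commutativity of the product reduces to it.
    pair-swap : ∀ p q (ψ : M → M → ℤ) → ⟨ p ∣ (λ m → ⟨ q ∣ ψ m ⟩) ⟩ ≡ ⟨ q ∣ (λ m′ → ⟨ p ∣ (λ m → ψ m m′) ⟩) ⟩
    pair-swap []            q ψ = sym (pair-0 q)
    pair-swap ((c , m) ∷ p) q ψ = begin
      c ℤ.* ⟨ q ∣ ψ m ⟩ ℤ.+ ⟨ p ∣ (λ m → ⟨ q ∣ ψ m ⟩) ⟩
        ≡⟨ cong₂ ℤ._+_ (sym (pair-scale q c (ψ m))) (pair-swap p q ψ) ⟩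
      ⟨ q ∣ (λ m′ → c ℤ.* ψ m m′) ⟩ ℤ.+ ⟨ q ∣ (λ m′ → ⟨ p ∣ (λ m → ψ m m′) ⟩) ⟩
        ≡⟨ sym (pair-+ q _ _) ⟩
      ⟨ q ∣ (λ m′ → c ℤ.* ψ m m′ ℤ.+ ⟨ p ∣ (λ m → ψ m m′) ⟩) ⟩ ∎
      where open ≡-Reasoning

    -- A termwise operator acts on test functions by its transpose, with `T m φ` the new value at m.
    -- Once an operator is written in this way, its congruence for `_≋_` is an instance of `at`.
    pair-concatMap : ∀ (F : Term n → Poly n) (T : M → (M → ℤ) → ℤ) →
      (∀ c m φ → ⟨ F (c , m) ∣ φ ⟩ ≡ c ℤ.* T m φ) → ∀ p φ → ⟨ concatMap F p ∣ φ ⟩ ≡ ⟨ p ∣ (λ m → T m φ) ⟩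
    pair-concatMap F T e []            φ = refl
    pair-concatMap F T e ((c , m) ∷ p) φ =
      trans (pair-++ (F (c , m)) _ φ) (cong₂ ℤ._+_ (e c m φ) (pair-concatMap F T e p φ))

    pair-map : ∀ (F : Term n → Term n) (c₀ : ℤ) (f : M → M) → (∀ c m → F (c , m) ≡ (c₀ ℤ.* c , f m)) →
      ∀ p φ → ⟨ map F p ∣ φ ⟩ ≡ c₀ ℤ.* ⟨ p ∣ φ ∘ f ⟩
    pair-map F c₀ f e []            φ = sym (ℤ.*-zeroʳ c₀)
    pair-map F c₀ f e ((c , m) ∷ p) φ rewrite e c m | pair-map F c₀ f e p φ =
      solve 4 (λ a c f s → (a :* c) :* f :+ a :* s := a :* (c :* f :+ s)) refl c₀ c (φ (f m)) _

    negate : Poly n → Poly n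
    negate = map (λ { (c , m) → ℤ.- (+ 1) ℤ.* c , m })

    infixl 7 _⊛_
    _⊛_ : Poly n → Poly n → Poly n
    p ⊛ q = concatMap (λ { (c , m) → map (λ { (d , m′) → c ℤ.* d , m ∙ m′ }) q }) p

    pair-negate : ∀ p φ → ⟨ negate p ∣ φ ⟩ ≡ ℤ.- ⟨ p ∣ φ ⟩
    pair-negate p φ = trans (pair-map _ (ℤ.- (+ 1)) id (λ _ _ → refl) p φ) (ℤ.-1*i≡-i _)

    pair-⊛ : ∀ p q φ → ⟨ p ⊛ q ∣ φ ⟩ ≡ ⟨ p ∣ (λ m → ⟨ q ∣ (λ m′ → φ (m ∙ m′)) ⟩) ⟩
    pair-⊛ p q = pair-concatMap _ (λ m φ → ⟨ q ∣ (λ m′ → φ (m ∙ m′)) ⟩)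
      (λ c m φ → pair-map _ c (m ∙_) (λ _ _ → refl) q φ) p

    const : ℤ → Poly n
    const c = (c , ε) ∷ []

    pair-const⊛ : ∀ c p φ → ⟨ const c ⊛ p ∣ φ ⟩ ≡ c ℤ.* ⟨ p ∣ φ ⟩
    pair-const⊛ c p φ = trans (pair-⊛ (const c) p φ)
      (trans (ℤ.+-identityʳ _) (cong (c ℤ.*_) (pair-cong p (λ m → cong φ (∙-identityˡ m)))))

    ⊛-comm : ∀ p q → p ⊛ q ≋ q ⊛ p
    ⊛-comm p q .at φ = begin
      ⟨ p ⊛ q ∣ φ ⟩                                  ≡⟨ pair-⊛ p q φ ⟩
      ⟨ p ∣ (λ m → ⟨ q ∣ (λ m′ → φ (m ∙ m′)) ⟩) ⟩    ≡⟨ pair-swap p q _ ⟩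
      ⟨ q ∣ (λ m′ → ⟨ p ∣ (λ m → φ (m ∙ m′)) ⟩) ⟩    ≡⟨ pair-cong q (λ m′ → pair-cong p (λ m → cong φ (∙-comm m m′))) ⟩
      ⟨ q ∣ (λ m′ → ⟨ p ∣ (λ m → φ (m′ ∙ m)) ⟩) ⟩    ≡⟨ sym (pair-⊛ q p φ) ⟩
      ⟨ q ⊛ p ∣ φ ⟩                                  ∎
      where open ≡-Reasoning

    ⊛-assoc : ∀ p q r → (p ⊛ q) ⊛ r ≋ p ⊛ (q ⊛ r)
    ⊛-assoc p q r .at φ = begin
      ⟨ (p ⊛ q) ⊛ r ∣ φ ⟩
        ≡⟨ trans (pair-⊛ (p ⊛ q) r φ) (pair-⊛ p q _) ⟩
      ⟨ p ∣ (λ m → ⟨ q ∣ (λ m′ → ⟨ r ∣ (λ m″ → φ ((m ∙ m′) ∙ m″)) ⟩) ⟩) ⟩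
        ≡⟨ pair-cong p (λ m → trans (pair-cong q (λ m′ → pair-cong r (λ m″ → cong φ (∙-assoc m m′ m″)))) (sym (pair-⊛ q r _))) ⟩
      ⟨ p ∣ (λ m → ⟨ q ⊛ r ∣ (λ m′ → φ (m ∙ m′)) ⟩) ⟩
        ≡⟨ sym (pair-⊛ p (q ⊛ r) φ) ⟩
      ⟨ p ⊛ (q ⊛ r) ∣ φ ⟩ ∎
      where open ≡-Reasoning

    ⊛-cong : ∀ {p p′ q q′} → p ≋ p′ → q ≋ q′ → p ⊛ q ≋ p′ ⊛ q′
    ⊛-cong {p} {p′} {q} {q′} e e′ .at φ = begin
      ⟨ p ⊛ q ∣ φ ⟩                                   ≡⟨ pair-⊛ p q φ ⟩
      ⟨ p ∣ (λ m → ⟨ q ∣ (λ m′ → φ (m ∙ m′)) ⟩) ⟩     ≡⟨ at e _ ⟩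
      ⟨ p′ ∣ (λ m → ⟨ q ∣ (λ m′ → φ (m ∙ m′)) ⟩) ⟩    ≡⟨ pair-cong p′ (λ m → at e′ _) ⟩
      ⟨ p′ ∣ (λ m → ⟨ q′ ∣ (λ m′ → φ (m ∙ m′)) ⟩) ⟩   ≡⟨ sym (pair-⊛ p′ q′ φ) ⟩
      ⟨ p′ ⊛ q′ ∣ φ ⟩                                 ∎
      where open ≡-Reasoning

    ++-cong : ∀ {p p′ q q′} → p ≋ p′ → q ≋ q′ → p ++ q ≋ p′ ++ q′
    ++-cong {p} {p′} {q} {q′} e e′ .at φ =
      trans (pair-++ p q φ) (trans (cong₂ ℤ._+_ (at e φ) (at e′ φ)) (sym (pair-++ p′ q′ φ)))

    ++-comm : ∀ p q → p ++ q ≋ q ++ p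
    ++-comm p q .at φ = trans (pair-++ p q φ) (trans (ℤ.+-comm ⟨ p ∣ φ ⟩ _) (sym (pair-++ q p φ)))

    negate-inverseˡ : ∀ p → negate p ++ p ≋ []
    negate-inverseˡ p .at φ = trans (pair-++ (negate p) p φ) (trans (cong (ℤ._+ ⟨ p ∣ φ ⟩) (pair-negate p φ)) (ℤ.+-inverseˡ ⟨ p ∣ φ ⟩))

    ⊛-distribʳ : ∀ r p q → (p ++ q) ⊛ r ≋ (p ⊛ r) ++ (q ⊛ r)
    ⊛-distribʳ r p q .at φ = begin
      ⟨ (p ++ q) ⊛ r ∣ φ ⟩                ≡⟨ trans (pair-⊛ (p ++ q) r φ) (pair-++ p q _) ⟩
      _                                   ≡⟨ sym (cong₂ ℤ._+_ (pair-⊛ p r φ) (pair-⊛ q r φ)) ⟩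
      ⟨ p ⊛ r ∣ φ ⟩ ℤ.+ ⟨ q ⊛ r ∣ φ ⟩     ≡⟨ sym (pair-++ (p ⊛ r) _ φ) ⟩
      ⟨ (p ⊛ r) ++ (q ⊛ r) ∣ φ ⟩          ∎
      where open ≡-Reasoning

    ⊛-identityˡ : ∀ p → const (+ 1) ⊛ p ≋ p
    ⊛-identityˡ p .at φ = trans (pair-const⊛ (+ 1) p φ) (ℤ.*-identityˡ _)

    ≋-refl : ∀ {p} → p ≋ p
    ≋-refl .at φ = refl
    ≋-sym : ∀ {p q} → p ≋ q → q ≋ p
    ≋-sym e .at φ = sym (at e φ)
    ≋-trans : ∀ {p q r} → p ≋ q → q ≋ r → p ≋ r
    ≋-trans e e′ .at φ = trans (at e φ) (at e′ φ)
    ≋-reflexive : ∀ {p q} → p ≡ q → p ≋ q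
    ≋-reflexive refl = ≋-refl

    commutativeRing : CommutativeRing 0ℓ 0ℓ
    commutativeRing = record
      { Carrier = Poly n
      ; _≈_ = _≋_
      ; _+_ = _++_
      ; _*_ = _⊛_
      ; -_  = negate
      ; 0#  = []
      ; 1#  = const (+ 1)
      ; isCommutativeRing = record
        { isRing = record
          { +-isAbelianGroup = record
            { isGroup = record
              { isMonoid = record
                { isSemigroup = record
                  { isMagma = record
                    { isEquivalence = record { refl = ≋-refl ; sym = ≋-sym ; trans = ≋-trans }
                    ; ∙-cong = ++-cong
                    }
                  ; assoc = λ p q r → ≋-reflexive (List.++-assoc p q r)
                  }
                ; identity = (λ _ → ≋-refl) , (λ p → ≋-reflexive (List.++-identityʳ p))
                }
              ; inverse = negate-inverseˡ , (λ p → ≋-trans (++-comm p (negate p)) (negate-inverseˡ p))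
              ; ⁻¹-cong = λ {p} {q} e → mk λ φ → trans (pair-negate p φ) (trans (cong ℤ.-_ (at e φ)) (sym (pair-negate q φ)))
              }
            ; comm = ++-comm
            }
          ; *-cong = ⊛-cong
          ; *-assoc = ⊛-assoc
          ; *-identity = ⊛-identityˡ , (λ p → ≋-trans (⊛-comm p _) (⊛-identityˡ p))
          ; distrib = (λ r p q → ≋-trans (⊛-comm r (p ++ q)) (≋-trans (⊛-distribʳ r p q) (++-cong (⊛-comm p r) (⊛-comm q r)))) , ⊛-distribʳ
          }
        ; *-comm = ⊛-comm
        }
      }

    constants : +-*-rawRing -Raw-AlmostCommutative⟶ fromCommutativeRing commutativeRing
    constants = record
      { ⟦_⟧    = const
      ; +-homo = λ c d → mk λ φ → solve 3 (λ c d f → (c :+ d) :* f :+ con (+ 0) := c :* f :+ (d :* f :+ con (+ 0))) refl c d (φ ε)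
      ; *-homo = λ c d → ≋-reflexive (cong (λ m → (c ℤ.* d , m) ∷ []) (sym (∙-identityˡ ε)))
      ; -‿homo = λ c → mk λ φ → solve 2 (λ c f → (:- c) :* f :+ con (+ 0) := (:- con (+ 1) :* c) :* f :+ con (+ 0)) refl c (φ ε)
      ; 0-homo = mk λ φ → refl
      ; 1-homo = ≋-refl
      }

  -- Exponent vectors, with positions counted from 0

  unit : ∀ n → ℕ → Vec ℕ n
  unit n i = xVar n (suc i)

  infixl 6 _⊕_
  _⊕_ : ∀ {n} → Vec ℕ n → Vec ℕ n → Vec ℕ n
  _⊕_ = zipWith ℕ._+_

  swapVec : ∀ {n} → ℕ → Vec ℕ n → Vec ℕ n
  swapVec i       []          = []
  swapVec zero    (a ∷ [])    = a ∷ []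
  swapVec zero    (a ∷ b ∷ v) = b ∷ a ∷ v
  swapVec (suc i) (a ∷ v)     = a ∷ swapVec i v

  swapVec-⊕ : ∀ {n} i (v w : Vec ℕ n) → swapVec i (v ⊕ w) ≡ swapVec i v ⊕ swapVec i w
  swapVec-⊕ i       []          []          = refl
  swapVec-⊕ zero    (a ∷ [])    (b ∷ [])    = refl
  swapVec-⊕ zero    (a ∷ _ ∷ v) (b ∷ _ ∷ w) = refl
  swapVec-⊕ (suc i) (a ∷ v)     (b ∷ w)     = cong (_ ∷_) (swapVec-⊕ i v w)

  swapVec-replicate : ∀ n i → swapVec i (replicate n 0) ≡ replicate n 0
  swapVec-replicate zero          i       = refl
  swapVec-replicate (suc zero)    zero    = refl
  swapVec-replicate (suc (suc n)) zero    = refl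
  swapVec-replicate (suc n)       (suc i) = cong (0 ∷_) (swapVec-replicate n i)

  swapVec-involutive : ∀ {n} i (v : Vec ℕ n) → swapVec i (swapVec i v) ≡ v
  swapVec-involutive i       []          = refl
  swapVec-involutive zero    (a ∷ [])    = refl
  swapVec-involutive zero    (a ∷ b ∷ v) = refl
  swapVec-involutive (suc i) (a ∷ v)     = cong (a ∷_) (swapVec-involutive i v)

  swapVec-comm : ∀ {n} i j → suc i < j → (v : Vec ℕ n) → swapVec i (swapVec j v) ≡ swapVec j (swapVec i v)
  swapVec-comm i       j             i<j       []          = refl
  swapVec-comm zero    (suc (suc j)) i<j       (a ∷ [])    = refl
  swapVec-comm zero    (suc zero)    (s≤s ())  (a ∷ [])
  swapVec-comm zero    (suc zero)    (s≤s ())  (a ∷ b ∷ v)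
  swapVec-comm zero    (suc (suc j)) i<j       (a ∷ b ∷ v) = refl
  swapVec-comm (suc i) (suc j)       (s≤s i<j) (a ∷ v)     = cong (a ∷_) (swapVec-comm i j i<j v)

  swapVec-braid : ∀ {n} i → suc (suc i) < n → (v : Vec ℕ n) →
    swapVec i (swapVec (suc i) (swapVec i v)) ≡ swapVec (suc i) (swapVec i (swapVec (suc i) v))
  swapVec-braid zero    i<       (a ∷ b ∷ c ∷ v) = refl
  swapVec-braid zero    (s≤s (s≤s ())) (a ∷ b ∷ [])
  swapVec-braid zero    (s≤s ()) (a ∷ [])
  swapVec-braid (suc i) (s≤s i<) (a ∷ v)         = cong (a ∷_) (swapVec-braid i i< v)

  swapVec-unit : ∀ n i → suc i < n → swapVec i (unit n i) ≡ unit n (suc i)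
  swapVec-unit (suc (suc n)) zero    i<       = refl
  swapVec-unit (suc zero)    zero    (s≤s ())
  swapVec-unit (suc n)       (suc i) (s≤s i<) = cong (0 ∷_) (swapVec-unit n i i<)

  swapVec-unit-other : ∀ n i j → suc i < n → j ≢ i → j ≢ suc i → swapVec i (unit n j) ≡ unit n j
  swapVec-unit-other (suc zero)    zero    j             (s≤s ()) p q
  swapVec-unit-other (suc (suc n)) zero    zero          i<       p q = ⊥-elim (p refl)
  swapVec-unit-other (suc (suc n)) zero    (suc zero)    i<       p q = ⊥-elim (q refl)
  swapVec-unit-other (suc (suc n)) zero    (suc (suc j)) i<       p q = refl
  swapVec-unit-other (suc n)       (suc i) zero          i<       p q = cong (1 ∷_) (swapVec-replicate n i)
  swapVec-unit-other (suc n)       (suc i) (suc j)       (s≤s i<) p q =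
    cong (0 ∷_) (swapVec-unit-other n i j i< (p ∘ cong suc) (q ∘ cong suc))

  vget-unit⊕ : ∀ {n} i (v : Vec ℕ n) → i < n → vget (unit n i ⊕ v) i ≡ suc (vget v i)
  vget-unit⊕ zero    (a ∷ v) i<       = refl
  vget-unit⊕ (suc i) (a ∷ v) (s≤s i<) = vget-unit⊕ i v i<

  vget-unit⊕-other : ∀ {n} i j (v : Vec ℕ n) → j ≢ i → vget (unit n j ⊕ v) i ≡ vget v i
  vget-unit⊕-other i       j       []      j≢i = refl
  vget-unit⊕-other zero    zero    (a ∷ v) j≢i = ⊥-elim (j≢i refl)
  vget-unit⊕-other zero    (suc j) (a ∷ v) j≢i = refl
  vget-unit⊕-other (suc i) zero    (a ∷ v) j≢i = cong (λ w → vget w i) (Vec.zipWith-identityˡ ℕ.+-identityˡ v)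
  vget-unit⊕-other (suc i) (suc j) (a ∷ v) j≢i = vget-unit⊕-other i j v (j≢i ∘ cong suc)

  -- Division by x_i on exponents. Truncation at 0 is harmless, because it is inverted only on
  -- multiples of x_i.
  lowerVec : ∀ {n} → ℕ → Vec ℕ n → Vec ℕ n
  lowerVec i v = vset v i (ℕ.pred (vget v i))

  lowerVec-unit⊕ : ∀ {n} i (v : Vec ℕ n) → lowerVec i (unit n i ⊕ v) ≡ v
  lowerVec-unit⊕ i       []      = refl
  lowerVec-unit⊕ zero    (a ∷ v) = cong (a ∷_) (Vec.zipWith-identityˡ ℕ.+-identityˡ v)
  lowerVec-unit⊕ (suc i) (a ∷ v) = cong (a ∷_) (lowerVec-unit⊕ i v)

  place : ∀ {n} → ℕ → Vec ℕ n → ℕ → ℕ → Vec ℕ n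
  place i v s r = vset (vset v i s) (suc i) r

  unit⊕place : ∀ {n} i (v : Vec ℕ n) s r → unit n i ⊕ place i v s r ≡ place i v (suc s) r
  unit⊕place i       []          s r = refl
  unit⊕place zero    (a ∷ v)     s r = cong (suc s ∷_) (Vec.zipWith-identityˡ ℕ.+-identityˡ _)
  unit⊕place (suc i) (a ∷ v)     s r = cong (a ∷_) (unit⊕place i v s r)

  unit⊕placeʳ : ∀ {n} i (v : Vec ℕ n) s r → unit n (suc i) ⊕ place i v s r ≡ place i v s (suc r)
  unit⊕placeʳ i       []          s r = refl
  unit⊕placeʳ zero    (a ∷ [])    s r = refl
  unit⊕placeʳ zero    (a ∷ b ∷ v) s r = cong (λ w → s ∷ suc r ∷ w) (Vec.zipWith-identityˡ ℕ.+-identityˡ v)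
  unit⊕placeʳ (suc i) (a ∷ v)     s r = cong (a ∷_) (unit⊕placeʳ i v s r)

  place-self : ∀ {n} i (v : Vec ℕ n) → place i v (vget v i) (vget v (suc i)) ≡ v
  place-self i       []          = refl
  place-self zero    (a ∷ [])    = refl
  place-self zero    (a ∷ b ∷ v) = refl
  place-self (suc i) (a ∷ v)     = cong (a ∷_) (place-self i v)

  place-swap : ∀ {n} i (v : Vec ℕ n) → suc i < n → place i v (vget v (suc i)) (vget v i) ≡ swapVec i v
  place-swap zero    (a ∷ b ∷ v) i<       = refl
  place-swap zero    (a ∷ [])    (s≤s ())
  place-swap (suc i) (a ∷ v)     (s≤s i<) = cong (a ∷_) (place-swap i v i<)

  -- Swaps and divided differences of formal sums

  module PolynomialOperators (n : ℕ) where
    open FormalSums n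
    open +-*-Solver using (solve; _:=_; _:+_; _:*_; _:-_; :-_; con)

    var : ℕ → Poly n
    var i = (+ 1 , 0 , unit n i) ∷ []

    βₚ : Poly n
    βₚ = (+ 1 , 1 , replicate n 0) ∷ []

    swapExp : ℕ → Exponents n → Exponents n
    swapExp i (k , a) = k , swapVec i a

    -- The factor `+ 1` makes this literally an instance of `pair-map`.
    swapₚ : ℕ → Poly n → Poly n
    swapₚ i = map (λ { (c , m) → + 1 ℤ.* c , swapExp i m })

    pair-swapₚ : ∀ i p φ → ⟨ swapₚ i p ∣ φ ⟩ ≡ ⟨ p ∣ φ ∘ swapExp i ⟩
    pair-swapₚ i p φ = trans (pair-map _ (+ 1) (swapExp i) (λ _ _ → refl) p φ) (ℤ.*-identityˡ _)

    swapExp-∙ : ∀ i m m′ → swapExp i (m ∙ m′) ≡ swapExp i m ∙ swapExp i m′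
    swapExp-∙ i (k , a) (l , b) = cong (k ℕ.+ l ,_) (swapVec-⊕ i a b)

    pair-term : ∀ {c d m m′} → c ≡ d → m ≡ m′ → (c , m) ∷ [] ≋ (d , m′) ∷ []
    pair-term refl refl = ≋-refl

    swapₚ-* : ∀ i p q → swapₚ i (p ⊛ q) ≋ swapₚ i p ⊛ swapₚ i q
    swapₚ-* i p q .at φ = begin
      ⟨ swapₚ i (p ⊛ q) ∣ φ ⟩
        ≡⟨ trans (pair-swapₚ i (p ⊛ q) φ) (pair-⊛ p q _) ⟩
      ⟨ p ∣ (λ m → ⟨ q ∣ (λ m′ → φ (swapExp i (m ∙ m′))) ⟩) ⟩
        ≡⟨ pair-cong p (λ m → trans (pair-cong q (λ m′ → cong φ (swapExp-∙ i m m′))) (sym (pair-swapₚ i q _))) ⟩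
      ⟨ p ∣ (λ m → ⟨ swapₚ i q ∣ (λ m′ → φ (swapExp i m ∙ m′)) ⟩) ⟩
        ≡⟨ sym (trans (pair-⊛ (swapₚ i p) (swapₚ i q) φ) (pair-swapₚ i p _)) ⟩
      ⟨ swapₚ i p ⊛ swapₚ i q ∣ φ ⟩ ∎
      where open ≡-Reasoning

    swapₚ-swapₚ : ∀ i j p φ → ⟨ swapₚ i (swapₚ j p) ∣ φ ⟩ ≡ ⟨ p ∣ φ ∘ swapExp i ∘ swapExp j ⟩
    swapₚ-swapₚ i j p φ = trans (pair-swapₚ i (swapₚ j p) φ) (pair-swapₚ j p _)

    pair-terms : ∀ c (f : ℕ → Exponents n) ts φ → ⟨ map (λ t → c , f t) ts ∣ φ ⟩ ≡ c ℤ.* ⟨ map (λ t → + 1 , f t) ts ∣ φ ⟩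
    pair-terms c f []       φ = sym (ℤ.*-zeroʳ c)
    pair-terms c f (t ∷ ts) φ rewrite pair-terms c f ts φ =
      solve 3 (λ c a s → c :* a :+ c :* s := c :* (con (+ 1) :* a :+ s)) refl c (φ (f t)) _

    pair-ddTerm : ∀ i c m φ → ⟨ ddTerm i (c , m) ∣ φ ⟩ ≡ c ℤ.* ⟨ ddTerm i (+ 1 , m) ∣ φ ⟩
    pair-ddTerm i c (k , a) φ with vget a (suc (i ∸ 1)) ℕ.≤ᵇ vget a (i ∸ 1)
    ... | true  = pair-terms c (λ t → k , vset (vset a (i ∸ 1) (vget a (suc (i ∸ 1)) ℕ.+ t)) (suc (i ∸ 1)) (vget a (i ∸ 1) ∸ 1 ∸ t))
                    (upTo (vget a (i ∸ 1) ∸ vget a (suc (i ∸ 1)))) φ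
    ... | false = begin
      _                       ≡⟨ pair-terms (ℤ.- c) f ts φ ⟩
      ℤ.- c ℤ.* s             ≡⟨ solve 2 (λ c s → (:- c) :* s := c :* ((:- con (+ 1)) :* s)) refl c s ⟩
      c ℤ.* (ℤ.- (+ 1) ℤ.* s) ≡⟨ cong (λ w → c ℤ.* w) (sym (pair-terms (ℤ.- (+ 1)) f ts φ)) ⟩
      _                       ∎
      where
      open ≡-Reasoning
      f : ℕ → Exponents n
      f t = k , vset (vset a (i ∸ 1) (vget a (i ∸ 1) ℕ.+ t)) (suc (i ∸ 1)) (vget a (suc (i ∸ 1)) ∸ 1 ∸ t)
      ts = upTo (vget a (suc (i ∸ 1)) ∸ vget a (i ∸ 1))
      s = ⟨ map (λ t → + 1 , f t) ts ∣ φ ⟩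

    pair-∂ : ∀ i p φ → ⟨ ∂ i p ∣ φ ⟩ ≡ ⟨ p ∣ (λ m → ⟨ ddTerm i (+ 1 , m) ∣ φ ⟩) ⟩
    pair-∂ i = pair-concatMap (ddTerm i) (λ m φ → ⟨ ddTerm i (+ 1 , m) ∣ φ ⟩) (pair-ddTerm i)

    telescope : ∀ c (g : ℕ → Exponents n) φ (H : ℕ → ℤ) l → (∀ t → t < l → φ (g t) ≡ H (suc t) ℤ.- H t) →
                ⟨ map (λ t → c , g t) (upTo l) ∣ φ ⟩ ≡ c ℤ.* (H l ℤ.- H 0)
    telescope c g φ H l e = trans (cong (λ ts → ⟨ ts ∣ φ ⟩) (List.map-upTo (λ t → c , g t) l)) (go g H l e)
      where
      go : ∀ g H l → (∀ t → t < l → φ (g t) ≡ H (suc t) ℤ.- H t) →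
           ⟨ applyUpTo (λ t → c , g t) l ∣ φ ⟩ ≡ c ℤ.* (H l ℤ.- H 0)
      go g H zero    e = solve 2 (λ c h → con (+ 0) := c :* (h :- h)) refl c (H 0)
      go g H (suc l) e rewrite e 0 (s≤s z≤n) | go (g ∘ suc) (H ∘ suc) l (λ t t<l → e (suc t) (s≤s t<l)) =
        solve 4 (λ c h₀ h₁ h → c :* (h₁ :- h₀) :+ c :* (h :- h₁) := c :* (h :- h₀)) refl c (H 0) (H 1) (H (suc l))

    -- In the case u ≥ v, multiplying the t-th term by x_i gives the monomial behind H(t + 1), and
    -- by x_{i+1} the one behind H(t). The sum telescopes to its ends, x^a and s_i x^a; for u < v
    -- the ends change places and the sign of the terms corrects this.
    dd-divides : ∀ i → suc i < n → ∀ (m : Exponents n) (φ : Exponents n → ℤ) →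
      ⟨ ddTerm (suc i) (+ 1 , m) ∣ (λ m′ → φ ((0 , unit n i) ∙ m′) ℤ.- φ ((0 , unit n (suc i)) ∙ m′)) ⟩ ≡ φ m ℤ.- φ (swapExp i m)
    dd-divides i i< (k , a) φ with vget a (suc i) ℕ.≤ᵇ vget a i in eq
    ... | true = begin
      _
        ≡⟨ telescope (+ 1) _ _ H (u ∸ v) step ⟩
      + 1 ℤ.* (H (u ∸ v) ℤ.- H 0)
        ≡⟨ ℤ.*-identityˡ _ ⟩
      H (u ∸ v) ℤ.- H 0
        ≡⟨ cong₂ (λ b c → φ (k , b) ℤ.- φ (k , c))
             (trans (cong₂ (place i a) (ℕ.m+[n∸m]≡n v≤u) (ℕ.m∸[m∸n]≡n v≤u)) (place-self i a))
             (trans (cong (λ s → place i a s u) (ℕ.+-identityʳ v)) (place-swap i a i<)) ⟩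
      φ (k , a) ℤ.- φ (k , swapVec i a) ∎
      where
      open ≡-Reasoning
      u = vget a i
      v = vget a (suc i)
      v≤u : v ≤ u
      v≤u = ℕ.≤ᵇ⇒≤ v u (subst T (sym eq) _)
      H : ℕ → ℤ
      H t = φ (k , place i a (v ℕ.+ t) (u ∸ t))
      step : ∀ t → t < u ∸ v →
        φ (k , unit n i ⊕ place i a (v ℕ.+ t) (u ∸ 1 ∸ t)) ℤ.- φ (k , unit n (suc i) ⊕ place i a (v ℕ.+ t) (u ∸ 1 ∸ t)) ≡ H (suc t) ℤ.- H t
      step t t< = cong₂ (λ b c → φ (k , b) ℤ.- φ (k , c))
        (trans (unit⊕place i a _ _) (cong₂ (place i a) (sym (ℕ.+-suc v t)) (ℕ.∸-+-assoc u 1 t)))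
        -- The equality (u - 1 - t) + 1 = u - t holds for truncated subtraction because t < u - v ≤
        -- u.
        (trans (unit⊕placeʳ i a _ _) (cong (place i a _) (trans (cong suc (ℕ.∸-+-assoc u 1 t)) (sym (ℕ.+-∸-assoc 1 (ℕ.<-≤-trans t< (ℕ.m∸n≤m u v)))))))
    ... | false = begin
      _
        ≡⟨ telescope (ℤ.- (+ 1)) _ _ H (v ∸ u) step ⟩
      ℤ.- (+ 1) ℤ.* (H (v ∸ u) ℤ.- H 0)
        ≡⟨ solve 2 (λ h h₀ → (:- con (+ 1)) :* (h :- h₀) := h₀ :- h) refl (H (v ∸ u)) (H 0) ⟩
      H 0 ℤ.- H (v ∸ u)
        ≡⟨ cong₂ (λ b c → φ (k , b) ℤ.- φ (k , c))
             (trans (cong (λ s → place i a s v) (ℕ.+-identityʳ u)) (place-self i a))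
             (trans (cong₂ (place i a) (ℕ.m+[n∸m]≡n u≤v) (ℕ.m∸[m∸n]≡n u≤v)) (place-swap i a i<)) ⟩
      φ (k , a) ℤ.- φ (k , swapVec i a) ∎
      where
      open ≡-Reasoning
      u = vget a i
      v = vget a (suc i)
      u≤v : u ≤ v
      u≤v = ℕ.≰⇒≥ λ v≤u → subst T eq (ℕ.≤⇒≤ᵇ v≤u)
      H : ℕ → ℤ
      H t = φ (k , place i a (u ℕ.+ t) (v ∸ t))
      step : ∀ t → t < v ∸ u →
        φ (k , unit n i ⊕ place i a (u ℕ.+ t) (v ∸ 1 ∸ t)) ℤ.- φ (k , unit n (suc i) ⊕ place i a (u ℕ.+ t) (v ∸ 1 ∸ t)) ≡ H (suc t) ℤ.- H t
      step t t< = cong₂ (λ b c → φ (k , b) ℤ.- φ (k , c))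
        (trans (unit⊕place i a _ _) (cong₂ (place i a) (sym (ℕ.+-suc u t)) (ℕ.∸-+-assoc v 1 t)))
        (trans (unit⊕placeʳ i a _ _) (cong (place i a _) (trans (cong suc (ℕ.∸-+-assoc v 1 t)) (sym (ℕ.+-∸-assoc 1 (ℕ.<-≤-trans t< (ℕ.m∸n≤m v u)))))))

    pair-difference⊛ : ∀ i j p φ → ⟨ (var i ++ negate (var j)) ⊛ p ∣ φ ⟩ ≡
      ⟨ p ∣ (λ m → φ ((0 , unit n i) ∙ m) ℤ.- φ ((0 , unit n j) ∙ m)) ⟩
    pair-difference⊛ i j p φ = begin
      ⟨ (var i ++ negate (var j)) ⊛ p ∣ φ ⟩
        ≡⟨ pair-⊛ (var i ++ negate (var j)) p φ ⟩
      + 1 ℤ.* a ℤ.+ (ℤ.- (+ 1) ℤ.* (+ 1) ℤ.* b ℤ.+ (+ 0))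
        ≡⟨ solve 2 (λ a b → con (+ 1) :* a :+ ((:- con (+ 1)) :* con (+ 1) :* b :+ con (+ 0)) := a :+ (:- con (+ 1)) :* b) refl a b ⟩
      a ℤ.+ ℤ.- (+ 1) ℤ.* b
        ≡⟨ cong (λ w → a ℤ.+ w) (sym (pair-scale p (ℤ.- (+ 1)) _)) ⟩
      a ℤ.+ ⟨ p ∣ (λ m → ℤ.- (+ 1) ℤ.* φ ((0 , unit n j) ∙ m)) ⟩
        ≡⟨ sym (pair-+ p _ _) ⟩
      ⟨ p ∣ (λ m → φ ((0 , unit n i) ∙ m) ℤ.+ ℤ.- (+ 1) ℤ.* φ ((0 , unit n j) ∙ m)) ⟩
        ≡⟨ pair-cong p (λ m → cong (λ w → φ ((0 , unit n i) ∙ m) ℤ.+ w) (ℤ.-1*i≡-i _)) ⟩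
      ⟨ p ∣ (λ m → φ ((0 , unit n i) ∙ m) ℤ.- φ ((0 , unit n j) ∙ m)) ⟩ ∎
      where
      open ≡-Reasoning
      a = ⟨ p ∣ (λ m → φ ((0 , unit n i) ∙ m)) ⟩
      b = ⟨ p ∣ (λ m → φ ((0 , unit n j) ∙ m)) ⟩

    ∂-divides : ∀ i → suc i < n → ∀ p → (var i ++ negate (var (suc i))) ⊛ ∂ (suc i) p ≋ p ++ negate (swapₚ i p)
    ∂-divides i i< p .at φ = begin
      ⟨ (var i ++ negate (var (suc i))) ⊛ ∂ (suc i) p ∣ φ ⟩
        ≡⟨ trans (pair-difference⊛ i (suc i) (∂ (suc i) p) φ) (pair-∂ (suc i) p _) ⟩
      _ ≡⟨ pair-cong p (λ m → dd-divides i i< m φ) ⟩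
      ⟨ p ∣ (λ m → φ m ℤ.- φ (swapExp i m)) ⟩
        ≡⟨ pair-cong p (λ m → cong (λ w → φ m ℤ.+ w) (sym (ℤ.-1*i≡-i _))) ⟩
      ⟨ p ∣ (λ m → φ m ℤ.+ ℤ.- (+ 1) ℤ.* φ (swapExp i m)) ⟩
        ≡⟨ trans (pair-+ p _ _) (cong (λ w → ⟨ p ∣ φ ⟩ ℤ.+ w) (trans (pair-scale p (ℤ.- (+ 1)) _) (ℤ.-1*i≡-i _))) ⟩
      ⟨ p ∣ φ ⟩ ℤ.- ⟨ p ∣ φ ∘ swapExp i ⟩
        ≡⟨ sym (trans (pair-++ p _ φ) (cong (λ w → ⟨ p ∣ φ ⟩ ℤ.+ w) (trans (pair-negate (swapₚ i p) φ) (cong ℤ.-_ (pair-swapₚ i p φ))))) ⟩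
      ⟨ p ++ negate (swapₚ i p) ∣ φ ⟩ ∎
      where open ≡-Reasoning

    -- Every function ψ on monomials has the form m ↦ φ (x i · m) − φ (x j · m): recurse on the exponent of x i.
    antidifference : ℕ → ℕ → (Exponents n → ℤ) → ℕ → Exponents n → ℤ
    antidifference i j ψ zero    m       = + 0
    antidifference i j ψ (suc t) (k , a) = ψ (k , lowerVec i a) ℤ.+ antidifference i j ψ t (k , unit n j ⊕ lowerVec i a)

    difference-cancel : ∀ i j → i < j → j < n → ∀ p → (var i ++ negate (var j)) ⊛ p ≋ [] → p ≋ []
    difference-cancel i j i<j j< p e .at ψ = begin
      ⟨ p ∣ ψ ⟩                                                     ≡⟨ pair-cong p (λ m → sym (step m)) ⟩
      ⟨ p ∣ (λ m → φ ((0 , unit n i) ∙ m) ℤ.- φ ((0 , unit n j) ∙ m)) ⟩ ≡⟨ sym (pair-difference⊛ i j p φ) ⟩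
      ⟨ (var i ++ negate (var j)) ⊛ p ∣ φ ⟩                         ≡⟨ at e φ ⟩
      + 0                                                           ∎
      where
      open ≡-Reasoning
      φ : Exponents n → ℤ
      φ (k , a) = antidifference i j ψ (vget a i) (k , a)
      step : ∀ m → φ ((0 , unit n i) ∙ m) ℤ.- φ ((0 , unit n j) ∙ m) ≡ ψ m
      -- The exponent of x_i bounds the recursion. For x_i m there is one more step than for m: it
      -- contributes ψ(m) and continues at x_j m, with exactly the bound that φ(x_j m) has.
      step (k , a) rewrite vget-unit⊕ i a (ℕ.<-trans i<j j<) | vget-unit⊕-other i j a (ℕ.>⇒≢ i<j) | lowerVec-unit⊕ i a =
        solve 2 (λ u v → (u :+ v) :- v := u) refl (ψ (k , a)) _

    swapRing : SwapRing n
    swapRing = record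
      { commutativeRing = commutativeRing
      ; constants       = constants
      ; β    = βₚ
      ; x    = var
      ; swap = swapₚ
      ; ∂ᵣ   = λ i → ∂ (suc i)
      ; swap-cong       = λ i {p} {q} e → mk λ φ → trans (pair-swapₚ i p φ) (trans (at e _) (sym (pair-swapₚ i q φ)))
      ; swap-+          = λ i p q → mk λ φ → trans (pair-swapₚ i (p ++ q) φ) (trans (pair-++ p q _)
                            (sym (trans (pair-++ (swapₚ i p) _ φ) (cong₂ ℤ._+_ (pair-swapₚ i p φ) (pair-swapₚ i q φ)))))
      ; swap-*          = swapₚ-*
      ; swap-const      = λ i c → pair-term (ℤ.*-identityˡ c) (cong (0 ,_) (swapVec-replicate n i))
      ; swap-β          = λ i → pair-term refl (cong (1 ,_) (swapVec-replicate n i))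
      ; swap-involutive = λ i p → mk λ φ → trans (swapₚ-swapₚ i i p φ)
                            (pair-cong p (λ { (k , a) → cong (λ v → φ (k , v)) (swapVec-involutive i a) }))
      ; swap-xˡ         = λ i i< → pair-term refl (cong (0 ,_) (swapVec-unit n i i<))
      ; swap-x-other    = λ i j i< p q → pair-term refl (cong (0 ,_) (swapVec-unit-other n i j i< p q))
      ; swap-comm       = λ i j i<j j< p → mk λ φ → trans (swapₚ-swapₚ i j p φ) (trans
                            (pair-cong p (λ { (k , a) → cong (λ v → φ (k , v)) (swapVec-comm i j i<j a) })) (sym (swapₚ-swapₚ j i p φ)))
      ; swap-braid      = λ i i< p → mk λ φ → trans (pair-swapₚ i (swapₚ (suc i) (swapₚ i p)) φ) (trans (swapₚ-swapₚ (suc i) i p _) (trans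
                            (pair-cong p (λ { (k , a) → cong (λ v → φ (k , v)) (swapVec-braid i i< a) }))
                            (sym (trans (pair-swapₚ (suc i) (swapₚ i (swapₚ (suc i) p)) φ) (swapₚ-swapₚ i (suc i) p _)))))
      ; ∂ᵣ-divides      = ∂-divides
      ; x-x-cancel      = difference-cancel
      }

-- Row-by-row enumeration of efficient patterns

module Enumeration where
  open ≡
  open import Data.Nat.Base using (_+_)
  open Cell using () renaming (val to value)

  -- The flag top marks row 0, below which a triangle with equal entries always has both edges (condition (4)).
  bottom : Bool → Cell → Cell → Cell
  bottom top c d =
    if value c ≡ᵇ value d then cell (value c) true (top ∨ (Cell.eR c ∧ Cell.eL d)) true
                          else cell (value c) true true false

  -- Here b and h are the top-left and top-right values. Above b a left edge is impossible, and a
  -- circled cell has its right edge exactly at the value h, by conditions (2) and (6).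
  levels : Cell → ℕ → ℕ → ℕ → List Cell
  levels e b h zero    = e ∷ []
  levels e b h (suc g) =
    cell (suc (b + g)) false false false ∷ cell (suc (b + g)) true false (suc (b + g) ≡ᵇ h) ∷ levels e b h g

  options : Bool → Cell → Cell → List Cell
  options top c d = levels (bottom top c d) (value c) (value d) (value d ∸ value c)

  nextRows : Bool → List Cell → List (List Cell)
  nextRows top []          = [] ∷ []
  nextRows top (c ∷ [])    = [] ∷ []
  nextRows top (c ∷ d ∷ r) = cartesianProductWith _∷_ (options top c d) (nextRows top (d ∷ r))

  -- The number counts the rows still to be written, r included; at 0 only the empty pattern is
  -- left, whatever r is.
  completions : ℕ → Bool → List Cell → List Pattern
  completions zero    top r = [] ∷ []
  completions (suc k) top r = concatMap (λ r′ → map (r ∷_) (completions k false r′)) (nextRows top r)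

  -- The local content of the conditions on a triangle. For `flat`, efficiency gives the right edge,
  -- (2) the circle, and (4) or (3) the left edge; `low` is (5), with no right edge by (2);
  -- `uncircled` has no edges by (2); `circled` combines (2) and (6).
  data CellStep (top : Bool) (c d : Cell) : Cell → Set where
    flat : value c ≡ value d → CellStep top c d (cell (value c) true (top ∨ (Cell.eR c ∧ Cell.eL d)) true)
    low  : value c < value d → CellStep top c d (cell (value c) true true false)
    uncircled : ∀ {v} → value c < v → v ≤ value d → CellStep top c d (cell v false false false)
    circled : ∀ {v} → value c < v → v ≤ value d → CellStep top c d (cell v true false (v ≡ᵇ value d))

  data RowStep (top : Bool) : List Cell → List Cell → Set where
    []  : RowStep top [] []
    [-] : ∀ {c} → RowStep top (c ∷ []) []
    _∷_ : ∀ {c d r e r′} → CellStep top c d e → RowStep top (d ∷ r) r′ → RowStep top (c ∷ d ∷ r) (e ∷ r′)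

  data Completion : ℕ → Bool → List Cell → Pattern → Set where
    []  : ∀ {top r} → Completion 0 top r []
    _∷_ : ∀ {k top r r′ P} → RowStep top r r′ → Completion k false r′ P → Completion (suc k) top r (r ∷ P)

  bottom-step : ∀ top c d → value c ≤ value d → CellStep top c d (bottom top c d)
  bottom-step top c d c≤d with value c ≡ᵇ value d in eq
  ... | true  = flat (ℕ.≡ᵇ⇒≡ _ _ (subst T (sym eq) _))
  ... | false = low (ℕ.≤∧≢⇒< c≤d λ c≡d → subst T eq (ℕ.≡⇒≡ᵇ _ _ c≡d))

  levels-step : ∀ top c d g e → value c + g ≤ value d → CellStep top c d e → ∀ {e′} →
                e′ ∈ levels e (value c) (value d) g → CellStep top c d e′
  levels-step top c d zero    e g≤ s (here refl)         = s
  levels-step top c d (suc g) e g≤ s (here refl)         = uncircled (s≤s (ℕ.m≤m+n _ g)) (subst (_≤ value d) (ℕ.+-suc _ g) g≤)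
  levels-step top c d (suc g) e g≤ s (there (here refl)) = circled (s≤s (ℕ.m≤m+n _ g)) (subst (_≤ value d) (ℕ.+-suc _ g) g≤)
  levels-step top c d (suc g) e g≤ s (there (there i))   =
    levels-step top c d g e (ℕ.≤-trans (ℕ.+-monoʳ-≤ (value c) (ℕ.n≤1+n g)) g≤) s i

  options-step : ∀ top c d → value c ≤ value d → ∀ {e} → e ∈ options top c d → CellStep top c d e
  options-step top c d c≤d = levels-step top c d _ _ (ℕ.≤-reflexive (ℕ.m+[n∸m]≡n c≤d)) (bottom-step top c d c≤d)

  levels-bottom : ∀ e b h g → e ∈ levels e b h g
  levels-bottom e b h zero    = here refl
  levels-bottom e b h (suc g) = there (there (levels-bottom e b h g))

  levels-uncircled : ∀ e b h g v → b < v → v ≤ b + g → cell v false false false ∈ levels e b h g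
  levels-uncircled e b h zero    v b<v v≤ = ⊥-elim (ℕ.<⇒≱ b<v (subst (v ≤_) (ℕ.+-identityʳ b) v≤))
  levels-uncircled e b h (suc g) v b<v v≤ with ℕ.m≤n⇒m<n∨m≡n (subst (v ≤_) (ℕ.+-suc b g) v≤)
  ... | inj₁ (s≤s v≤′) = there (there (levels-uncircled e b h g v b<v v≤′))
  ... | inj₂ refl      = here refl

  levels-circled : ∀ e b h g v → b < v → v ≤ b + g → cell v true false (v ≡ᵇ h) ∈ levels e b h g
  levels-circled e b h zero    v b<v v≤ = ⊥-elim (ℕ.<⇒≱ b<v (subst (v ≤_) (ℕ.+-identityʳ b) v≤))
  levels-circled e b h (suc g) v b<v v≤ with ℕ.m≤n⇒m<n∨m≡n (subst (v ≤_) (ℕ.+-suc b g) v≤)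
  ... | inj₁ (s≤s v≤′) = there (there (levels-circled e b h g v b<v v≤′))
  ... | inj₂ refl      = there (here refl)

  step-bounds : ∀ {top c d e} → CellStep top c d e → value c ≤ value e × value e ≤ value d
  step-bounds (flat c≡d)     = ℕ.≤-refl , ℕ.≤-reflexive c≡d
  step-bounds (low c<d)      = ℕ.≤-refl , ℕ.<⇒≤ c<d
  step-bounds (uncircled c<v v≤d) = ℕ.<⇒≤ c<v , v≤d
  step-bounds (circled c<v v≤d) = ℕ.<⇒≤ c<v , v≤d

  bottom-flat : ∀ top c d → value c ≡ value d → bottom top c d ≡ cell (value c) true (top ∨ (Cell.eR c ∧ Cell.eL d)) true
  bottom-flat top c d c≡d with value c ≡ᵇ value d in eq
  ... | true  = refl
  ... | false = ⊥-elim (subst T eq (ℕ.≡⇒≡ᵇ _ _ c≡d))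

  bottom-low : ∀ top c d → value c < value d → bottom top c d ≡ cell (value c) true true false
  bottom-low top c d c<d with value c ≡ᵇ value d in eq
  ... | true  = ⊥-elim (ℕ.<⇒≢ c<d (ℕ.≡ᵇ⇒≡ _ _ (subst T (sym eq) _)))
  ... | false = refl

  step-options : ∀ {top c d e} → CellStep top c d e → e ∈ options top c d
  step-options {top} {c} {d} (flat c≡d) =
    subst (_∈ options top c d) (bottom-flat top c d c≡d) (levels-bottom _ (value c) (value d) (value d ∸ value c))
  step-options {top} {c} {d} (low c<d) =
    subst (_∈ options top c d) (bottom-low top c d c<d) (levels-bottom _ (value c) (value d) (value d ∸ value c))
  step-options (uncircled c<v v≤d) =
    levels-uncircled _ _ _ _ _ c<v (ℕ.≤-trans v≤d (ℕ.≤-reflexive (sym (ℕ.m+[n∸m]≡n (ℕ.≤-trans (ℕ.<⇒≤ c<v) v≤d)))))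
  step-options (circled c<v v≤d) =
    levels-circled _ _ _ _ _ c<v (ℕ.≤-trans v≤d (ℕ.≤-reflexive (sym (ℕ.m+[n∸m]≡n (ℕ.≤-trans (ℕ.<⇒≤ c<v) v≤d)))))

  values : List Cell → List ℕ
  values = map value

  ∈-nextRows⁻ : ∀ top r → Linked _≤_ (values r) → ∀ {r′} → r′ ∈ nextRows top r → RowStep top r r′
  ∈-nextRows⁻ top []          l         (here refl) = []
  ∈-nextRows⁻ top (c ∷ [])    l         (here refl) = [-]
  ∈-nextRows⁻ top (c ∷ d ∷ r) (c≤d ∷ l) i
    with _ , _ , e∈ , r∈ , refl ← ∈-cartesianProductWith⁻ _∷_ (options top c d) (nextRows top (d ∷ r)) i =
    options-step top c d c≤d e∈ ∷ ∈-nextRows⁻ top (d ∷ r) l r∈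

  ∈-nextRows⁺ : ∀ {top r r′} → RowStep top r r′ → r′ ∈ nextRows top r
  ∈-nextRows⁺ []       = here refl
  ∈-nextRows⁺ [-]      = here refl
  ∈-nextRows⁺ (s ∷ ss) = ∈-cartesianProductWith⁺ _∷_ (step-options s) (∈-nextRows⁺ ss)

  RowStep-Linked : ∀ {top r r′} → RowStep top r r′ → Linked _≤_ (values r′)
  RowStep-Linked []            = []
  RowStep-Linked [-]           = []
  RowStep-Linked (s ∷ [-])     = [-]
  RowStep-Linked (s ∷ t ∷ ss)  = ℕ.≤-trans (proj₂ (step-bounds s)) (proj₁ (step-bounds t)) ∷ RowStep-Linked (t ∷ ss)

  ∈-completions⁻ : ∀ k top r → Linked _≤_ (values r) → ∀ {P} → P ∈ completions k top r → Completion k top r P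
  ∈-completions⁻ zero    top r l (here refl) = []
  ∈-completions⁻ (suc k) top r l i
    with r′ , r′∈ , i′ ← find (∈-concatMap⁻ _ {xs = nextRows top r} i)
    with P , P∈ , refl ← ∈-map⁻ (r ∷_) i′ =
    let s = ∈-nextRows⁻ top r l r′∈ in s ∷ ∈-completions⁻ k false r′ (RowStep-Linked s) P∈

  ∈-completions⁺ : ∀ {k top r P} → Completion k top r P → P ∈ completions k top r
  ∈-completions⁺ []      = here refl
  ∈-completions⁺ (s ∷ t) = ∈-concatMap⁺ _ (lose (∈-nextRows⁺ s) (∈-map⁺ _ (∈-completions⁺ t)))

  Unique-concatMap : ∀ {A B : Set} (f : A → List B) (as : List A) → Unique as → (∀ {a} → a ∈ as → Unique (f a)) →
    (∀ {a a′ b} → a ∈ as → a′ ∈ as → b ∈ f a → b ∈ f a′ → a ≡ a′) → Unique (concatMap f as)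
  Unique-concatMap f []       u        uf sep = []
  Unique-concatMap f (a ∷ as) (a∉ ∷ u) uf sep =
    Unique.++⁺ (uf (here refl)) (Unique-concatMap f as u (uf ∘ there) (λ i j → sep (there i) (there j))) disjoint
    where
    disjoint : ∀ {b} → b ∈ f a × b ∈ concatMap f as → _
    disjoint (b∈ , b∈′) with a′ , a′∈ , b∈f ← find (∈-concatMap⁻ f {xs = as} b∈′) =
      All.lookup a∉ a′∈ (sep (here refl) (there a′∈) b∈ b∈f)

  levels-value : ∀ e b h g → value e ≤ b → All (λ e′ → value e′ ≤ b + g) (levels e b h g)
  levels-value e b h zero    e≤ = ℕ.≤-trans e≤ (ℕ.m≤m+n b 0) ∷ []
  levels-value e b h (suc g) e≤ = top≤ ∷ top≤ ∷ All.map (λ p → ℕ.≤-trans p (ℕ.+-monoʳ-≤ b (ℕ.n≤1+n g))) (levels-value e b h g e≤)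
    where top≤ = ℕ.≤-reflexive (sym (ℕ.+-suc b g))

  levels-unique : ∀ e b h g → value e ≤ b → Unique (levels e b h g)
  levels-unique e b h zero    e≤ = [] ∷ []
  levels-unique e b h (suc g) e≤ = 
    ((λ ()) ∷ All.map (λ { p refl → ℕ.n≮n _ p }) lower) ∷ All.map (λ { p refl → ℕ.n≮n _ p }) lower ∷ levels-unique e b h g e≤
    where lower = levels-value e b h g e≤

  bottom-value : ∀ top c d → value (bottom top c d) ≡ value c
  bottom-value top c d with value c ≡ᵇ value d
  ... | true  = refl
  ... | false = refl

  nextRows-unique : ∀ top r → Unique (nextRows top r)
  nextRows-unique top []          = [] ∷ []
  nextRows-unique top (c ∷ [])    = [] ∷ []
  nextRows-unique top (c ∷ d ∷ r) = Unique.cartesianProductWith⁺ _∷_ List.∷-injective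
    (levels-unique _ (value c) (value d) (value d ∸ value c) (ℕ.≤-reflexive (bottom-value top c d))) (nextRows-unique top (d ∷ r))

  RowStep-length : ∀ {top r r′} → RowStep top r r′ → length r′ ≡ ℕ.pred (length r)
  RowStep-length []            = refl
  RowStep-length [-]           = refl
  RowStep-length (s ∷ [-])     = refl
  RowStep-length (s ∷ t ∷ ss)  = cong suc (RowStep-length (t ∷ ss))

  -- For k > 0 the row can be read off the pattern; for k = 0 the length hypothesis makes both rows
  -- empty.
  ∈-completions-head : ∀ k {top r r′ P} → length r ≡ k → length r′ ≡ k → P ∈ completions k top r → P ∈ completions k top r′ → r ≡ r′
  ∈-completions-head zero    {r = []} {[]} _ _ _ _ = refl
  ∈-completions-head (suc k) {top} {r} {r′} _ _ i i′
    with s , _ , j ← find (∈-concatMap⁻ _ {xs = nextRows top r} i)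
    with _ , _ , refl ← ∈-map⁻ (r ∷_) j
    with s′ , _ , j′ ← find (∈-concatMap⁻ _ {xs = nextRows top r′} i′)
    with _ , _ , refl ← ∈-map⁻ (r′ ∷_) j′ = refl

  completions-unique : ∀ k top r → Linked _≤_ (values r) → length r ≡ k → Unique (completions k top r)
  completions-unique zero    top r l e = [] ∷ []
  completions-unique (suc k) top r l e = Unique-concatMap _ (nextRows top r) (nextRows-unique top r)
    (λ {r′} i → Unique.map⁺ List.∷-injectiveʳ (completions-unique k false r′ (RowStep-Linked (step i)) (len i)))
    separate
    where
    step : ∀ {r′} → r′ ∈ nextRows top r → RowStep top r r′
    step = ∈-nextRows⁻ top r l
    len : ∀ {r′} → r′ ∈ nextRows top r → length r′ ≡ k
    len i = trans (RowStep-length (step i)) (cong ℕ.pred e)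
    separate : ∀ {r′ r″ P} → r′ ∈ nextRows top r → r″ ∈ nextRows top r →
      P ∈ map (r ∷_) (completions k false r′) → P ∈ map (r ∷_) (completions k false r″) → r′ ≡ r″
    separate i i′ j j′
      with _ , p , refl ← ∈-map⁻ (r ∷_) j
      with _ , p′ , refl ← ∈-map⁻ (r ∷_) j′ = ∈-completions-head k (len i) (len i′) p p′

open Enumeration
open Cell using () renaming (val to value)

-- Weights of entries, rows and patterns

module Sums {N : ℕ} (R : SwapRing N) where
  open SwapRing R
  open Operators R

  sumOver : ∀ {A : Set} → (A → Carrier) → List A → Carrier
  sumOver f []       = 0#
  sumOver f (a ∷ as) = f a + sumOver f as

  sumOver-cong : ∀ {A : Set} {f g : A → Carrier} as → (∀ {a} → a ∈ as → f a ≈ g a) → sumOver f as ≈ sumOver g as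
  sumOver-cong []       e = refl
  sumOver-cong (a ∷ as) e = +-cong (e (here ≡.refl)) (sumOver-cong as (e ∘ there))

  sumOver-++ : ∀ {A : Set} (f : A → Carrier) as bs → sumOver f (as ++ bs) ≈ sumOver f as + sumOver f bs
  sumOver-++ f []       bs = sym (+-identityˡ _)
  sumOver-++ f (a ∷ as) bs = trans (+-congˡ (sumOver-++ f as bs)) (sym (+-assoc _ _ _))

  sumOver-map : ∀ {A B : Set} (f : B → Carrier) (h : A → B) as → sumOver f (map h as) ≈ sumOver (f ∘ h) as
  sumOver-map f h []       = refl
  sumOver-map f h (a ∷ as) = +-congˡ (sumOver-map f h as)

  sumOver-concatMap : ∀ {A B : Set} (f : B → Carrier) (h : A → List B) as →
    sumOver f (concatMap h as) ≈ sumOver (λ a → sumOver f (h a)) as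
  sumOver-concatMap f h []       = refl
  sumOver-concatMap f h (a ∷ as) = trans (sumOver-++ f (h a) _) (+-congˡ (sumOver-concatMap f h as))

  sumOver-*ˡ : ∀ {A : Set} c (f : A → Carrier) as → c * sumOver f as ≈ sumOver (λ a → c * f a) as
  sumOver-*ˡ c f []       = zeroʳ c
  sumOver-*ˡ c f (a ∷ as) = trans (distribˡ c _ _) (+-congˡ (sumOver-*ˡ c f as))

  sumOver-cartesianProductWith : ∀ {A B C : Set} (h : A → B → C) (f : C → Carrier) (g₁ : A → Carrier) (g₂ : B → Carrier) →
    (∀ a b → f (h a b) ≈ g₁ a * g₂ b) → ∀ as bs → sumOver f (cartesianProductWith h as bs) ≈ sumOver g₁ as * sumOver g₂ bs
  sumOver-cartesianProductWith h f g₁ g₂ e []       bs = sym (zeroˡ _)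
  sumOver-cartesianProductWith h f g₁ g₂ e (a ∷ as) bs = begin
    sumOver f (map (h a) bs ++ cartesianProductWith h as bs)
      ≈⟨ sumOver-++ f (map (h a) bs) _ ⟩
    sumOver f (map (h a) bs) + sumOver f (cartesianProductWith h as bs)
      ≈⟨ +-cong (trans (sumOver-map f (h a) bs) (trans (sumOver-cong bs (λ {b} _ → e a b)) (sym (sumOver-*ˡ (g₁ a) g₂ bs))))
                (sumOver-cartesianProductWith h f g₁ g₂ e as bs) ⟩
    g₁ a * sumOver g₂ bs + sumOver g₁ as * sumOver g₂ bs
      ≈⟨ sym (distribʳ _ _ _) ⟩
    sumOver g₁ (a ∷ as) * sumOver g₂ bs ∎
    where open ≈R

  W-sumOver : ∀ k → k ≤ N → ∀ {A : Set} (f : A → Carrier) as → W k (sumOver f as) ≈ sumOver (λ a → W k (f a)) as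
  W-sumOver k k≤ f []       = W-0 k k≤
  W-sumOver k k≤ f (a ∷ as) = trans (W-+ k k≤ _ _) (+-congˡ (W-sumOver k k≤ f as))

  nonCirc : Cell → ℕ
  nonCirc e = if Cell.circ e then 0 else 1

  -- The share of one entry: y carries the drop from the top-right value h, plus one if the entry is
  -- uncircled, and u carries the entry into the monomial of the new row.
  levelWeight : Carrier → Carrier → ℕ → Cell → Carrier
  levelWeight u y h e = (y ^ (h ∸ value e ℕ.+ nonCirc e) * β ^ nonCirc e) * u ^ value e

  -- Both cells of a value v > b together contribute 1 + βy times u^v, which is the recursion of
  -- `ladder`. The prefactor is the drop from h that a partial ladder ending at b + g still has to
  -- carry.
  levels-sum : ∀ u y h e b t g → value e ≡ b → Cell.circ e ≡ true → b ℕ.+ g ≤ h →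
    sumOver (levelWeight u y h) (levels e b t g) ≈ y ^ (h ∸ (b ℕ.+ g)) * ladder b g u y
  levels-sum u y h (cell b true l r) .b t zero ≡.refl ≡.refl le = begin
    (y ^ (h ∸ b ℕ.+ 0) * 1#) * u ^ b + 0#   ≈⟨ +-identityʳ _ ⟩
    (y ^ (h ∸ b ℕ.+ 0) * 1#) * u ^ b        ≈⟨ *-congʳ (*-identityʳ _) ⟩
    y ^ (h ∸ b ℕ.+ 0) * u ^ b               ≈⟨ *-congʳ (reflexive (≡.cong (y ^_) (≡.trans (ℕ.+-identityʳ (h ∸ b)) (≡.cong (h ∸_) (≡.sym (ℕ.+-identityʳ b)))))) ⟩
    y ^ (h ∸ (b ℕ.+ 0)) * u ^ b             ∎
    where open ≈R
  levels-sum u y h e b t (suc g) p q le = begin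
    (y ^ (h ∸ v ℕ.+ 1) * β ^ 1) * u ^ v + ((y ^ (h ∸ v ℕ.+ 0) * β ^ 0) * u ^ v + sumOver (levelWeight u y h) (levels e b t g))
      ≈⟨ +-cong (*-congʳ (*-congʳ (reflexive (≡.cong (y ^_) (ℕ.+-comm (h ∸ v) 1)))))
                (+-cong (*-congʳ (*-cong (reflexive (≡.cong (y ^_) (ℕ.+-identityʳ (h ∸ v)))) refl)) (levels-sum u y h e b t g p q (ℕ.<⇒≤ le′))) ⟩
    ((y * z) * (β * 1#)) * u ^ v + ((z * 1#) * u ^ v + y ^ (h ∸ (b ℕ.+ g)) * l)
      ≈⟨ +-cong (*-congʳ (*-congˡ (*-congˡ (sym 1-h)))) (+-cong (*-congʳ (*-congˡ (sym 1-h))) (*-congʳ (reflexive (≡.cong (y ^_) exp-eq)))) ⟩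
    ((y * z) * (β * 𝟙)) * u ^ v + ((z * 𝟙) * u ^ v + (y * z) * l)
      ≈⟨ solve 5 (λ β y z w l → ((y :* z) :* (β :* con (+ 1))) :* w :+ ((z :* con (+ 1)) :* w :+ (y :* z) :* l)
           := z :* (y :* l :+ (con (+ 1) :+ β :* y) :* w)) refl β y z _ _ ⟩
    z * (y * l + o y * u ^ v)
      ≈⟨ *-congʳ (reflexive (≡.cong (λ w → y ^ (h ∸ w)) (≡.sym (ℕ.+-suc b g)))) ⟩
    y ^ (h ∸ (b ℕ.+ suc g)) * ladder b (suc g) u y ∎
    where
    open ≈R
    v = suc (b ℕ.+ g)
    z = y ^ (h ∸ v)
    l = ladder b g u y
    1-h = 1-homo constants
    le′ : b ℕ.+ g < h
    le′ = ℕ.≤-trans (ℕ.≤-reflexive (≡.sym (ℕ.+-suc b g))) le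
    exp-eq : h ∸ (b ℕ.+ g) ≡ suc (h ∸ v)
    exp-eq = ℕ.+-∸-assoc 1 le′

  options-sum : ∀ top u y c d → value c ≤ value d →
    sumOver (levelWeight u y (value d)) (options top c d) ≈ ladder (value c) (value d ∸ value c) u y
  options-sum top u y c d c≤d = begin
    sumOver (levelWeight u y h) (options top c d)  ≈⟨ levels-sum u y h _ b h (h ∸ b) (bottom-value top c d) circ-bottom (ℕ.≤-reflexive b+) ⟩
    y ^ (h ∸ (b ℕ.+ (h ∸ b))) * l                  ≈⟨ *-congʳ (reflexive (≡.cong (y ^_) (≡.trans (≡.cong (h ∸_) b+) (ℕ.n∸n≡0 h)))) ⟩
    1# * l                                         ≈⟨ *-identityˡ l ⟩
    l                                              ∎
    where
    open ≈R
    b = value c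
    h = value d
    l = ladder b (h ∸ b) u y
    b+ = ℕ.m+[n∸m]≡n c≤d
    circ-bottom : Cell.circ (bottom top c d) ≡ true
    circ-bottom with value c ≡ᵇ value d
    ... | true  = ≡.refl
    ... | false = ≡.refl

  rowWeight : List Cell → List Cell → Carrier → Carrier
  rowWeight (c ∷ d ∷ r) (e ∷ r′) y = levelWeight (x (length (values r))) y (value d) e * rowWeight (d ∷ r) r′ y
  rowWeight _           _        y = 𝟙

  nextRows-sum : ∀ top r y → Linked _≤_ (values r) → sumOver (λ r′ → rowWeight r r′ y) (nextRows top r) ≈ Q (values r) y
  nextRows-sum top []          y l         = +-identityʳ _
  nextRows-sum top (c ∷ [])    y l         = +-identityʳ _
  nextRows-sum top (c ∷ d ∷ r) y (c≤d ∷ l) = trans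
    (sumOver-cartesianProductWith _∷_ _ (levelWeight (x (length (values r))) y (value d)) (λ r′ → rowWeight (d ∷ r) r′ y)
      (λ e r′ → refl) (options top c d) (nextRows top (d ∷ r)))
    (*-cong (options-sum top _ y c d c≤d) (nextRows-sum top (d ∷ r) y l))

  gap : List Cell → List Cell → ℕ
  gap (c ∷ d ∷ r) (e ∷ r′) = (value d ∸ value e ℕ.+ nonCirc e) ℕ.+ gap (d ∷ r) r′
  gap _           _        = 0

  rowNonCirc-∷ : ∀ e r → rowNonCirc (e ∷ r) ≡ nonCirc e ℕ.+ rowNonCirc r
  rowNonCirc-∷ (cell _ true  _ _) r = ≡.refl
  rowNonCirc-∷ (cell _ false _ _) r = ≡.refl

  -- In S_{i-1} - S_i + D_i each new entry is paired with its top-right neighbour. The first entry c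
  -- of the upper row remains unpaired and accounts for the prefactor x_k^c of the branching rule.
  gap-eq : ∀ {top c r r′} → RowStep top (c ∷ r) r′ → rowSum (c ∷ r) ℕ.+ rowNonCirc r′ ≡ (value c ℕ.+ gap (c ∷ r) r′) ℕ.+ rowSum r′
  gap-eq {c = c} [-] = ≡.refl
  gap-eq {c = c} (_∷_ {d = d} {r} {e} {r′} s ss) = begin
    (value c ℕ.+ rowSum (d ∷ r)) ℕ.+ rowNonCirc (e ∷ r′)
      ≡⟨ ≡.cong (λ n → (value c ℕ.+ rowSum (d ∷ r)) ℕ.+ n) (rowNonCirc-∷ e r′) ⟩
    (value c ℕ.+ rowSum (d ∷ r)) ℕ.+ (nonCirc e ℕ.+ rowNonCirc r′)
      ≡⟨ solveℕ 4 (λ c s n m → (c ⊞ s) ⊞ (n ⊞ m) ⊜ (c ⊞ n) ⊞ (s ⊞ m)) ≡.refl (value c) _ (nonCirc e) _ ⟩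
    (value c ℕ.+ nonCirc e) ℕ.+ (rowSum (d ∷ r) ℕ.+ rowNonCirc r′)
      ≡⟨ ≡.cong (λ n → (value c ℕ.+ nonCirc e) ℕ.+ n) (gap-eq ss) ⟩
    (value c ℕ.+ nonCirc e) ℕ.+ ((value d ℕ.+ gap (d ∷ r) r′) ℕ.+ rowSum r′)
      ≡⟨ ≡.cong (λ n → (value c ℕ.+ nonCirc e) ℕ.+ ((n ℕ.+ gap (d ∷ r) r′) ℕ.+ rowSum r′)) (≡.sym (ℕ.m∸n+n≡m (proj₂ (step-bounds s)))) ⟩
    (value c ℕ.+ nonCirc e) ℕ.+ (((value d ∸ value e) ℕ.+ value e ℕ.+ gap (d ∷ r) r′) ℕ.+ rowSum r′)
      ≡⟨ solveℕ 6 (λ c n m e g s → (c ⊞ n) ⊞ ((m ⊞ e ⊞ g) ⊞ s) ⊜ (c ⊞ ((m ⊞ n) ⊞ g)) ⊞ (e ⊞ s)) ≡.refl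
           (value c) (nonCirc e) (value d ∸ value e) (value e) (gap (d ∷ r) r′) (rowSum r′) ⟩
    (value c ℕ.+ ((value d ∸ value e ℕ.+ nonCirc e) ℕ.+ gap (d ∷ r) r′)) ℕ.+ (value e ℕ.+ rowSum r′) ∎
    where
    open ≡.≡-Reasoning
    open Data.Nat.Solver.+-*-Solver using () renaming (solve to solveℕ; _:+_ to _⊞_; _:=_ to _⊜_)

  rowWeight-eq : ∀ {top r r′} y → RowStep top r r′ →
    rowWeight r r′ y ≈ y ^ gap r r′ * (β ^ rowNonCirc r′ * mono (values r′))
  rowWeight-eq y []  = trans (sym (𝟙*_ _)) (trans (sym (*-identityˡ _)) (*-congˡ (*-congʳ (1-homo constants))))
  rowWeight-eq y [-] = trans (sym (𝟙*_ _)) (trans (sym (*-identityˡ _)) (*-congˡ (*-congʳ (1-homo constants))))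
  rowWeight-eq y (_∷_ {c} {d} {r} {e} {r′} s ss) = begin
    ((y ^ m * β ^ n) * u ^ value e) * rowWeight (d ∷ r) r′ y
      ≈⟨ *-cong (*-congˡ (reflexive (≡.cong (λ l → x l ^ value e) len))) (rowWeight-eq y ss) ⟩
    ((y ^ m * β ^ n) * u′ ^ value e) * (y ^ g * (β ^ rowNonCirc r′ * M))
      ≈⟨ solve 6 (λ a b c d e f → ((a :* b) :* c) :* (d :* (e :* f)) := (a :* d) :* ((b :* e) :* (c :* f))) refl _ _ _ _ _ _ ⟩
    (y ^ m * y ^ g) * ((β ^ n * β ^ rowNonCirc r′) * (u′ ^ value e * M))
      ≈⟨ sym (*-cong (^-homo-* y m g) (*-congʳ (trans (reflexive (≡.cong (β ^_) (rowNonCirc-∷ e r′))) (^-homo-* β n _)))) ⟩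
    y ^ (m ℕ.+ g) * (β ^ rowNonCirc (e ∷ r′) * mono (values (e ∷ r′))) ∎
    where
    open ≈R
    m = value d ∸ value e ℕ.+ nonCirc e
    n = nonCirc e
    u = x (length (values r))
    u′ = x (length (values r′))
    g = gap (d ∷ r) r′
    M = mono (values r′)
    len : length (values r) ≡ length (values r′)
    len = ≡.trans (List.length-map value r) (≡.trans (≡.sym (RowStep-length ss)) (≡.sym (List.length-map value r′)))

  dropExponent : List Cell → List Cell → ℕ
  dropExponent r r′ = (rowSum r ℕ.+ rowNonCirc r′) ∸ rowSum r′

  -- A row's variable is numbered by the rows beneath it. Below the last row `row [] 0` is empty, in
  -- accordance with S_n = D_n = 0.
  weight : Pattern → Carrier
  weight []      = 𝟙
  weight (r ∷ P) = (x (length P) ^ dropExponent r (row P 0) * β ^ rowNonCirc (row P 0)) * weight P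

  Completion-length : ∀ {k top r P} → Completion k top r P → length P ≡ k
  Completion-length []      = ≡.refl
  Completion-length (s ∷ t) = ≡.cong suc (Completion-length t)

  Completion-head : ∀ {k top r P} → length r ≡ k → Completion k top r P → row P 0 ≡ r
  Completion-head {r = []} e []      = ≡.refl
  Completion-head          e (s ∷ t) = ≡.refl

  -- The branching rule removes one row, and `nextRows-sum` expands its product of ladders over the
  -- candidates r′. For each r′ the factor F involves only x_k and β, hence leaves W_k, and what
  -- remains is the monomial of r′.
  W-completions : ∀ k top r → k ≤ N → length r ≡ k → Linked _≤_ (values r) →
    W k (mono (values r)) ≈ sumOver weight (completions k top r)
  W-completions zero    top []      k≤ e l = sym (+-identityʳ _)
  W-completions (suc k) top (c ∷ r) k≤ e l = begin
    W (suc k) (mono (values (c ∷ r)))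
      ≈⟨ ≡.subst (λ k → W (suc k) (mono (values (c ∷ r))) ≈ W k (x k ^ value c * Q (values (c ∷ r)) (x k))) len
           (W-branch (value c) (values r) l (≡.subst (_< N) (≡.sym len) k≤)) ⟩
    W k (y ^ value c * Q (values (c ∷ r)) y)
      ≈⟨ W-cong k k≤′ (trans (*-congˡ (sym (nextRows-sum top (c ∷ r) y l))) (sumOver-*ˡ _ _ (nextRows top (c ∷ r)))) ⟩
    W k (sumOver (λ r′ → y ^ value c * rowWeight (c ∷ r) r′ y) (nextRows top (c ∷ r)))
      ≈⟨ W-sumOver k k≤′ _ (nextRows top (c ∷ r)) ⟩
    sumOver (λ r′ → W k (y ^ value c * rowWeight (c ∷ r) r′ y)) (nextRows top (c ∷ r))
      ≈⟨ sumOver-cong (nextRows top (c ∷ r)) (λ r∈ → each (∈-nextRows⁻ top (c ∷ r) l r∈)) ⟩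
    sumOver (λ r′ → sumOver weight (map ((c ∷ r) ∷_) (completions k false r′))) (nextRows top (c ∷ r))
      ≈⟨ sym (sumOver-concatMap weight _ (nextRows top (c ∷ r))) ⟩
    sumOver weight (completions (suc k) top (c ∷ r)) ∎
    where
    open ≈R
    y = x k
    k≤′ : k ≤ N
    k≤′ = ℕ.<⇒≤ k≤
    len : length (values r) ≡ k
    len = ≡.trans (List.length-map value r) (≡.cong ℕ.pred e)
    each : ∀ {r′} → RowStep top (c ∷ r) r′ →
      W k (y ^ value c * rowWeight (c ∷ r) r′ y) ≈ sumOver weight (map ((c ∷ r) ∷_) (completions k false r′))
    each {r′} s = begin
      W k (y ^ value c * rowWeight (c ∷ r) r′ y)
        ≈⟨ W-cong k k≤′ (*-congˡ (rowWeight-eq y s)) ⟩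
      W k (y ^ value c * (y ^ g * (β ^ D′ * mono (values r′))))
        ≈⟨ W-cong k k≤′ (solve 4 (λ a b c d → a :* (b :* (c :* d)) := ((a :* b) :* c) :* d) refl _ _ _ _) ⟩
      W k (((y ^ value c * y ^ g) * β ^ D′) * mono (values r′))
        ≈⟨ W-cong k k≤′ (*-congʳ (*-congʳ (trans (sym (^-homo-* y (value c) g)) (reflexive (≡.cong (y ^_) exp-eq))))) ⟩
      W k (F * mono (values r′))
        ≈⟨ W-scale k k≤′ (λ j j<k → Inv-* (Inv-^ (dropExponent (c ∷ r) r′) (swap-x-upper j<k (ℕ.<-≤-trans j<k k≤′))) (Inv-^ D′ (swap-β j))) _ ⟩
      F * W k (mono (values r′))
        ≈⟨ *-congˡ (W-completions k false r′ k≤′ len′ (RowStep-Linked s)) ⟩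
      F * sumOver weight (completions k false r′)
        ≈⟨ sumOver-*ˡ F weight (completions k false r′) ⟩
      sumOver (λ P → F * weight P) (completions k false r′)
        ≈⟨ sumOver-cong (completions k false r′) (λ P∈ → weight-∷ (∈-completions⁻ k false r′ (RowStep-Linked s) P∈)) ⟩
      sumOver (λ P → weight ((c ∷ r) ∷ P)) (completions k false r′)
        ≈⟨ sym (sumOver-map weight ((c ∷ r) ∷_) (completions k false r′)) ⟩
      sumOver weight (map ((c ∷ r) ∷_) (completions k false r′)) ∎
      where
      g = gap (c ∷ r) r′
      D′ = rowNonCirc r′
      F = y ^ dropExponent (c ∷ r) r′ * β ^ D′
      len′ : length r′ ≡ k
      len′ = ≡.trans (RowStep-length s) (≡.cong ℕ.pred e)
      exp-eq : value c ℕ.+ g ≡ dropExponent (c ∷ r) r′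
      exp-eq = ≡.sym (≡.trans (≡.cong (_∸ rowSum r′) (gap-eq s)) (ℕ.m+n∸n≡m _ (rowSum r′)))
      weight-∷ : ∀ {P} → Completion k false r′ P → F * weight P ≈ weight ((c ∷ r) ∷ P)
      weight-∷ {P} t = *-congʳ (reflexive (≡.cong₂ (λ l r″ → x l ^ dropExponent (c ∷ r) r″ * β ^ rowNonCirc r″)
        (≡.sym (Completion-length t)) (≡.sym (Completion-head len′ t))))

-- Efficient enhanced patterns as sequences of local steps

module Characterisation where
  open ≡
  open import Data.Nat.Base using (_+_)

  -- The defaults are those of `val`, `circ`, `eL` and `eR`, so the fields of `cellAt P i j` reduce
  -- to these functions.
  cellOf : Maybe Cell → Cell
  cellOf m = cell (maybe Cell.val 0 m) (maybe Cell.circ false m) (maybe Cell.eL false m) (maybe Cell.eR false m)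

  cellAt : Pattern → ℕ → ℕ → Cell
  cellAt P i j = cellOf (entry P i j)

  rowFlag : Bool → ℕ → Bool
  rowFlag b zero    = b
  rowFlag b (suc _) = false

  StepAt : Bool → Pattern → ℕ → ℕ → Set
  StepAt b P i j = CellStep (rowFlag b i) (cellAt P i j) (cellAt P i (suc j)) (cellAt P (suc i) j)

  Steps : ℕ → Bool → Pattern → Set
  Steps n b P = ∀ i j → Valid n (suc i) j → StepAt b P i j

  cellStep-at : Bool → List Cell → List Cell → ℕ → Set
  cellStep-at b r r′ j = CellStep b (cellOf (nth r j)) (cellOf (nth r (suc j))) (cellOf (nth r′ j))

  RowStep⁻ : ∀ {b r r′} → RowStep b r r′ → ∀ j → j < length r′ → cellStep-at b r r′ j
  RowStep⁻ (s ∷ ss) zero    j<       = s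
  RowStep⁻ (s ∷ ss) (suc j) (s≤s j<) = RowStep⁻ ss j j<

  RowStep⁺ : ∀ {b} r r′ → length r′ ≡ ℕ.pred (length r) → (∀ j → j < length r′ → cellStep-at b r r′ j) → RowStep b r r′
  RowStep⁺ []          []       e h = []
  RowStep⁺ (c ∷ [])    []       e h = [-]
  RowStep⁺ (c ∷ d ∷ r) (e ∷ r′) p h = h 0 (s≤s z≤n) ∷ RowStep⁺ (d ∷ r) r′ (cong ℕ.pred p) (λ j j< → h (suc j) (s≤s j<))

  Completion-Shape : ∀ {n b r P} → length r ≡ n → Completion n b r P → Shape n P
  Completion-Shape e []                = refl , λ _ ()
  Completion-Shape {suc n} {P = r ∷ P} e (s ∷ t) with ih ← Completion-Shape (trans (RowStep-length s) (cong ℕ.pred e)) t =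
    cong suc (proj₁ ih) , λ { zero i< → e ; (suc i) (s≤s i<) → proj₂ ih i i< }

  Completion-top : ∀ {n b r P} → 0 < n → Completion n b r P → row P 0 ≡ r
  Completion-top 0<n (s ∷ t) = refl

  Completion-Steps : ∀ {n b r P} → length r ≡ n → Completion n b r P → Steps n b P
  Completion-Steps e (_∷_ {k = suc k} {r′ = r′} s (s′ ∷ t)) zero (suc j) (_ , 1≤j , j≤) =
    RowStep⁻ s j (subst (j <_) (sym (trans (RowStep-length s) (cong ℕ.pred e))) j≤)
  Completion-Steps e (_∷_ {k = zero} s []) zero j (s≤s () , _)
  Completion-Steps {b = b} e (_∷_ {k = k} {P = P} s t) (suc i) j (s≤s i< , 1≤j , j≤) =
    subst (λ f → CellStep f (cellAt P i j) (cellAt P i (suc j)) (cellAt P (suc i) j)) (flag i)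
      (Completion-Steps (trans (RowStep-length s) (cong ℕ.pred e)) t i j (i< , 1≤j , j≤))
    where
    flag : ∀ i → rowFlag false i ≡ false
    flag zero    = refl
    flag (suc i) = refl

  Completion⁺ : ∀ n b r P → Shape n P → (0 < n → row P 0 ≡ r) → Steps n b P → Completion n b r P
  Completion⁺ zero    b r []      sh top st = []
  Completion⁺ (suc n) b r (r₀ ∷ P) (l , ls) top st with refl ← top (s≤s z≤n) =
    RowStep⁺ r₀ (row P 0) len below ∷
    Completion⁺ n false (row P 0) P (cong ℕ.pred l , λ i i< → ls (suc i) (s≤s i<)) (λ _ → refl)
      (λ i j v → subst (λ f → CellStep f (cellAt P i j) (cellAt P i (suc j)) (cellAt P (suc i) j)) (flag i)
        (st (suc i) j (s≤s (proj₁ v) , proj₂ v)))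
    where
    flag : ∀ i → false ≡ rowFlag false i
    flag zero    = refl
    flag (suc i) = refl
    head-length : ∀ m P → length P ≡ m → (∀ i → i < suc m → length (row (r₀ ∷ P) i) ≡ suc m ∸ i) → length (row P 0) ≡ m
    head-length zero    []      l ls = refl
    head-length (suc m) (_ ∷ _) l ls = ls 1 (s≤s (s≤s z≤n))
    len₀ : length (row P 0) ≡ n
    len₀ = head-length n P (cong ℕ.pred l) ls
    len : length (row P 0) ≡ ℕ.pred (length r₀)
    len = trans len₀ (cong ℕ.pred (sym (ls 0 (s≤s z≤n))))
    below : ∀ j → j < length (row P 0) → cellStep-at b r₀ (row P 0) j
    below j j< = st 0 (suc j) (s≤s (ℕ.≤-trans (s≤s z≤n) j<n) , s≤s z≤n , j<n)
      where j<n = subst (j <_) len₀ j<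

  step-circ-L : ∀ {b c d e} → CellStep b c d e → T (Cell.eL e) → value e ≡ value c × T (Cell.circ e)
  step-circ-L (flat _) t = refl , tt
  step-circ-L (low _)  t = refl , tt

  step-circ-R : ∀ {b c d e} → CellStep b c d e → T (Cell.eR e) → value e ≡ value d × T (Cell.circ e)
  step-circ-R (flat c≡d) t = c≡d , tt
  step-circ-R (circled _ _) t = ℕ.≡ᵇ⇒≡ _ _ t , tt

  step-both : ∀ {b c d e} → CellStep b c d e → T (Cell.eL e) → T (Cell.eR e) →
              value c ≡ value d × T (b ∨ (Cell.eR c ∧ Cell.eL d))
  step-both (flat c≡d) l r = c≡d , l

  step-flat : ∀ {b c d e} → CellStep b c d e → value c ≡ value d →
              e ≡ cell (value c) true (b ∨ (Cell.eR c ∧ Cell.eL d)) true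
  step-flat (flat _)       c≡d = refl
  step-flat (low c<d)      c≡d = ⊥-elim (ℕ.<⇒≢ c<d c≡d)
  step-flat (uncircled c<v v≤d) c≡d = ⊥-elim (ℕ.<⇒≱ c<v (ℕ.≤-trans v≤d (ℕ.≤-reflexive (sym c≡d))))
  step-flat (circled c<v v≤d) c≡d = ⊥-elim (ℕ.<⇒≱ c<v (ℕ.≤-trans v≤d (ℕ.≤-reflexive (sym c≡d))))

  step-low : ∀ {b c d e} → CellStep b c d e → value c < value d → value e ≡ value c → T (Cell.circ e) × T (Cell.eL e)
  step-low (flat c≡d)   c<d e≡c = ⊥-elim (ℕ.<⇒≢ c<d c≡d)
  step-low (low _)      c<d e≡c = tt , tt
  step-low (uncircled c<v _) c<d e≡c = ⊥-elim (ℕ.<⇒≢ c<v (sym e≡c))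
  step-low (circled c<v _) c<d e≡c = ⊥-elim (ℕ.<⇒≢ c<v (sym e≡c))

  step-high : ∀ {b c d e} → CellStep b c d e → value c < value d → value e ≡ value d → T (Cell.circ e) → T (Cell.eR e)
  step-high (flat c≡d) c<d e≡d t = tt
  step-high (low _)    c<d e≡d t = ⊥-elim (ℕ.<⇒≢ c<d e≡d)
  step-high (circled _ _) c<d e≡d t = ℕ.≡⇒≡ᵇ _ _ e≡d

  T-≡ : ∀ {b} → T b → b ≡ true
  T-≡ {true} _ = refl

  ¬T-≡ : ∀ {b} → ¬ T b → b ≡ false
  ¬T-≡ {true}  h = ⊥-elim (h tt)
  ¬T-≡ {false} h = refl

  T-∧⁺ : ∀ {a b} → T a → T b → T (a ∧ b)
  T-∧⁺ {true} _ t = t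

  T-∧⁻ : ∀ {a b} → T (a ∧ b) → T a × T b
  T-∧⁻ {true} t = tt , t

  T-iff : ∀ {a b} → (T a → T b) → (T b → T a) → a ≡ b
  T-iff {true}  {true}  f g = refl
  T-iff {true}  {false} f g = ⊥-elim (f tt)
  T-iff {false} {true}  f g = ⊥-elim (g tt)
  T-iff {false} {false} f g = refl

  ≡-cell : ∀ {e v c l r} → value e ≡ v → Cell.circ e ≡ c → Cell.eL e ≡ l → Cell.eR e ≡ r → e ≡ cell v c l r
  ≡-cell refl refl refl refl = refl

  module _ {n i j : ℕ} (v : Valid n (suc i) j) where
    private
      i<n : i < n
      i<n = ℕ.<-trans (ℕ.n<1+n i) (proj₁ v)

    suc-bound : suc j ≤ n ∸ i
    suc-bound = ℕ.≤-trans (s≤s (proj₂ (proj₂ v))) (ℕ.≤-reflexive (sym (ℕ.+-∸-assoc 1 (ℕ.<⇒≤ (proj₁ v)))))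

    Valid-left : Valid n i j
    Valid-left = i<n , proj₁ (proj₂ v) , ℕ.<⇒≤ suc-bound

    Valid-right : Valid n i (suc j)
    Valid-right = i<n , s≤s z≤n , suc-bound

  Valid-below : ∀ {n i j} → suc i < n → 1 ≤ j → suc j ≤ n ∸ i → Valid n (suc i) j
  Valid-below {n} {i} i< 1≤j j≤ = i< , 1≤j , ℕ.≤-pred (ℕ.≤-trans j≤ (ℕ.≤-reflexive (ℕ.+-∸-assoc 1 (ℕ.<⇒≤ i<))))

  -- The entry equals both top entries, only the top-left one, or exceeds the top-left one. The
  -- first case is settled by efficiency with (2) to (4), the second by (5) and (2), the third by
  -- (2) and (6).
  Enhanced-Steps : ∀ {n la P} → InP⁺ n la P → Steps n true P
  Enhanced-Steps {n} {la} {P} (enh , eff) i j v = go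
    where
    open Enhanced enh
    vc = val P i j
    vd = val P i (suc j)
    e = cellAt P (suc i) j
    c≤e : vc ≤ value e
    c≤e = proj₁ (gz i j v)
    e≤d : value e ≤ vd
    e≤d = proj₂ (gz i j v)

    flat-eL : vc ≡ vd → T (Cell.eR e) → Cell.eL e ≡ rowFlag true i ∨ (eR P i j ∧ eL P i (suc j))
    flat-eL c≡d r = by-row i v c≡d r
      where
      by-row : ∀ i → (v : Valid n (suc i) j) → val P i j ≡ val P i (suc j) → T (eR P (suc i) j) →
               eL P (suc i) j ≡ rowFlag true i ∨ (eR P i j ∧ eL P i (suc j))
      -- In row 1 the left edge comes from (4). Lower down the right edge is already known, so (3)
      -- makes the left edge equivalent to the two edges above.
      by-row zero    v c≡d r = T-≡ (proj₁ (proj₂ (c4 j (proj₁ (proj₂ v)) (suc-bound v) c≡d)))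
      by-row (suc i) v c≡d r = T-iff
        (λ l → let p , q = proj₂ c3′ (l , r) in T-∧⁺ p q)
        (λ t → proj₁ (proj₁ c3′ (T-∧⁻ t)))
        where c3′ = c3 (suc i) j (s≤s z≤n) (ℕ.≤-trans (ℕ.≤-reflexive (ℕ.+-comm (suc i) 2)) (proj₁ v)) (proj₁ (proj₂ v)) (suc-bound v)

    go : StepAt true P i j
    go with ℕ.m≤n⇒m<n∨m≡n c≤e
    ... | inj₂ c≡e with ℕ.m≤n⇒m<n∨m≡n (ℕ.≤-trans c≤e e≤d)
    ...   | inj₂ c≡d = subst (CellStep _ _ _) (sym (≡-cell (sym c≡e) (T-≡ (proj₂ (c2R i j v r))) (flat-eL c≡d r) (T-≡ r))) (flat c≡d)
      where r = eff i j v c≡d (sym c≡e)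
    ...   | inj₁ c<d = subst (CellStep _ _ _) (sym (≡-cell (sym c≡e) (T-≡ (proj₁ t)) (T-≡ (proj₂ t))
                         (¬T-≡ λ r → ℕ.<⇒≢ c<d (trans c≡e (proj₁ (c2R i j v r)))))) (low c<d)
      where t = c5 i j v c<d (sym c≡e)
    go | inj₁ c<e with circ P (suc i) j in eq
    ...   | false = subst (CellStep _ _ _) (sym (≡-cell refl refl
                      (¬T-≡ λ l → subst T eq (proj₂ (c2L i j v l))) (¬T-≡ λ r → subst T eq (proj₂ (c2R i j v r))))) (uncircled c<e e≤d)
    ...   | true  = subst (CellStep _ _ _) (sym (≡-cell refl refl
                      (¬T-≡ λ l → ℕ.<⇒≢ c<e (sym (proj₁ (c2L i j v l))))
                      (T-iff (λ r → ℕ.≡⇒≡ᵇ _ _ (proj₁ (c2R i j v r)))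
                             (λ t → c6 i j v (ℕ.<-≤-trans c<e e≤d) (ℕ.≡ᵇ⇒≡ _ _ t) (subst T (sym eq) tt))))) (circled c<e e≤d)

  -- Connected components and condition (7)

  module Labels (n : ℕ) (P : Pattern) (st : Steps n true P) where

    Label : Set
    Label = ℕ × ℕ × ℕ

    -- The connected component of a cell: the common value of a component reaching row 0, and otherwise also the
    -- position of the topmost cell (rows of such cells are positive).
    label : ℕ → ℕ → Label
    label zero    j = val P 0 j , 0 , 0
    label (suc i) j = if eR P (suc i) j then label i (suc j) else if eL P (suc i) j then label i j else (val P (suc i) j , suc i , j)

    label-value : ∀ i j → Valid n i j → proj₁ (label i j) ≡ val P i j
    label-value zero    j v = refl
    label-value (suc i) j v with eR P (suc i) j in eqR | eL P (suc i) j in eqL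
    ... | true  | _     = trans (label-value i (suc j) (Valid-right v)) (sym (proj₁ (step-circ-R (st i j v) (subst T (sym eqR) tt))))
    ... | false | true  = trans (label-value i j (Valid-left v)) (sym (proj₁ (step-circ-L (st i j v) (subst T (sym eqL) tt))))
    ... | false | false = refl

    label-row : ∀ i j → proj₁ (proj₂ (label i j)) ≤ i
    label-row zero    j = z≤n
    label-row (suc i) j with eR P (suc i) j | eL P (suc i) j
    ... | true  | _     = ℕ.m≤n⇒m≤1+n (label-row i (suc j))
    ... | false | true  = ℕ.m≤n⇒m≤1+n (label-row i j)
    ... | false | false = ℕ.≤-refl

    label-R : ∀ i j → T (eR P (suc i) j) → label (suc i) j ≡ label i (suc j)
    label-R i j r with eR P (suc i) j
    ... | true = refl

    -- This makes the preference for right edges in `label` immaterial: by (3) the two top entries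
    -- are already joined to a common entry one row higher, and in row 0 the label only records
    -- their equal value.
    label-both : ∀ i j → Valid n (suc i) j → T (eL P (suc i) j) → T (eR P (suc i) j) → label i j ≡ label i (suc j)
    label-L : ∀ i j → Valid n (suc i) j → T (eL P (suc i) j) → label (suc i) j ≡ label i j

    label-both zero    j v l r = cong (λ u → u , 0 , 0) (proj₁ (step-both (st 0 j v) l r))
    label-both (suc i) j v l r = trans (label-R i j (proj₁ t)) (sym (label-L i (suc j) (Valid-right v) (proj₂ t)))
      where t = T-∧⁻ (proj₂ (step-both (st (suc i) j v) l r))

    label-L i j v l with eR P (suc i) j in eqR | eL P (suc i) j in eqL
    ... | true  | true = sym (label-both i j v (subst T (sym eqL) tt) (subst T (sym eqR) tt))
    ... | false | true = refl

    label-edge : ∀ {p q} → Edge n P p q → label (proj₁ p) (proj₂ p) ≡ label (proj₁ q) (proj₂ q)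
    label-edge (edgeL v t) = label-L _ _ v t
    label-edge (edgeR v t) = label-R _ _ t

    label-connected : ∀ {p q} → Connected n P p q → label (proj₁ p) (proj₂ p) ≡ label (proj₁ q) (proj₂ q)
    label-connected = fold (λ p q → label (proj₁ p) (proj₂ p) ≡ label (proj₁ q) (proj₂ q))
      (λ { (inj₁ e) eq → trans (label-edge e) eq ; (inj₂ e) eq → trans (sym (label-edge e)) eq }) refl

    -- The key to (7). Adjacent cells below row 0 in one component must both be joined to their
    -- common upper neighbour; then (3) gives the triangle beneath them both edges.
    label-joined : ∀ i j → Valid n (suc i) j → Valid n (suc i) (suc j) → label (suc i) j ≡ label (suc i) (suc j) →
                   T (eR P (suc i) j) × T (eL P (suc i) (suc j))
    joined-of-equal : ∀ i j → Valid n (suc i) j → Valid n (suc i) (suc j) → label (suc i) j ≡ label (suc i) (suc j) →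
                      val P (suc i) j ≡ val P (suc i) (suc j) → T (eR P (suc i) j) × T (eL P (suc i) (suc j))

    label-joined i j v v′ same = joined-of-equal i j v v′ same
      (trans (sym (label-value (suc i) j v)) (trans (cong proj₁ same) (label-value (suc i) (suc j) v′)))

    joined-of-equal i j v v′ same values≡ with eR P (suc i) j in R | eL P (suc i) j in L | eL P (suc i) (suc j) in L′ | eR P (suc i) (suc j) in R′
    ... | true  | _     | true  | _     = tt , tt
    -- Both labels come from the row above along right edges, so the two top entries of the
    -- right-hand cell share a label. By induction on the row its triangle is flat with a left edge,
    -- contrary to L′.
    ... | true  | _     | false | true  = ⊥-elim (subst T (trans (cong Cell.eL (sym flat′)) L′) (flat-true i same (Valid-left v′) (Valid-right v′)))
      where
      u≡ : val P i (suc j) ≡ val P i (suc (suc j))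
      u≡ = trans (sym (label-value i (suc j) (Valid-right v))) (trans (cong proj₁ same) (label-value i (suc (suc j)) (Valid-right v′)))
      flat′ : cellAt P (suc i) (suc j) ≡ cell (val P i (suc j)) true (rowFlag true i ∨ (eR P i (suc j) ∧ eL P i (suc (suc j)))) true
      flat′ = step-flat (st i (suc j) v′) u≡
      flat-true : ∀ i → label i (suc j) ≡ label i (suc (suc j)) → Valid n i (suc j) → Valid n i (suc (suc j)) →
                  T (rowFlag true i ∨ (eR P i (suc j) ∧ eL P i (suc (suc j))))
      flat-true zero    same w w′ = tt
      flat-true (suc i) same w w′ = let p , q = label-joined i (suc j) w w′ same in T-∧⁺ p q
    -- A cell without upper edges is labelled by its own row i + 1, whereas a label inherited from
    -- above has row at most i. The next three cases are alike; two such cells differ in column.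
    ... | true  | _     | false | false = ⊥-elim (ℕ.1+n≰n (subst (_≤ i) (cong (proj₁ ∘ proj₂) same) (label-row i (suc j))))
    ... | false | false | true  | true  = ⊥-elim (ℕ.1+n≰n (subst (_≤ i) (cong (proj₁ ∘ proj₂) (sym same)) (label-row i (suc (suc j)))))
    ... | false | false | false | true  = ⊥-elim (ℕ.1+n≰n (subst (_≤ i) (cong (proj₁ ∘ proj₂) (sym same)) (label-row i (suc (suc j)))))
    ... | false | false | true  | false = ⊥-elim (ℕ.1+n≰n (subst (_≤ i) (cong (proj₁ ∘ proj₂) (sym same)) (label-row i (suc j))))
    ... | false | false | false | false = ⊥-elim (ℕ.1+n≢n (sym (cong (proj₂ ∘ proj₂) same)))
    -- A left edge and equal values squeeze the triangle of the left-hand cell flat, so it also has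
    -- a right edge, contrary to R.
    ... | false | true  | _ | _ = ⊥-elim (subst T (trans (sym (cong Cell.eR (step-flat (st i j v) c≡d))) R) tt)
      where
      c≡d : val P i j ≡ val P i (suc j)
      c≡d = ℕ.≤-antisym (ℕ.≤-trans (proj₁ (step-bounds (st i j v))) (proj₂ (step-bounds (st i j v))))
        (ℕ.≤-trans (proj₁ (step-bounds (st i (suc j) v′))) (ℕ.≤-reflexive (trans (sym values≡) (proj₁ (step-circ-L (st i j v) (subst T (sym L) tt))))))

  topCell : ∀ {n} → Vec ℕ n → ℕ → Cell
  topCell {n} la j = cell (vget la (n ∸ suc j)) true false false

  topRow : ∀ {n} → Vec ℕ n → List Cell
  topRow {n} la = applyUpTo (topCell la) n

  nth-applyUpTo : ∀ {A : Set} (f : ℕ → A) n j → j < n → nth (applyUpTo f n) j ≡ just (f j)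
  nth-applyUpTo f (suc n) zero    j<       = refl
  nth-applyUpTo f (suc n) (suc j) (s≤s j<) = nth-applyUpTo (f ∘ suc) n j j<

  nth-ext : ∀ {r s : List Cell} → length r ≡ length s → (∀ j → j < length r → cellOf (nth r j) ≡ cellOf (nth s j)) → r ≡ s
  nth-ext {[]}    {[]}    e h = refl
  nth-ext {c ∷ r} {d ∷ s} e h = cong₂ _∷_ (h 0 (s≤s z≤n)) (nth-ext (cong ℕ.pred e) (λ j j< → h (suc j) (s≤s j<)))

  InP⁺⇒Completion : ∀ {n la P} → InP⁺ n la P → Completion n true (topRow la) P
  InP⁺⇒Completion {n} {la} {P} inP@(enh , _) = Completion⁺ n true (topRow la) P shape top (Enhanced-Steps inP)
    where
    open Enhanced enh
    top : 0 < n → row P 0 ≡ topRow la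
    top 0<n = nth-ext (trans len (sym (List.length-applyUpTo (topCell la) n)))
      λ j j< → let j<n = subst (j <_) len j< in
        trans (≡-cell (top-val (suc j) (s≤s z≤n) j<n) (T-≡ (top-circ (suc j) (s≤s z≤n) j<n))
                      (top-noL (suc j) (s≤s z≤n) j<n) (top-noR (suc j) (s≤s z≤n) j<n))
              (sym (cong cellOf (nth-applyUpTo (topCell la) n j j<n)))
      where
      len : length (row P 0) ≡ n
      len = proj₂ shape 0 0<n

  Completion⇒InP⁺ : ∀ {n la P} → Completion n true (topRow la) P → InP⁺ n la P
  Completion⇒InP⁺ {n} {la} {P} t = record
    { shape    = Completion-Shape len t
    ; top-val  = λ j 1≤j j≤n → trans (cong value (top j 1≤j j≤n)) (cong (λ k → vget la (n ∸ k)) (suc-pred 1≤j))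
    ; top-circ = λ j 1≤j j≤n → subst T (sym (cong Cell.circ (top j 1≤j j≤n))) tt
    ; top-noL  = λ j 1≤j j≤n → cong Cell.eL (top j 1≤j j≤n)
    ; top-noR  = λ j 1≤j j≤n → cong Cell.eR (top j 1≤j j≤n)
    ; gz       = λ i j v → step-bounds (st i j v)
    ; c2L      = λ i j v → step-circ-L (st i j v)
    ; c2R      = λ i j v → step-circ-R (st i j v)
    ; c3       = c3
    ; c4       = λ j 1≤j j<n e → let s = step-flat (st 0 j (Valid-below (ℕ.≤-trans (s≤s 1≤j) j<n) 1≤j j<n)) e in
                   true-T (cong Cell.circ s) , true-T (cong Cell.eL s) , true-T (cong Cell.eR s)
    ; c5       = λ i j v → step-low (st i j v)
    ; c6       = λ i j v → step-high (st i j v)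
    ; c7       = λ i j v c≡d _ con → let s = step-flat (st i j v) c≡d in
                   true-T (cong Cell.circ s) , subst T (sym (cong Cell.eL s)) (c7-L i j v con) , true-T (cong Cell.eR s)
    ; c8       = λ i j v c≡d _ _ → inj₂ (true-T (cong Cell.eR (step-flat (st i j v) c≡d)))
    } , λ i j v c≡d _ → true-T (cong Cell.eR (step-flat (st i j v) c≡d))
    where
    len : length (topRow la) ≡ n
    len = List.length-applyUpTo (topCell la) n
    st : Steps n true P
    st = Completion-Steps len t
    open Labels n P st
    true-T : ∀ {b} → b ≡ true → T b
    true-T refl = tt
    suc-pred : ∀ {j} → 1 ≤ j → suc (ℕ.pred j) ≡ j
    suc-pred {suc j} _ = refl
    top : ∀ j → 1 ≤ j → j ≤ n → cellAt P 0 j ≡ topCell la (ℕ.pred j)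
    top (suc j) 1≤j j≤n = cong cellOf
      (trans (cong (λ r → nth r j) (Completion-top (ℕ.≤-trans (s≤s z≤n) j≤n) t)) (nth-applyUpTo (topCell la) n j j≤n))
    c3 : ∀ i j → 1 ≤ i → i + 2 ≤ n → 1 ≤ j → suc j ≤ n ∸ i →
         ((T (eR P i j) × T (eL P i (suc j))) → (T (eL P (suc i) j) × T (eR P (suc i) j)))
       × ((T (eL P (suc i) j) × T (eR P (suc i) j)) → (T (eR P i j) × T (eL P i (suc j))))
    c3 (suc i) j 1≤i i≤ 1≤j j≤ = up , down
      where
      v : Valid n (suc (suc i)) j
      v = Valid-below (ℕ.≤-trans (ℕ.≤-reflexive (ℕ.+-comm 2 (suc i))) i≤) 1≤j j≤
      s = st (suc i) j v
      up : T (eR P (suc i) j) × T (eL P (suc i) (suc j)) → T (eL P (suc (suc i)) j) × T (eR P (suc (suc i)) j)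
      up (r , l) = subst T (sym (cong Cell.eL f)) (T-∧⁺ r l) , true-T (cong Cell.eR f)
        where
        f = step-flat s (trans (proj₁ (step-circ-R (st i j (Valid-left v)) r)) (sym (proj₁ (step-circ-L (st i (suc j) (Valid-right v)) l))))
      down : T (eL P (suc (suc i)) j) × T (eR P (suc (suc i)) j) → T (eR P (suc i) j) × T (eL P (suc i) (suc j))
      down (l , r) = T-∧⁻ (proj₂ (step-both s l r))
    c7-L : ∀ i j → Valid n (suc i) j → Connected n P (i , j) (i , suc j) → T (rowFlag true i ∨ (eR P i j ∧ eL P i (suc j)))
    c7-L zero    j v con = tt
    -- A path keeps the label constant, however far it strays, so the two top cells are joined to
    -- their common upper neighbour.
    c7-L (suc i) j v con = let p , q = label-joined i j (Valid-left v) (Valid-right v) (label-connected con) in T-∧⁺ p q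

-- Evaluation of words and weights, and the theorem

open ≡
open PolynomialRing
open Characterisation

vget-replicate : ∀ n k → vget (replicate n 0) k ≡ 0
vget-replicate zero    k       = refl
vget-replicate (suc n) zero    = refl
vget-replicate (suc n) (suc k) = vget-replicate n k

vget-≥ : ∀ {n} (v : Vec ℕ n) k → n ≤ k → vget v k ≡ 0
vget-≥ []      k       n≤k       = refl
vget-≥ (a ∷ v) (suc k) (s≤s n≤k) = vget-≥ v k n≤k

vget-zero : ∀ {n} (v : Vec ℕ n) → (∀ k → vget v k ≡ 0) → v ≡ replicate n 0
vget-zero []      h = refl
vget-zero (a ∷ v) h = cong₂ _∷_ (h 0) (vget-zero v (h ∘ suc))

vget-vset : ∀ {n} (v : Vec ℕ n) k → vget (vset v k 0) k ≡ 0
vget-vset []      k       = refl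
vget-vset (a ∷ v) zero    = refl
vget-vset (a ∷ v) (suc k) = vget-vset v k

vget-vset-other : ∀ {n} (v : Vec ℕ n) j k → j ≢ k → vget (vset v j 0) k ≡ vget v k
vget-vset-other []      j       k       j≢k = refl
vget-vset-other (a ∷ v) zero    zero    j≢k with () ← j≢k refl
vget-vset-other (a ∷ v) zero    (suc k) j≢k = refl
vget-vset-other (a ∷ v) (suc j) zero    j≢k = refl
vget-vset-other (a ∷ v) (suc j) (suc k) j≢k = vget-vset-other v j k (j≢k ∘ cong suc)

vget-tabulate : ∀ n (h : ℕ → ℕ) k → k < n → vget (tabulate {n = n} (h ∘ toℕ)) k ≡ h k
vget-tabulate (suc n) h zero    k<       = refl
vget-tabulate (suc n) h (suc k) (s≤s k<) = vget-tabulate n (h ∘ suc) k k<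

vset-⊕ : ∀ {n} (w : Vec ℕ n) m → vset (replicate n 0) m (vget w m) ⊕ vset w m 0 ≡ w
vset-⊕ []      m       = refl
vset-⊕ (a ∷ w) zero    = cong₂ _∷_ (ℕ.+-identityʳ a) (Vec.zipWith-identityˡ ℕ.+-identityˡ w)
vset-⊕ (a ∷ w) (suc m) = cong (a ∷_) (vset-⊕ w m)

vset-zero : ∀ n k → vset (replicate n 0) k 0 ≡ replicate n 0
vset-zero zero    k       = refl
vset-zero (suc n) zero    = refl
vset-zero (suc n) (suc k) = cong (0 ∷_) (vset-zero n k)

unit-⊕-vset : ∀ n k c → unit n k ⊕ vset (replicate n 0) k c ≡ vset (replicate n 0) k (suc c)
unit-⊕-vset zero    k       c = refl
unit-⊕-vset (suc n) zero    c = cong (suc c ∷_) (Vec.zipWith-identityˡ ℕ.+-identityˡ _)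
unit-⊕-vset (suc n) (suc k) c = cong (0 ∷_) (unit-⊕-vset n k c)

reflect : ∀ {k n} → k < n → n ∸ suc (n ∸ suc k) ≡ k
reflect {k} {n} k<n = trans (cong (n ∸_) (sym (ℕ.+-∸-assoc 1 k<n))) (ℕ.m∸[m∸n]≡n (ℕ.<⇒≤ k<n))

module Evaluation (n : ℕ) where
  open FormalSums n using (_≋_; at; mk; ⟨_∣_⟩; ≋-refl; ≋-sym; ≋-trans; ≋-reflexive; pair-cong; pair-++; pair-map; pair-⊛; ++-cong; _⊛_; ∙-comm)
  open PolynomialOperators n
  open Operators swapRing
  open Sums swapRing
  open SwapRing swapRing using (*-cong; *-congˡ)

  -- A coefficient is the pairing with the indicator function of its monomial.
  coeff-pair : ∀ p k d → coeff p k d ≡ ⟨ p ∣ (λ { (l , a) → if (k ≡ᵇ l) ∧ does (Vec.≡-dec ℕ._≟_ d a) then + 1 else + 0 }) ⟩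
  coeff-pair []                k d = refl
  coeff-pair ((c , l , a) ∷ p) k d with (k ≡ᵇ l) ∧ does (Vec.≡-dec ℕ._≟_ d a)
  ... | true  = cong₂ ℤ._+_ (sym (ℤ.*-identityʳ c)) (coeff-pair p k d)
  ... | false = trans (coeff-pair p k d) (sym (trans (cong (λ z → z ℤ.+ ⟨ p ∣ _ ⟩) (ℤ.*-zeroʳ c)) (ℤ.+-identityˡ _)))

  ≋⇒≈ₚ : ∀ {p q} → p ≋ q → p ≈ₚ q
  ≋⇒≈ₚ {p} {q} e k d = trans (coeff-pair p k d) (trans (at e _) (sym (coeff-pair q k d)))

  pair-mulMono : ∀ b e p φ → ⟨ mulMono b e p ∣ φ ⟩ ≡ ⟨ p ∣ (λ { (k , a) → φ (k ℕ.+ b , a ⊕ e) }) ⟩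
  pair-mulMono b e p φ = trans
    (pair-map _ (+ 1) (λ { (k , a) → k ℕ.+ b , a ⊕ e }) (λ { c (k , a) → cong (_, _) (sym (ℤ.*-identityˡ c)) }) p φ)
    (ℤ.*-identityˡ _)

  mulMono-⊛ : ∀ b e p → mulMono b e p ≋ ((+ 1 , b , e) ∷ []) ⊛ p
  mulMono-⊛ b e p .at φ = trans (pair-mulMono b e p φ) (sym (trans (pair-⊛ ((+ 1 , b , e) ∷ []) p φ)
    (trans (trans (ℤ.+-identityʳ _) (ℤ.*-identityˡ _)) (pair-cong p (λ m → cong φ (∙-comm (b , e) m))))))

  ∂-cong : ∀ i {p q} → p ≋ q → ∂ i p ≋ ∂ i q
  ∂-cong i {p} {q} e .at φ = trans (pair-∂ i p φ) (trans (at e _) (sym (pair-∂ i q φ)))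

  πβ-π : ∀ i {p q} → p ≋ q → πβ (suc i) p ≋ π i q
  πβ-π i {p} {q} e = ∂-cong (suc i) (++-cong
    {mulMono 0 (unit n i) p} {var i ⊛ q} {mulMono 1 (unit n i ⊕ unit n (suc i)) p} {(βₚ ⊛ (var i ⊛ var (suc i))) ⊛ q}
    (≋-trans (mulMono-⊛ 0 (unit n i) p) (*-congˡ {var i} e))
    (≋-trans (mulMono-⊛ 1 (unit n i ⊕ unit n (suc i)) p) (*-cong {y = βₚ ⊛ (var i ⊛ var (suc i))}
      (pair-term refl (cong (1 ,_) (sym (Vec.zipWith-identityˡ ℕ.+-identityˡ _)))) e)))

  applyWord-desc : ∀ k {p q} → p ≋ q → applyWord (desc k) p ≋ C k q
  applyWord-desc zero    e = e
  applyWord-desc (suc k) e = applyWord-desc k (πβ-π k e)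

  applyWord-++ : ∀ u v (p : Poly n) → applyWord (u ++ v) p ≡ applyWord v (applyWord u p)
  applyWord-++ []      v p = refl
  applyWord-++ (i ∷ u) v p = applyWord-++ u v (πβ i p)

  -- `applyUpTo` unfolds at the front, whereas `W` splits off the block applied last.
  w0word-suc : ∀ k → concatMap desc (applyUpTo suc (suc k)) ≡ concatMap desc (applyUpTo suc k) ++ desc (suc k)
  w0word-suc k = begin
    concatMap desc (applyUpTo suc (suc k))                       ≡⟨ cong (concatMap desc) (sym (List.applyUpTo-∷ʳ suc k)) ⟩
    concatMap desc (applyUpTo suc k ++ suc k ∷ [])               ≡⟨ List.concatMap-++ desc (applyUpTo suc k) (suc k ∷ []) ⟩
    concatMap desc (applyUpTo suc k) ++ concatMap desc (suc k ∷ []) ≡⟨ cong (concatMap desc (applyUpTo suc k) ++_) (List.++-identityʳ _) ⟩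
    concatMap desc (applyUpTo suc k) ++ desc (suc k)             ∎
    where open ≡-Reasoning

  applyWord-w0 : ∀ k (p : Poly n) → applyWord (concatMap desc (applyUpTo suc (k ∸ 1))) p ≋ W k p
  applyWord-w0 zero          p = ≋-refl
  applyWord-w0 (suc zero)    p = ≋-refl
  applyWord-w0 (suc (suc k)) p = ≋-trans
    (≋-reflexive (trans (cong (λ w → applyWord w p) (w0word-suc k)) (applyWord-++ (concatMap desc (applyUpTo suc k)) (desc (suc k)) p)))
    (applyWord-desc (suc k) (applyWord-w0 (suc k) p))

  var-^ : ∀ k c → var k ^ c ≋ (+ 1 , 0 , vset (replicate n 0) k c) ∷ []
  var-^ k zero    = pair-term refl (cong (0 ,_) (sym (vset-zero n k)))
  var-^ k (suc c) = ≋-trans (*-congˡ {var k} (var-^ k c)) (pair-term refl (cong (0 ,_) (unit-⊕-vset n k c)))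

  β-^ : ∀ b → βₚ ^ b ≋ (+ 1 , b , replicate n 0) ∷ []
  β-^ zero    = ≋-refl
  β-^ (suc b) = ≋-trans (*-congˡ {βₚ} (β-^ b)) (pair-term refl (cong (suc b ,_) (Vec.zipWith-identityˡ ℕ.+-identityˡ _)))

  -- The head of the list belongs to x_{m-1}. Removing it clears that coordinate of w, so the
  -- hypothesis that w vanishes from m on reproduces itself.
  mono-eval : ∀ m g (w : Vec ℕ n) → (∀ k → k < m → vget w k ≡ g (m ∸ suc k)) → (∀ k → m ≤ k → vget w k ≡ 0) →
              mono (applyUpTo g m) ≋ (+ 1 , 0 , w) ∷ []
  mono-eval zero    g w h z = pair-term refl (cong (0 ,_) (sym (vget-zero w (λ k → z k z≤n))))
  mono-eval (suc m) g w h z = ≋-trans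
    (*-cong (≋-trans (≋-reflexive (cong (λ l → var l ^ g 0) (List.length-applyUpTo (g ∘ suc) m))) (var-^ m (g 0)))
            (mono-eval m (g ∘ suc) (vset w m 0) h′ z′))
    (pair-term refl (cong (0 ,_) (trans (cong (λ c → vset (replicate n 0) m c ⊕ vset w m 0) (sym head)) (vset-⊕ w m))))
    where
    head : vget w m ≡ g 0
    head = trans (h m (ℕ.n<1+n m)) (cong g (ℕ.n∸n≡0 m))
    h′ : ∀ k → k < m → vget (vset w m 0) k ≡ g (suc (m ∸ suc k))
    h′ k k<m = trans (vget-vset-other w m k (ℕ.>⇒≢ k<m)) (trans (h k (ℕ.m<n⇒m<1+n k<m)) (cong g (ℕ.+-∸-assoc 1 k<m)))
    z′ : ∀ k → m ≤ k → vget (vset w m 0) k ≡ 0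
    z′ k m≤k with ℕ.m≤n⇒m<n∨m≡n m≤k
    ... | inj₁ m<k  = trans (vget-vset-other w m k (ℕ.<⇒≢ m<k)) (z k m<k)
    ... | inj₂ refl = vget-vset w m

  values-topRow : (la : Vec ℕ n) → values (topRow la) ≡ applyUpTo (λ j → vget la (n ∸ suc j)) n
  values-topRow la = List.map-applyUpTo (topCell la) value n

  mono-topRow : (la : Vec ℕ n) → mono (values (topRow la)) ≋ xPow la
  mono-topRow la = ≋-trans (≋-reflexive (cong mono (values-topRow la)))
    (mono-eval n _ la (λ k k<n → cong (vget la) (sym (reflect k<n))) (vget-≥ la))

  drops : Pattern → List ℕ
  drops P = applyUpTo (λ i → dropExponent (row P i) (row P (suc i))) (length P)

  weight-drops : ∀ r P → weight (r ∷ P) ≋ (βₚ ^ rk P) ⊛ mono (drops (r ∷ P))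
  weight-drops r []       = solve 1 (λ u → (u :* con (+ 1)) :* con (+ 1) := con (+ 1) :* (u :* con (+ 1))) ≋-refl (var 0 ^ dropExponent r [])
  weight-drops r (r′ ∷ P) = ≋-trans
    (*-congˡ {var (length (r′ ∷ P)) ^ dropExponent r r′ ⊛ βₚ ^ rowNonCirc r′} (weight-drops r′ P))
    (≋-trans (solve 4 (λ u b c m → (u :* b) :* (c :* m) := (b :* c) :* (u :* m)) ≋-refl (var (length (r′ ∷ P)) ^ dropExponent r r′) _ _ _)
      (*-cong (≋-sym (^-homo-* βₚ (rowNonCirc r′) (rk P)))
        (*-cong (≋-reflexive (cong (λ l → var l ^ dropExponent r r′) (sym (List.length-applyUpTo (λ i → dropExponent (row (r′ ∷ P) i) (row (r′ ∷ P) (suc i))) (length (r′ ∷ P)))))) (≋-refl {mono (drops (r′ ∷ P))}))))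

  mono-drops : ∀ P → length P ≡ n → mono (drops P) ≋ (+ 1 , 0 , dexp n P) ∷ []
  mono-drops P refl = mono-eval n _ (dexp n P)
    -- The variable numbered k belongs to the step from row n - 1 - k to row n - k, hence the shift
    -- by one.
    (λ k k<n → trans (vget-tabulate n (λ k → h (n ∸ k)) k k<n) (cong h (ℕ.+-∸-assoc 1 k<n))) (vget-≥ (dexp n P))
    where
    h : ℕ → ℕ
    h i = (S P (i ∸ 1) ℕ.+ D P i) ∸ S P i

  rowNonCirc-applyUpTo : ∀ (f : ℕ → Cell) m → (∀ j → Cell.circ (f j) ≡ true) → rowNonCirc (applyUpTo f m) ≡ 0
  rowNonCirc-applyUpTo f zero    h = refl
  rowNonCirc-applyUpTo f (suc m) h rewrite h 0 = rowNonCirc-applyUpTo (f ∘ suc) m (h ∘ suc)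

  weight-xP : ∀ {la : Vec ℕ n} {P} → length P ≡ n → Completion n true (topRow la) P → weight P ≋ xP n P ∷ []
  weight-xP len []                 = ≋-refl
  weight-xP {la} len (_∷_ {P = P} s t) = ≋-trans (weight-drops (topRow la) P)
    (≋-trans (*-cong (β-^ (rk P)) (mono-drops (topRow la ∷ P) len))
      (pair-term refl (cong₂ _,_
        -- `weight` counts uncircled entries below row 0 only; row 0 is fully circled, so the count
        -- is the rank.
        (trans (ℕ.+-identityʳ _) (cong (ℕ._+ rk P) (sym (rowNonCirc-applyUpTo (topCell la) n (λ _ → refl)))))
        (Vec.zipWith-identityˡ ℕ.+-identityˡ _))))

  sumOver-weight : ∀ {la : Vec ℕ n} Ps → (∀ {P} → P ∈ Ps → Completion n true (topRow la) P) → sumOver weight Ps ≋ map (xP n) Ps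
  sumOver-weight []       h = ≋-refl
  sumOver-weight {la} (P ∷ Ps) h = ++-cong (weight-xP {la} (Completion-length (h (here refl))) (h (here refl))) (sumOver-weight {la} Ps (h ∘ there))

vget-decreasing : ∀ {n} (la : Vec ℕ n) → Partition la → ∀ k → vget la (suc k) ≤ vget la k
vget-decreasing []           l       k       = z≤n
vget-decreasing (a ∷ [])     l       k       = z≤n
vget-decreasing (a ∷ b ∷ la) (b≤a ∷ l) zero    = b≤a
vget-decreasing (a ∷ b ∷ la) (b≤a ∷ l) (suc k) = vget-decreasing (b ∷ la) l k

topRow-Linked : ∀ {n} (la : Vec ℕ n) → Partition la → Linked _≤_ (values (topRow la))
topRow-Linked {n} la l = subst (Linked _≤_) (sym (Evaluation.values-topRow n la)) (Linked.applyUpTo⁺₁ _ n step)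
  where
  step : ∀ {i} → suc i < n → vget la (n ∸ suc i) ≤ vget la (n ∸ suc (suc i))
  step {i} i< = subst (λ k → vget la k ≤ vget la (n ∸ suc (suc i))) (sym (ℕ.+-∸-assoc 1 i<)) (vget-decreasing la l _)

theorem4p12 : (n : ℕ) (la : Vec ℕ n) → Partition la →
    Σ (List Pattern) (λ Ps →
    (∀ P → P ∈ Ps → InP⁺ n la P)
    × (∀ P → InP⁺ n la P → P ∈ Ps)
    × Unique Ps
    × Gβ la ≈ₚ map (xP n) Ps)
theorem4p12 n la l = completions n true (topRow la) ,
  (λ P i → Completion⇒InP⁺ {la = la} (sound i)) ,
  (λ P inP → ∈-completions⁺ (InP⁺⇒Completion {la = la} inP)) ,
  completions-unique n true (topRow la) linked len ,
  ≋⇒≈ₚ (≋-trans (applyWord-w0 n (xPow la)) (≋-trans (W-cong n ℕ.≤-refl (≋-sym (mono-topRow la)))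
    (≋-trans (W-completions n true (topRow la) ℕ.≤-refl len linked) (sumOver-weight {la} (completions n true (topRow la)) sound))))
  where
  open Evaluation n
  open FormalSums n using (≋-trans; ≋-sym)
  open Operators (PolynomialOperators.swapRing n) using (W-cong)
  open Sums (PolynomialOperators.swapRing n) using (W-completions)
  linked = topRow-Linked la l
  len : length (topRow la) ≡ n
  len = List.length-applyUpTo (topCell la) n
  sound : ∀ {P} → P ∈ completions n true (topRow la) → Completion n true (topRow la) P
  sound = ∈-completions⁻ n true (topRow la) linked
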